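{- There is an absolute constant $c$ such that every $n$-vertex graph $G$ with at least one edge, maximum degree $\Delta(G)$, path-width $\mathrm{pw}(G)$, tree-partition-width $\mathrm{tpw}(G)$ and tree-width $\mathrm{tw}(G)$ has three-dimensional drawings of each of the following dimensions: (a) $c\,\mathrm{pw}(G)\times c\,\mathrm{pw}(G)\times c\,n$, and hence $c\,\mathrm{tw}(G)\log n\times c\,\mathrm{tw}(G)\log n\times c\,n$ (for $n\ge2$); (b) $c\,\mathrm{tpw}(G)\times c\,\mathrm{tpw}(G)\times c\,n$, and hence $c\,\Delta(G)\mathrm{tw}(G)\times c\,\Delta(G)\mathrm{tw}(G)\times c\,n$; (c) $c\,T\times c\,T\times c\,n$ where $T=3^{\mathrm{tw}(G)}\cdot 6^{(4^{\mathrm{tw}(G)}-3\,\mathrm{tw}(G)-1)/9}$.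
   Context: A three-dimensional drawing of a graph represents the vertices by distinct points of $\mathbb{Z}^3$ and each edge by the straight line-segment between its end-vertices, such that edges intersect only at common end-vertices and an edge meets a vertex only if it is an end-vertex of that edge; an $X\times Y\times Z$ drawing is one contained in an axis-aligned box with side lengths $X-1,Y-1,Z-1$; a drawing fitting in a smaller box also counts as fitting in a larger one. A tree-partition of $G$ is a tree $T'$ with pairwise disjoint bags covering $V(G)$, indexed by $V(T')$, such that every edge of $G$ lies inside a bag or between bags of adjacent nodes of $T'$; its width is the maximum bag size, and $\mathrm{tpw}(G)$ the minimum width. $\log$ is the binary logarithm. -}

module Defs where

open import Data.Nat as ℕ using (ℕ; zero; suc; _≤_; _⊔_)
open import Data.Integer as ℤ using (ℤ; +_)
open import Data.Fin using (Fin; zero; suc; toℕ; inject₁; _≟_)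
open import Data.Fin.Subset using (Subset; _∈_; ∣_∣)
open import Data.Vec using (tabulate)
open import Data.List using (foldr; filter; length; map; allFin)
open import Data.Bool using (Bool; true; false; T)
open import Data.Product using (Σ; ∃; ∃-syntax; _×_; _,_)
open import Data.Sum using (_⊎_)
open import Relation.Binary.PropositionalEquality using (_≡_; _≢_)
open import Relation.Nullary using (¬_; does)

record Graph (n : ℕ) : Set where
  field
    adj     : Fin n → Fin n → Bool
    adj-sym : ∀ u v → adj u v ≡ adj v u
    adj-irr : ∀ u → adj u u ≡ false
open Graph public

Edge : ∀ {n} → Graph n → Fin n → Fin n → Set
Edge G u v = adj G u v ≡ true

HasEdge : ∀ {n} → Graph n → Set
HasEdge G = ∃[ u ] ∃[ v ] Edge G u v

deg : ∀ {n} → Graph n → Fin n → ℕ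
deg {n} G v = length (filter (λ u → T? (adj G v u)) (allFin n))
  where
  open import Relation.Nullary.Decidable using () renaming (T? to T?′)
  T? = T?′

maxDeg : ∀ {n} → Graph n → ℕ
maxDeg {n} G = foldr _⊔_ 0 (map (deg G) (allFin n))

-- Trees, given as rooted trees on nodes Fin (suc m) with a parent
-- pointer: node (suc i) has parent (par i), whose index is ≤ i.
-- Every finite tree admits such a labelling (e.g. in BFS order).

record Tree (m : ℕ) : Set where
  field
    par    : Fin m → Fin (suc m)
    par-le : ∀ i → toℕ (par i) ≤ toℕ i
open Tree public

TAdj : ∀ {m} → Tree m → Fin (suc m) → Fin (suc m) → Set
TAdj T x y = ∃[ i ] ((x ≡ suc i × y ≡ par T i) ⊎ (y ≡ suc i × x ≡ par T i))

pathTree : (m : ℕ) → Tree m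
pathTree m = record { par = inject₁ ; par-le = λ i → le i }
  where
  open import Data.Fin.Properties using (toℕ-inject₁)
  open import Data.Nat.Properties using (≤-reflexive)
  le : ∀ i → toℕ (inject₁ i) ≤ toℕ i
  le i = ≤-reflexive (toℕ-inject₁ i)

data WalkIn {X : Set} (A : X → X → Set) (S : X → Set) : X → X → Set where
  here : ∀ {x} → S x → WalkIn A S x x
  step : ∀ {x y z} → S x → A x y → WalkIn A S y z → WalkIn A S x z

ConnectedIn : ∀ {m} → Tree m → (Fin (suc m) → Set) → Set
ConnectedIn T S = ∀ x y → S x → S y → WalkIn (TAdj T) S x y

record TreeDecomposition {n : ℕ} (G : Graph n) (m : ℕ) (T : Tree m) : Set where
  field
    bag       : Fin (suc m) → Subset n
    cover     : ∀ v → ∃[ x ] (v ∈ bag x)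
    edge-in   : ∀ u v → Edge G u v → ∃[ x ] (u ∈ bag x × v ∈ bag x)
    connected : ∀ v → ConnectedIn T (λ x → v ∈ bag x)
open TreeDecomposition public

TDWidth≤ : ∀ {n m} {G : Graph n} {T : Tree m} → TreeDecomposition G m T → ℕ → Set
TDWidth≤ {m = m} D k = ∀ (x : Fin (suc m)) → ∣ bag D x ∣ ≤ suc k

HasTD : ∀ {n} → Graph n → ℕ → Set
HasTD G k = ∃[ m ] Σ (Tree m) λ T → Σ (TreeDecomposition G m T) λ D → TDWidth≤ D k

HasPD : ∀ {n} → Graph n → ℕ → Set
HasPD G k = ∃[ m ] Σ (TreeDecomposition G m (pathTree m)) λ D → TDWidth≤ D k

IsTW : ∀ {n} → Graph n → ℕ → Set
IsTW G k = HasTD G k × (∀ k′ → HasTD G k′ → k ≤ k′)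

IsPW : ∀ {n} → Graph n → ℕ → Set
IsPW G k = HasPD G k × (∀ k′ → HasPD G k′ → k ≤ k′)

-- Tree-partitions: a tree with pairwise disjoint bags covering V(G),
-- given by the map sending each vertex to the node whose bag contains it.

record TreePartition {n : ℕ} (G : Graph n) (m : ℕ) (T : Tree m) : Set where
  field
    node    : Fin n → Fin (suc m)
    edge-ok : ∀ u v → Edge G u v → node u ≡ node v ⊎ TAdj T (node u) (node v)
open TreePartition public

TPbag : ∀ {n m} {G : Graph n} {T : Tree m} → TreePartition G m T → Fin (suc m) → Subset n
TPbag P x = tabulate (λ v → does (node P v ≟ x))

HasTP : ∀ {n} → Graph n → ℕ → Set
HasTP {n} G k = ∃[ m ] Σ (Tree m) λ T → Σ (TreePartition G m T) λ P →
  ∀ x → ∣ TPbag P x ∣ ≤ k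

IsTPW : ∀ {n} → Graph n → ℕ → Set
IsTPW G k = HasTP G k × (∀ k′ → HasTP G k′ → k ≤ k′)

-- q·a + s·(b − a): q times the point a + (s/q)(b − a) of segment [a,b]
scaledPt : ℕ → ℕ → ℤ → ℤ → ℤ
scaledPt q s a b = (+ q) ℤ.* a ℤ.+ (+ s) ℤ.* (b ℤ.- a)

record Drawing3D {n : ℕ} (G : Graph n) : Set where
  field
    px py pz : Fin n → ℤ
    injective : ∀ u v → px u ≡ px v → py u ≡ py v → pz u ≡ pz v → u ≡ v
    -- an edge meets a vertex only if it is an end-vertex of that edge:
    -- if w = pos u + (s/q)(pos v − pos u) with 0 ≤ s ≤ q, q > 0
    vertex-ok : ∀ u v w → Edge G u v → (q s : ℕ) → 0 ℕ.< q → s ≤ q →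
      (+ q) ℤ.* px w ≡ scaledPt q s (px u) (px v) →
      (+ q) ℤ.* py w ≡ scaledPt q s (py u) (py v) →
      (+ q) ℤ.* pz w ≡ scaledPt q s (pz u) (pz v) →
      w ≡ u ⊎ w ≡ v
    edge-ok : ∀ u v x y → Edge G u v → Edge G x y →
      ¬ ((u ≡ x × v ≡ y) ⊎ (u ≡ y × v ≡ x)) →
      (q s t : ℕ) → 0 ℕ.< q → s ≤ q → t ≤ q →
      scaledPt q s (px u) (px v) ≡ scaledPt q t (px x) (px y) →
      scaledPt q s (py u) (py v) ≡ scaledPt q t (py x) (py y) →
      scaledPt q s (pz u) (pz v) ≡ scaledPt q t (pz x) (pz y) →
      ∃[ w ] ((w ≡ u ⊎ w ≡ v) × (w ≡ x ⊎ w ≡ y) ×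
              (+ q) ℤ.* px w ≡ scaledPt q s (px u) (px v) ×
              (+ q) ℤ.* py w ≡ scaledPt q s (py u) (py v) ×
              (+ q) ℤ.* pz w ≡ scaledPt q s (pz u) (pz v))
open Drawing3D public

-- coordinates lie in {c₀, …, c₀ + X − 1} (box side length X − 1)
InRange : ∀ {n} → (Fin n → ℤ) → ℕ → Set
InRange p X = ∃[ c₀ ] ∀ v → (c₀ ℤ.≤ p v) × (p v ℤ.+ + 1 ℤ.≤ c₀ ℤ.+ + X)

HasDrawing : ∀ {n} → Graph n → ℕ → ℕ → ℕ → Set
HasDrawing G X Y Z = Σ (Drawing3D G) λ D →
  InRange (px D) X × InRange (py D) Y × InRange (pz D) Z

-- T = 3^k · 6^((4^k − 3k − 1)/9)   (the division is exact)
Tbound : ℕ → ℕ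
Tbound k = 3 ℕ.^ k ℕ.* 6 ℕ.^ ((4 ℕ.^ k ℕ.∸ 3 ℕ.* k ℕ.∸ 1) ℕ./ 9)

{-# OPTIONS --safe #-}
-- All five drawings come from track layouts: a proper colouring with t colours and an order of the vertices such that
-- edges between the same two colour classes do not cross. Ranking the vertices colour by colour and cutting the ranking
-- into blocks of length about n/t gives at most 2t balanced tracks. With a prime p between 2t and 128t (Chebyshev), the
-- r-th vertex of track i goes to (i, i² mod p, p r + (i³ mod p)). By the Vandermonde determinant modulo p, four tracks
-- are not coplanar and three are not collinear in projection, so only edges between the same two tracks could cross.
--
-- (a) An order of vertex separation number K, such as that by first bags in a path decomposition, has a greedy
-- (K+1)-colouring, which is a track layout. A perfect elimination order yields K = O(tw log n) by laying out the
-- smaller part first at every branching.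
-- (b) A tree-partition is laid out in breadth-first order, coloured by depth modulo 3 and position within the bag.
-- One of width O(Δ tw) exists: keep a set S in the root bag; if S is small, recurse on the rest with the neighbours
-- of S as the new set, otherwise separate S and merge the partitions of both sides at their roots.
-- (c) The layers of a graph of treewidth k have treewidth k − 1. Ordering each layer by the latest vertex of the clique
-- above a component, 2^k − 1 labels suffice for the edges to earlier vertices of the elimination order with the same
-- label to form monotone matchings. Each vertex has at most one earlier neighbour of each of k + 1 colours, so the
-- colour classes can be refined by residues until all edges between two classes share label and direction.
module Submission where

open import Defs
open import Data.Nat using (ℕ; zero; suc; _+_; _*_; _^_; _∸_; _⊔_; _⊓_; pred; _≤_; _<_; z≤n; s≤s; NonZero; _/_; _%_; >-nonZero; ≢-nonZero; nonTrivial⇒n>1)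
open import Data.Nat.Properties hiding (_≟_)
open import Data.Nat.DivMod
open import Data.Nat.Divisibility
open import Data.Nat.Primality using (Prime; prime?; euclidsLemma; prime⇒nonZero; prime⇒nonTrivial; prime⇒irreducible)
open import Data.Nat.Primality.Factorisation using (factorise)
open import Data.Nat.LCM using (lcm; m∣lcm[m,n]; n∣lcm[m,n]; lcm-least)
open import Data.Nat.Combinatorics using (_C_; nCk+nC[k+1]≡[n+1]C[k+1]; nC1≡n)
open import Data.Nat.Induction using (<-wellFounded; <-rec)
open import Induction.WellFounded using (Acc; acc)
import Data.Nat.Tactic.RingSolver as ℕR
open import Data.Integer as ℤ using (ℤ)
import Data.Integer.Properties as ℤP
open import Data.Integer using () renaming (+_ to pos; _+_ to _+ᶻ_; _*_ to _*ᶻ_; _-_ to _-ᶻ_; -_ to -ᶻ_)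
open import Data.Integer.Divisibility.Signed as ℤS using () renaming (_∣_ to _∣ᶻ_)
import Data.Integer.Tactic.RingSolver as ℤR
open import Data.Fin as Fin using (Fin; zero; suc; toℕ; fromℕ<)
import Data.Fin.Properties as FinP
open import Data.Fin.Subset as Subset using (Subset)
open import Data.Vec as Vec using ([]; _∷_)
import Data.Vec.Properties as VecP
open import Data.List as List using (List; []; _∷_)
import Data.List.Properties as ListP
open import Data.Nat.ListAction using (product)
open import Data.List.Relation.Unary.All as All using (All)
open import Data.Bool using (Bool; true; false; _∧_; _∨_; not; if_then_else_)
import Data.Bool.Properties as BoolP
open import Data.Product using (Σ; ∃-syntax; _×_; _,_; proj₁; proj₂)
import Data.Sum
open import Data.Sum using (_⊎_; inj₁; inj₂; [_,_]′) renaming (map to ⊎-map)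
open import Data.Empty using (⊥; ⊥-elim)
open import Data.Unit using (tt)
open import Function using (_∘_; id; case_of_; _∋_)
open import Relation.Nullary using (¬_; Dec; yes; no; does)
open import Relation.Nullary.Decidable using (map′; ¬?; _×-dec_; _⊎-dec_; _→-dec_; dec-true; dec-false; toWitness; T?)
open import Relation.Binary.Definitions using (tri<; tri≈; tri>)
open import Relation.Binary.PropositionalEquality using (_≡_; _≢_; refl; sym; trans; cong; cong₂; subst; subst₂; module ≡-Reasoning)

-- The height of a drawing is about p times the longest track, so one long track could cost t n;
-- blocks of length n/t + 1 prevent this while only doubling the number of tracks. A prime within
-- any constant factor of t is good enough, so elementary bounds on central binomial coefficients
-- suffice. The determinants are known to be nonzero only modulo p, whereas a crossing is a linear
-- relation with integer weights. Such a relation has all weights divisible by p, hence can be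
-- divided by p again and again, and must be zero. In (b) the danger is that root bags grow under
-- repeated merging. Once S has more than 12 (k + 1) vertices, a balanced separation leaves at most
-- |S| - 2 (k + 1) root vertices on either side, separator included; this surplus pays for the
-- duplicated separator. In (c) the count 2^k - 1 solves the recurrence l -> 2l + 1 over the layers.
-- The resulting (k + 1) (2^(k+1) - 1)^(k+1) tracks are compared with T only at the end: their
-- logarithm is about quadratic in k, that of T is exponential.

-- Linear arithmetic by certificate: the equation is a ring identity.
linear : ∀ {x y A B} s → A ≤ B → x + B + s ≡ y + A → x ≤ y
linear {x} {y} {A} {B} s A≤B eq = +-cancelʳ-≤ A x y (begin
  x + A ≤⟨ +-monoʳ-≤ x A≤B ⟩
  x + B ≤⟨ m≤m+n (x + B) s ⟩
  x + B + s ≡⟨ eq ⟩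
  y + A ∎)
  where open ≤-Reasoning

-- Counting finite sets given by Boolean predicates

true≢false : true ≢ false
true≢false ()

bit : Bool → ℕ
bit false = 0
bit true  = 1

∧-true : ∀ {a b} → a ∧ b ≡ true → a ≡ true × b ≡ true
∧-true {true} {true} _ = refl , refl

∧-left : ∀ {a b} → a ∧ b ≡ true → a ≡ true
∧-left {a} e = proj₁ (∧-true {a} e)

∧-right : ∀ {a b} → a ∧ b ≡ true → b ≡ true
∧-right {a} e = proj₂ (∧-true {a} e)

∨-true : ∀ {a b} → a ∨ b ≡ true → a ≡ true ⊎ b ≡ true
∨-true {true}  _ = inj₁ refl
∨-true {false} e = inj₂ e

not-true : ∀ {a} → not a ≡ true → a ≢ true
not-true {false} _ ()

does⇒ : ∀ {P : Set} (d : Dec P) → does d ≡ true → P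
does⇒ (yes p) _ = p

count : ∀ {n} → (Fin n → Bool) → ℕ
count {zero}  p = 0
count {suc n} p = bit (p zero) + count (p ∘ suc)

-- One induction serves unions, splittings and disjoint sums: an absent summand is the constantly
-- false predicate.
count-+ : ∀ {n} (p q r s : Fin n → Bool) → (∀ i → bit (p i) + bit (q i) ≤ bit (r i) + bit (s i)) →
  count p + count q ≤ count r + count s
count-+ {zero}  p q r s h = z≤n
count-+ {suc n} p q r s h = subst₂ _≤_ (shuffle (bit (p zero)) (bit (q zero)) _ _) (shuffle (bit (r zero)) (bit (s zero)) _ _)
  (+-mono-≤ (h zero) (count-+ (p ∘ suc) (q ∘ suc) (r ∘ suc) (s ∘ suc) (h ∘ suc)))
  where
  shuffle : ∀ a b c d → (a + b) + (c + d) ≡ (a + c) + (b + d)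
  shuffle = ℕR.solve-∀

count-false : ∀ {n} → count {n} (λ _ → false) ≡ 0
count-false {zero}  = refl
count-false {suc n} = count-false {n}

count≤n : ∀ {n} (p : Fin n → Bool) → count p ≤ n
count≤n {zero}  p = z≤n
count≤n {suc n} p with p zero
... | true  = s≤s (count≤n (p ∘ suc))
... | false = m≤n⇒m≤1+n (count≤n (p ∘ suc))

count-mono : ∀ {n} {p q : Fin n → Bool} → (∀ i → p i ≡ true → q i ≡ true) → count p ≤ count q
count-mono {n} {p} {q} h = subst₂ _≤_ (+0 p) (+0 q) (count-+ p _ q _ (λ i → +-monoˡ-≤ 0 (bit-mono (h i))))
  where
  +0 : ∀ p → count p + count (λ (_ : Fin n) → false) ≡ count p
  +0 p = trans (cong (count p +_) (count-false {n})) (+-identityʳ _)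
  bit-mono : ∀ {a b} → (a ≡ true → b ≡ true) → bit a ≤ bit b
  bit-mono {false} h = z≤n
  bit-mono {true}  h = ≤-reflexive (cong bit (sym (h refl)))

count-∨ : ∀ {n} (p q : Fin n → Bool) → count (λ i → p i ∨ q i) ≤ count p + count q
count-∨ {n} p q = ≤-trans (m≤m+n _ _) (count-+ _ (λ _ → false) p q (λ i → h (p i) (q i)))
  where
  h : ∀ a b → bit (a ∨ b) + 0 ≤ bit a + bit b
  h true  b     = s≤s z≤n
  h false true  = ≤-refl
  h false false = ≤-refl

count-split : ∀ {n} (p q : Fin n → Bool) → count p ≤ count (λ i → p i ∧ q i) + count (λ i → p i ∧ not (q i))
count-split {n} p q = ≤-trans (m≤m+n _ _) (count-+ p (λ _ → false) _ _ (λ i → h (p i) (q i)))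
  where
  h : ∀ a b → bit a + 0 ≤ bit (a ∧ b) + bit (a ∧ not b)
  h true  true  = ≤-refl
  h true  false = ≤-refl
  h false b     = z≤n

infix 6 _∖_
_∖_ : ∀ {n} → (Fin n → Bool) → Fin n → Fin n → Bool
(p ∖ x) i = p i ∧ not (does (i Fin.≟ x))

∖-true : ∀ {n} (p : Fin n → Bool) {x i} → p i ≡ true → i ≢ x → (p ∖ x) i ≡ true
∖-true p {x} {i} pi i≢x rewrite pi | dec-false (i Fin.≟ x) i≢x = refl

∖-true⁻ : ∀ {n} (p : Fin n → Bool) {x i} → (p ∖ x) i ≡ true → p i ≡ true × i ≢ x
∖-true⁻ p {x} {i} e = ∧-left e , λ i≡x → not-true (∧-right {p i} e) (dec-true (i Fin.≟ x) i≡x)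

count-singleton : ∀ {n} (x : Fin n) → count (λ i → does (i Fin.≟ x)) ≡ 1
count-singleton {suc n} zero = cong suc (count-false {n})
count-singleton (suc x) = trans (≤-antisym (count-mono (λ i e → e' i e)) (count-mono (λ i e → e″ i e))) (count-singleton x)
  where
  e' : ∀ i → does (suc i Fin.≟ suc x) ≡ true → does (i Fin.≟ x) ≡ true
  e' i e = dec-true (i Fin.≟ x) (FinP.suc-injective (does⇒ (suc i Fin.≟ suc x) e))
  e″ : ∀ i → does (i Fin.≟ x) ≡ true → does (suc i Fin.≟ suc x) ≡ true
  e″ i e = dec-true (suc i Fin.≟ suc x) (cong suc (does⇒ (i Fin.≟ x) e))

count-∖< : ∀ {n} (p : Fin n → Bool) {x} → p x ≡ true → count (p ∖ x) < count p
count-∖< {n} p {x} px = begin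
  suc (count (p ∖ x)) ≡⟨ cong (_+ count (p ∖ x)) (count-singleton x) ⟨
  count (λ i → does (i Fin.≟ x)) + count (p ∖ x) ≤⟨ count-+ _ (p ∖ x) p (λ _ → false) h ⟩
  count p + count (λ (_ : Fin n) → false) ≡⟨ cong (count p +_) (count-false {n}) ⟩
  count p + 0 ≡⟨ +-identityʳ _ ⟩
  count p ∎
  where
  open ≤-Reasoning
  h : ∀ i → bit (does (i Fin.≟ x)) + bit ((p ∖ x) i) ≤ bit (p i) + 0
  h i with i Fin.≟ x
  ... | yes refl rewrite px = ≤-refl
  ... | no _ with p i
  ...   | true  = ≤-refl
  ...   | false = ≤-refl

count-< : ∀ {n} {p q : Fin n → Bool} → (∀ i → p i ≡ true → q i ≡ true) →
  ∀ {x} → q x ≡ true → p x ≢ true → count p < count q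
count-< {p = p} {q} h {x} qx ¬px = ≤-trans (s≤s (count-mono λ i pi → ∖-true q (h i pi) λ { refl → ¬px pi })) (count-∖< q qx)

count-pos : ∀ {n} {p : Fin n → Bool} {x} → p x ≡ true → 1 ≤ count p
count-pos {p = p} px = ≤-trans (s≤s z≤n) (count-∖< p px)

count-∃ : ∀ {n} (p : Fin n → Bool) → 1 ≤ count p → ∃[ x ] (p x ≡ true)
count-∃ {suc n} p le with p zero in e
... | true  = zero , e
... | false with count-∃ (p ∘ suc) le
...   | x , px = suc x , px

count-inj : ∀ {m n} (g : Fin m → Fin n) (p : Fin n → Bool) → (∀ {i j} → g i ≡ g j → i ≡ j) →
  (∀ i → p (g i) ≡ true) → m ≤ count p
count-inj {zero}  g p inj h = z≤n
count-inj {suc m} g p inj h = ≤-trans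
  (s≤s (count-inj (g ∘ suc) (p ∖ g zero) (FinP.suc-injective ∘ inj)
    (λ i → ∖-true p (h (suc i)) λ e → FinP.0≢1+n (sym (inj e)))))
  (count-∖< p (h zero))

-- Pigeonhole: if every colour occurred on `p`, representatives would inject `Fin (suc k)` into `p`.
missing-colour : ∀ {n k} (p : Fin n → Bool) (col : Fin n → Fin (suc k)) → count p ≤ k →
  ∃[ c ] (∀ u → p u ≡ true → col u ≢ c)
missing-colour {n} {k} p col le with FinP.any? (λ c → FinP.all? (λ u → (p u BoolP.≟ true) →-dec ¬? (col u Fin.≟ c)))
... | yes r = r
... | no ¬r = ⊥-elim (<⇒≱ (s≤s le) (count-inj (proj₁ ∘ pre) p inj (proj₁ ∘ proj₂ ∘ pre)))
  where
  pre : ∀ c → ∃[ u ] (p u ≡ true × col u ≡ c)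
  pre c with FinP.any? (λ u → (p u BoolP.≟ true) ×-dec (col u Fin.≟ c))
  ... | yes r = r
  ... | no ¬s = ⊥-elim (¬r (c , λ u pu e → ¬s (u , pu , e)))
  inj : ∀ {i j} → proj₁ (pre i) ≡ proj₁ (pre j) → i ≡ j
  inj {i} {j} e = trans (sym (proj₂ (proj₂ (pre i)))) (trans (cong col e) (proj₂ (proj₂ (pre j))))

any : ∀ {n} → (Fin n → Bool) → Bool
any p = does (FinP.any? (λ i → p i BoolP.≟ true))

any-true : ∀ {n} (p : Fin n → Bool) {i} → p i ≡ true → any p ≡ true
any-true p pi = dec-true (FinP.any? (λ i → p i BoolP.≟ true)) (_ , pi)

any-true⁻ : ∀ {n} (p : Fin n → Bool) → any p ≡ true → ∃[ i ] (p i ≡ true)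
any-true⁻ p = does⇒ (FinP.any? (λ i → p i BoolP.≟ true))

count-⋃ : ∀ {m n Δ} (s : Fin m → Bool) (r : Fin m → Fin n → Bool) → (∀ i → count (r i) ≤ Δ) →
  count (λ u → any (λ i → s i ∧ r i u)) ≤ Δ * count s
count-⋃ {zero} {n} s r h = ≤-trans (count-mono {q = λ _ → false} (λ u e → case any-true⁻ (λ i → s i ∧ r i u) e of λ { (() , _) }))
  (≤-trans (≤-reflexive (count-false {n})) z≤n)
count-⋃ {suc m} {n} {Δ} s r h = begin
  count (λ u → any (λ i → s i ∧ r i u)) ≤⟨ count-mono head ⟩
  count (λ u → (s zero ∧ r zero u) ∨ any (λ i → s (suc i) ∧ r (suc i) u)) ≤⟨ count-∨ (λ u → s zero ∧ r zero u) _ ⟩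
  count (λ u → s zero ∧ r zero u) + count (λ u → any (λ i → s (suc i) ∧ r (suc i) u))
    ≤⟨ +-mono-≤ first (count-⋃ (s ∘ suc) (r ∘ suc) (h ∘ suc)) ⟩
  Δ * bit (s zero) + Δ * count (s ∘ suc) ≡⟨ *-distribˡ-+ Δ (bit (s zero)) _ ⟨
  Δ * count s ∎
  where
  open ≤-Reasoning
  head : ∀ u → any (λ i → s i ∧ r i u) ≡ true →
    (s zero ∧ r zero u) ∨ any (λ i → s (suc i) ∧ r (suc i) u) ≡ true
  head u e with any-true⁻ (λ i → s i ∧ r i u) e
  ... | zero , x rewrite x = refl
  ... | suc i , x rewrite any-true (λ i → s (suc i) ∧ r (suc i) u) x = BoolP.∨-zeroʳ _
  first : count (λ u → s zero ∧ r zero u) ≤ Δ * bit (s zero)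
  first with s zero
  ... | true  = ≤-trans (h zero) (≤-reflexive (sym (*-identityʳ Δ)))
  ... | false = ≤-trans (≤-reflexive (count-false {n})) z≤n

count-filter : ∀ {n} {P : Fin n → Set} (P? : ∀ i → Dec (P i)) {m} (f : Fin m → Fin n) →
  List.length (List.filter P? (List.tabulate f)) ≡ count (λ i → does (P? (f i)))
count-filter P? {zero}  f = refl
count-filter P? {suc m} f with does (P? (f zero))
... | true  = cong suc (count-filter P? (f ∘ suc))
... | false = count-filter P? (f ∘ suc)

count-Subset : ∀ {n} (p : Subset n) → Subset.∣ p ∣ ≡ count (Vec.lookup p)
count-Subset []          = refl
count-Subset (true ∷ p)  = cong suc (count-Subset p)
count-Subset (false ∷ p) = count-Subset p

-- Chebyshev's bound on gaps between primes

∣-prime⇒≡ : ∀ {p q} → Prime p → Prime q → p ∣ q → p ≡ q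
∣-prime⇒≡ {p} pp pq p∣q with prime⇒irreducible pq p∣q
... | inj₂ e    = e
... | inj₁ refl = ⊥-elim (<-irrefl refl (nonTrivial⇒n>1 1 {{prime⇒nonTrivial pp}}))

prime>1 : ∀ {p} → Prime p → 1 < p
prime>1 {p} pp = nonTrivial⇒n>1 p {{prime⇒nonTrivial pp}}

n<p^n : ∀ {p} → 1 < p → ∀ n → n < p ^ n
n<p^n 1<p zero = s≤s z≤n
n<p^n {p} 1<p (suc n) = begin
  2 + n ≤⟨ +-monoʳ-≤ 1 (n<p^n 1<p n) ⟩
  1 + p ^ n ≤⟨ +-monoˡ-≤ (p ^ n) (≤-trans (s≤s z≤n) (n<p^n 1<p n)) ⟩
  p ^ n + p ^ n ≡⟨ cong (p ^ n +_) (+-identityʳ (p ^ n)) ⟨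
  2 * p ^ n ≤⟨ *-monoˡ-≤ (p ^ n) 1<p ⟩
  p * p ^ n ∎
  where open ≤-Reasoning

p-part : ∀ {p} → Prime p → ∀ a → 1 ≤ a → ∃[ e ] ∃[ b ] (a ≡ p ^ e * b × ¬ p ∣ b)
p-part {p} pp = <-rec _ go
  where
  go : ∀ a → (∀ {b} → b < a → 1 ≤ b → ∃[ e ] ∃[ c ] (b ≡ p ^ e * c × ¬ p ∣ c)) →
    1 ≤ a → ∃[ e ] ∃[ c ] (a ≡ p ^ e * c × ¬ p ∣ c)
  go a rec 1≤a with p ∣? a
  ... | no ¬p∣a = 0 , a , sym (*-identityˡ a) , ¬p∣a
  ... | yes (divides q refl) with n≢0⇒n>0 {q} (λ { refl → n≮0 1≤a })
  ... | 1≤q with rec {q} (m<m*n q p {{>-nonZero 1≤q}} (prime>1 pp)) 1≤q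
  ... | e , c , refl , ¬p∣c = suc e , c , shuffle (p ^ e) c p , ¬p∣c
    where
    shuffle : ∀ x c p → x * c * p ≡ p * x * c
    shuffle = ℕR.solve-∀

p^e∣p^j*c : ∀ {p} → Prime p → ∀ e j {c} → ¬ p ∣ c → p ^ e ∣ p ^ j * c → e ≤ j
p^e∣p^j*c pp zero j ¬p∣c d = z≤n
p^e∣p^j*c {p} pp (suc e) zero {c} ¬p∣c d = ⊥-elim (¬p∣c (subst (p ∣_) (*-identityˡ c) (∣-trans (m∣m*n (p ^ e)) d)))
p^e∣p^j*c {p} pp (suc e) (suc j) {c} ¬p∣c d =
  s≤s (p^e∣p^j*c pp e j ¬p∣c (*-cancelˡ-∣ p {{prime⇒nonZero pp}} (subst (p ^ suc e ∣_) (*-assoc p (p ^ j) c) d)))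

^-monoʳ-∣ : ∀ p {i j} → i ≤ j → p ^ i ∣ p ^ j
^-monoʳ-∣ p {i} {j} le = subst (λ z → p ^ i ∣ p ^ z) (m+[n∸m]≡n le)
  (subst (p ^ i ∣_) (sym (^-distribˡ-+-* p i (j ∸ i))) (m∣m*n _))

-- With a = p^i a' and b = p^j b', the number p^max(i,j) a' b' is a common multiple, so e is at most
-- the larger of i and j.
p^e∣lcm : ∀ {p} → Prime p → ∀ e {a b} → 1 ≤ a → 1 ≤ b → p ^ e ∣ lcm a b → p ^ e ∣ a ⊎ p ^ e ∣ b
p^e∣lcm {p} pp e {a} {b} 1≤a 1≤b d with p-part pp a 1≤a | p-part pp b 1≤b
... | i , a' , refl , ¬a | j , b' , refl , ¬b = cases (≤-total i j)
  where
  ¬ab : ¬ p ∣ a' * b'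
  ¬ab x = [ ¬a , ¬b ]′ (euclidsLemma a' b' pp x)
  cases : i ≤ j ⊎ j ≤ i → p ^ e ∣ p ^ i * a' ⊎ p ^ e ∣ p ^ j * b'
  cases (inj₁ i≤j) = inj₂ (∣m⇒∣m*n b' (^-monoʳ-∣ p (p^e∣p^j*c pp e j ¬ab (∣-trans d (lcm-least
    (∣-trans (*-monoˡ-∣ a' (^-monoʳ-∣ p i≤j)) (*-monoʳ-∣ (p ^ j) (m∣m*n b'))) (*-monoʳ-∣ (p ^ j) (n∣m*n a')))))))
  cases (inj₂ j≤i) = inj₁ (∣m⇒∣m*n a' (^-monoʳ-∣ p (p^e∣p^j*c pp e i ¬ab (∣-trans d (lcm-least
    (*-monoʳ-∣ (p ^ i) (m∣m*n b')) (∣-trans (*-monoˡ-∣ b' (^-monoʳ-∣ p j≤i)) (*-monoʳ-∣ (p ^ i) (n∣m*n a'))))))))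

lcmUpTo : ℕ → ℕ
lcmUpTo zero    = 1
lcmUpTo (suc n) = lcm (suc n) (lcmUpTo n)

∣lcmUpTo : ∀ n i → 1 ≤ i → i ≤ n → i ∣ lcmUpTo n
∣lcmUpTo zero    i 1≤i i≤0 = ⊥-elim (<⇒≱ 1≤i i≤0)
∣lcmUpTo (suc n) i 1≤i i≤n with m≤n⇒m<n∨m≡n i≤n
... | inj₁ (s≤s i≤n') = ∣-trans (∣lcmUpTo n i 1≤i i≤n') (n∣lcm[m,n] (suc n) (lcmUpTo n))
... | inj₂ refl       = m∣lcm[m,n] (suc n) (lcmUpTo n)

lcmUpTo≥1 : ∀ n → 1 ≤ lcmUpTo n
lcmUpTo≥1 zero = ≤-refl
lcmUpTo≥1 (suc n) = n≢0⇒n>0 λ e → <⇒≢ (*-mono-≤ {1} {suc n} (s≤s z≤n) (lcmUpTo≥1 n))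
  (sym (0∣⇒≡0 (subst (_∣ suc n * lcmUpTo n) e (lcm-least (m∣m*n {suc n} (lcmUpTo n)) (n∣m*n (suc n))))))

-- Some argument of the iterated lcm must absorb the whole prime power. The first alternative serves
-- the base case, where the lcm is 1.
p^e∣lcmUpTo : ∀ {p} → Prime p → ∀ e n → p ^ e ∣ lcmUpTo n → p ^ e ≤ 1 ⊎ p ^ e ≤ n
p^e∣lcmUpTo pp e zero d = inj₁ (∣⇒≤ d)
p^e∣lcmUpTo pp e (suc n) d with p^e∣lcm pp e (s≤s z≤n) (lcmUpTo≥1 n) d
... | inj₁ d' = inj₂ (∣⇒≤ d')
... | inj₂ d' = ⊎-map id m≤n⇒m≤1+n (p^e∣lcmUpTo pp e n d')

nC0≡1 : ∀ n → n C 0 ≡ 1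
nC0≡1 n = +-cancelʳ-≡ (n C 1) (n C 0) 1
  (trans (nCk+nC[k+1]≡[n+1]C[k+1] n 0) (trans (nC1≡n (suc n)) (cong suc (sym (nC1≡n n)))))

absorption : ∀ n k → suc k * (suc n C suc k) ≡ suc n * (n C k)
absorption n zero = trans (*-identityˡ (suc n C 1)) (trans (nC1≡n (suc n)) (sym (trans (cong (suc n *_) (nC0≡1 n)) (*-identityʳ (suc n)))))
absorption zero (suc k) = trans (cong (suc (suc k) *_) (sym (nCk+nC[k+1]≡[n+1]C[k+1] 0 (suc k)))) (*-zeroʳ (suc (suc k)))
absorption (suc n) (suc k) = begin
  (2 + k) * (suc (suc n) C suc (suc k)) ≡⟨ cong ((2 + k) *_) (nCk+nC[k+1]≡[n+1]C[k+1] (suc n) (suc k)) ⟨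
  (2 + k) * (a + b) ≡⟨ expand k a b ⟩
  a + suc k * a + (2 + k) * b ≡⟨ cong₂ (λ x y → a + x + y) (absorption n k) (absorption n (suc k)) ⟩
  a + suc n * (n C k) + suc n * (n C suc k) ≡⟨ collect n a (n C k) (n C suc k) ⟩
  a + suc n * (n C k + n C suc k) ≡⟨ cong (λ x → a + suc n * x) (nCk+nC[k+1]≡[n+1]C[k+1] n k) ⟩
  suc (suc n) * a ∎
  where
  open ≡-Reasoning
  a = suc n C suc k
  b = suc n C suc (suc k)
  expand : ∀ k a b → (2 + k) * (a + b) ≡ a + (1 + k) * a + (2 + k) * b
  expand = ℕR.solve-∀
  collect : ∀ n a x y → a + (1 + n) * x + (1 + n) * y ≡ a + (1 + n) * (x + y)
  collect = ℕR.solve-∀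

-- Leibniz's harmonic triangle: the reciprocals d(n,k) of (n+1)C(n,k) satisfy d(n,k+1) = d(n-1,k) - d(n,k).
leibniz : ∀ n k L → k ≤ n → 1 ≤ L → (∀ i → 1 ≤ i → i ≤ suc n → i ∣ L) → suc n * (n C k) ∣ L
leibniz n zero L _ _ h = subst (_∣ L) (sym (trans (cong (suc n *_) (nC0≡1 n)) (*-identityʳ (suc n)))) (h (suc n) (s≤s z≤n) ≤-refl)
leibniz (suc n) (suc k) L (s≤s k≤n) 1≤L h
  with leibniz n k L k≤n 1≤L (λ i 1≤i i≤ → h i 1≤i (m≤n⇒m≤1+n i≤)) | leibniz (suc n) k L (m≤n⇒m≤1+n k≤n) 1≤L h
... | divides x L≡xa | divides y L≡yb = ∣m+n∣m⇒∣n {c} {c * y} {L} (subst (c ∣_) key (m∣m*n x)) (m∣m*n y)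
  where
  open ≡-Reasoning
  p = n C k ; q = suc n C k ; r = suc n C suc k ; s = suc (suc n) C suc k
  a = suc n * p
  b = suc (suc n) * q
  c = suc (suc n) * r
  nz : ∀ z w → L ≡ z * w → NonZero w
  nz z w e = ≢-nonZero λ { refl → <⇒≢ 1≤L (sym (trans e (*-zeroʳ z))) }
  instance
    _ = nz x a L≡xa
    _ = nz y b L≡yb
    _ = m*n≢0 a b
  -- The relation 1/c = 1/a - 1/b of the harmonic triangle with denominators cleared.
  abc : c * b ≡ a * b + c * a
  abc = begin
    c * b ≡⟨ cong (c *_) (absorption (suc n) k) ⟨
    suc (suc n) * r * (suc k * s) ≡⟨ e₂ n k r s ⟩
    suc k * r * (suc (suc n) * s) ≡⟨ cong (_* (suc (suc n) * s)) (absorption n k) ⟩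
    a * (suc (suc n) * s) ≡⟨ cong (λ z → a * (suc (suc n) * z)) (nCk+nC[k+1]≡[n+1]C[k+1] (suc n) k) ⟨
    a * (suc (suc n) * (q + r)) ≡⟨ e₃ n a q r ⟩
    a * b + c * a ∎
    where
    e₂ : ∀ n k r s → (2 + n) * r * ((1 + k) * s) ≡ (1 + k) * r * ((2 + n) * s)
    e₂ = ℕR.solve-∀
    e₃ : ∀ n a q r → a * ((2 + n) * (q + r)) ≡ a * ((2 + n) * q) + (2 + n) * r * a
    e₃ = ℕR.solve-∀
  -- Multiplied by L, the relation reads L/c = x - y, so c divides L.
  key : c * x ≡ c * y + L
  key = *-cancelʳ-≡ (c * x) (c * y + L) (a * b) (begin
    c * x * (a * b) ≡⟨ f₁ a b c x ⟩
    c * b * (x * a) ≡⟨ cong₂ _*_ abc (sym L≡xa) ⟩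
    (a * b + c * a) * L ≡⟨ f₂ a b c L ⟩
    c * a * L + L * (a * b) ≡⟨ cong (λ z → c * a * z + L * (a * b)) L≡yb ⟩
    c * a * (y * b) + L * (a * b) ≡⟨ f₃ a b c y L ⟩
    (c * y + L) * (a * b) ∎)
    where
    f₁ : ∀ a b c x → c * x * (a * b) ≡ c * b * (x * a)
    f₁ = ℕR.solve-∀
    f₂ : ∀ a b c L → (a * b + c * a) * L ≡ c * a * L + L * (a * b)
    f₂ = ℕR.solve-∀
    f₃ : ∀ a b c y L → c * a * (y * b) + L * (a * b) ≡ (c * y + L) * (a * b)
    f₃ = ℕR.solve-∀

nCk≤[1+n]Ck : ∀ n k → n C k ≤ suc n C k
nCk≤[1+n]Ck n zero = ≤-reflexive (trans (nC0≡1 n) (sym (nC0≡1 (suc n))))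
nCk≤[1+n]Ck n (suc k) = ≤-trans (m≤n+m _ (n C k)) (≤-reflexive (nCk+nC[k+1]≡[n+1]C[k+1] n k))

2^m≤2mCm : ∀ m → 2 ^ m ≤ (m + m) C m
2^m≤2mCm zero = ≤-reflexive (sym (nC0≡1 0))
2^m≤2mCm (suc m) = begin
  2 * 2 ^ m ≤⟨ *-monoʳ-≤ 2 (2^m≤2mCm m) ⟩
  2 * c ≡⟨ cong (c +_) (+-identityʳ c) ⟩
  c + c ≤⟨ +-mono-≤ (nCk≤[1+n]Ck (m + m) m) (≤-trans (m≤m+n c _) (≤-reflexive (nCk+nC[k+1]≡[n+1]C[k+1] (m + m) m))) ⟩
  (suc (m + m) C m) + (suc (m + m) C suc m) ≡⟨ nCk+nC[k+1]≡[n+1]C[k+1] (suc (m + m)) m ⟩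
  suc (suc (m + m)) C suc m ≡⟨ cong (λ z → suc z C suc m) (+-suc m m) ⟨
  (suc m + suc m) C suc m ∎
  where
  open ≤-Reasoning
  c = (m + m) C m

nCk≤2^n : ∀ n k → n C k ≤ 2 ^ n
nCk≤2^n n zero = ≤-trans (≤-reflexive (nC0≡1 n)) (m^n>0 2 n)
nCk≤2^n zero (suc k) = z≤n
nCk≤2^n (suc n) (suc k) = begin
  suc n C suc k ≡⟨ nCk+nC[k+1]≡[n+1]C[k+1] n k ⟨
  n C k + n C suc k ≤⟨ +-mono-≤ (nCk≤2^n n k) (nCk≤2^n n (suc k)) ⟩
  2 ^ n + 2 ^ n ≡⟨ cong (2 ^ n +_) (+-identityʳ (2 ^ n)) ⟨
  2 * 2 ^ n ∎
  where open ≤-Reasoning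

-- Both k and n - k are below p. Pascal's rule preserves this on both branches down to n = p, where
-- by absorption p divides the product of the lower index and the coefficient, but not the index.
prime∣nCk : ∀ {p} → Prime p → ∀ n k → p ≤ n → k < p → n < p + k → p ∣ n C k
prime∣nCk {p} pp n zero p≤n _ n< = ⊥-elim (<⇒≱ n< (≤-trans (≤-reflexive (+-identityʳ p)) p≤n))
prime∣nCk {p} pp zero (suc k) p≤n k<p _ = ⊥-elim (<⇒≱ k<p (≤-trans p≤n z≤n))
prime∣nCk {p} pp (suc n) (suc k) p≤n k<p n< with m≤n⇒m<n∨m≡n p≤n
... | inj₁ (s≤s p≤n') = subst (p ∣_) (nCk+nC[k+1]≡[n+1]C[k+1] n k)
  (∣m∣n⇒∣m+n (prime∣nCk pp n k p≤n' (<-trans (n<1+n k) k<p) (≤-pred (≤-trans n< (≤-reflexive (+-suc p k)))))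
             (prime∣nCk pp n (suc k) p≤n' k<p (<-trans (n<1+n n) n<)))
... | inj₂ refl with euclidsLemma (suc k) (suc n C suc k) pp (subst (p ∣_) (sym (absorption n k)) (m∣m*n (n C k)))
...   | inj₁ p∣k = ⊥-elim (<⇒≱ k<p (∣⇒≤ p∣k))
...   | inj₂ r   = r

-- Products over primes

infix 8 ∏ₚ
∏ₚ : (ℕ → ℕ) → ℕ → ℕ
∏ₚ f zero    = 1
∏ₚ f (suc n) = (if does (prime? (suc n)) then f (suc n) else 1) * ∏ₚ f n

-- Strips the full power of each prime from n downwards, bounded by `f`. At n = 0 no prime factor is
-- left and M is 1.
≤∏ₚ : ∀ f n M → 1 ≤ M → (∀ {p} → Prime p → p ∣ M → p ≤ n) →
  (∀ {p} → Prime p → ∀ e → p ^ e ∣ M → p ^ e ≤ f p) → M ≤ ∏ₚ f n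
≤∏ₚ f zero M 1≤M small _ with factorise M {{>-nonZero 1≤M}}
... | record { factors = [] ; isFactorisation = e } = ≤-reflexive e
... | record { factors = p ∷ ps ; isFactorisation = e ; factorsPrime = pp All.∷ _ } =
  ⊥-elim (<⇒≱ (prime>1 pp) (≤-trans (small pp (divides (product ps) (trans e (*-comm p _)))) z≤n))
≤∏ₚ f (suc n) M 1≤M small bound with prime? (suc n)
... | no ¬p = ≤-trans (≤∏ₚ f n M 1≤M (λ pp d → ≤-pred (≤∧≢⇒< (small pp d) λ { refl → ¬p pp })) bound)
                      (≤-reflexive (sym (+-identityʳ _)))
... | yes pp with p-part pp M 1≤M
...   | e , b , refl , ¬p∣b = *-mono-≤ (bound pp e (m∣m*n b)) (≤∏ₚ f n b 1≤b
          (λ pq d → ≤-pred (≤∧≢⇒< (small pq (∣n⇒∣m*n (suc n ^ e) d)) λ { refl → ¬p∣b d }))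
          (λ pq k d → bound pq k (∣n⇒∣m*n (suc n ^ e) d)))
  where
  1≤b : 1 ≤ b
  1≤b = n≢0⇒n>0 λ { refl → <⇒≢ 1≤M (sym (*-zeroʳ (suc n ^ e))) }

-- Distinct primes dividing M can be divided out one after another, so their product is at most M.
∏ₚ≤ : ∀ m j M → 1 ≤ M → (∀ {p} → Prime p → m < p → p ≤ j + m → p ∣ M) → ∏ₚ id (j + m) ≤ ∏ₚ id m * M
∏ₚ≤ m zero M 1≤M h = m≤m*n _ M {{>-nonZero 1≤M}}
∏ₚ≤ m (suc j) M 1≤M h with prime? (suc (j + m))
... | no _ = ≤-trans (≤-reflexive (+-identityʳ _)) (∏ₚ≤ m j M 1≤M λ pp m< ≤j → h pp m< (m≤n⇒m≤1+n ≤j))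
... | yes pp with h pp (s≤s (m≤n+m m j)) ≤-refl
...   | divides M' refl = begin
  q * ∏ₚ id (j + m) ≤⟨ *-monoʳ-≤ q (∏ₚ≤ m j M' (n≢0⇒n>0 λ { refl → n≮0 1≤M }) rest) ⟩
  q * (∏ₚ id m * M') ≡⟨ shuffle q (∏ₚ id m) M' ⟩
  ∏ₚ id m * (M' * q) ∎
  where
  open ≤-Reasoning
  q = suc (j + m)
  shuffle : ∀ q a b → q * (a * b) ≡ a * (b * q)
  shuffle = ℕR.solve-∀
  rest : ∀ {p} → Prime p → m < p → p ≤ j + m → p ∣ M'
  rest pr m< ≤j with euclidsLemma M' q pr (h pr m< (m≤n⇒m≤1+n ≤j))
  ... | inj₁ d = d
  ... | inj₂ d = ⊥-elim (<⇒≱ (s≤s ≤j) (≤-reflexive (sym (∣-prime⇒≡ pr pp d))))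

-- The primes in (m, 2m] divide C(2m, m), which is at most 4^m; doubling m therefore doubles the
-- exponent 2m.
primorial≤ : ∀ a → ∏ₚ id (2 ^ a) ≤ 2 ^ (2 * 2 ^ a)
primorial≤ zero = s≤s z≤n
primorial≤ (suc a) = begin
  ∏ₚ id (2 * m) ≡⟨ cong (∏ₚ id) 2m ⟩
  ∏ₚ id (m + m) ≤⟨ ∏ₚ≤ m m ((m + m) C m) (≤-trans (m^n>0 2 m) (2^m≤2mCm m))
                         (λ pp m<p p≤ → prime∣nCk pp (m + m) m p≤ m<p (+-monoˡ-< m m<p)) ⟩
  ∏ₚ id m * ((m + m) C m) ≤⟨ *-mono-≤ (primorial≤ a) (nCk≤2^n (m + m) m) ⟩
  2 ^ (2 * m) * 2 ^ (m + m) ≡⟨ ^-distribˡ-+-* 2 (2 * m) (m + m) ⟨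
  2 ^ (2 * m + (m + m)) ≡⟨ cong (2 ^_) (e m) ⟩
  2 ^ (2 * (2 * m)) ∎
  where
  open ≤-Reasoning
  m = 2 ^ a
  2m : 2 * m ≡ m + m
  2m = cong (m +_) (+-identityʳ m)
  e : ∀ m → 2 * m + (m + m) ≡ 2 * (2 * m)
  e = ℕR.solve-∀

-- A factor N is charged to every index up to y, prime or not, which avoids counting primes.
∏ₚ-split : ∀ f N y n → 1 ≤ N → (∀ i → i ≤ y → f i ≤ N) → (∀ i → y < i → f i ≤ i) → ∏ₚ f n ≤ N ^ y * ∏ₚ id n
∏ₚ-split f N y n 1≤N f≤N f≤i = ≤-trans (go n) (*-monoˡ-≤ (∏ₚ id n) (^-monoʳ-≤ N {{>-nonZero 1≤N}} (m⊓n≤n n y)))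
  where
  open ≤-Reasoning
  shuffle : ∀ x a b → x * (a * b) ≡ a * (x * b)
  shuffle = ℕR.solve-∀
  go : ∀ n → ∏ₚ f n ≤ N ^ (n ⊓ y) * ∏ₚ id n
  go zero = ≤-refl
  go (suc n) with does (prime? (suc n)) | ≤-<-connex (suc n) y
  ... | false | _ = begin
    1 * ∏ₚ f n ≡⟨ *-identityˡ _ ⟩
    ∏ₚ f n ≤⟨ go n ⟩
    N ^ (n ⊓ y) * ∏ₚ id n ≤⟨ *-mono-≤ (^-monoʳ-≤ N {{>-nonZero 1≤N}} (⊓-monoˡ-≤ y (n≤1+n n))) (≤-reflexive (sym (*-identityˡ _))) ⟩
    N ^ (suc n ⊓ y) * (1 * ∏ₚ id n) ∎
  ... | true | inj₁ n<y = begin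
    f (suc n) * ∏ₚ f n ≤⟨ *-mono-≤ (f≤N (suc n) n<y) (go n) ⟩
    N * (N ^ (n ⊓ y) * ∏ₚ id n) ≡⟨ *-assoc N _ _ ⟨
    N ^ suc (n ⊓ y) * ∏ₚ id n ≡⟨ cong (λ z → N ^ z * ∏ₚ id n) (trans (cong suc (m≤n⇒m⊓n≡m (<⇒≤ n<y))) (sym (m≤n⇒m⊓n≡m n<y))) ⟩
    N ^ (suc n ⊓ y) * ∏ₚ id n ≤⟨ *-monoʳ-≤ (N ^ (suc n ⊓ y)) (m≤n*m (∏ₚ id n) (suc n)) ⟩
    N ^ (suc n ⊓ y) * (suc n * ∏ₚ id n) ∎
  ... | true | inj₂ y≤n = begin
    f (suc n) * ∏ₚ f n ≤⟨ *-mono-≤ (f≤i (suc n) y≤n) (go n) ⟩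
    suc n * (N ^ (n ⊓ y) * ∏ₚ id n) ≡⟨ shuffle (suc n) (N ^ (n ⊓ y)) _ ⟩
    N ^ (n ⊓ y) * (suc n * ∏ₚ id n) ≡⟨ cong (λ z → N ^ z * (suc n * ∏ₚ id n)) (trans (m≥n⇒m⊓n≡n (≤-pred y≤n)) (sym (m≥n⇒m⊓n≡n (<⇒≤ y≤n)))) ⟩
    N ^ (suc n ⊓ y) * (suc n * ∏ₚ id n) ∎

-- If no prime lay in (t, N] with N = 16 t = 2^(2j), then 2^(N/2 - 1) ≤ lcm(1..N) ≤ N^(√N) · 4^t,
-- because primes above √N divide the lcm at most once.
prime-between-powers : ∀ i → ∃[ p ] (Prime p × 2 ^ (2 * (3 + i)) < p × p ≤ 16 * 2 ^ (2 * (3 + i)))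
prime-between-powers i with anyUpTo? (λ p → prime? p ×-dec (2 ^ (2 * (3 + i)) <? p)) (suc (16 * 2 ^ (2 * (3 + i))))
... | yes (p , p≤N , pp , t<p) = p , pp , t<p , ≤-pred p≤N
... | no none = ⊥-elim (<⇒≱ absurd exponents)
  where
  open ≤-Reasoning
  x = 2 ^ i
  z = 2 ^ (3 + i)
  y = 2 ^ (5 + i)
  t = 2 ^ (2 * (3 + i))
  N = 16 * t
  M = lcmUpTo N
  -- 2m + 1 is N - 1, so by the harmonic triangle (2m + 1) C(2m, m) divides `M`.
  m = pred (8 * t)
  J = 5 + i
  t≡zz : t ≡ z * z
  t≡zz = trans (cong (2 ^_) (cong (3 + i +_) (+-identityʳ (3 + i)))) (^-distribˡ-+-* 2 (3 + i) (3 + i))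
  N≡yy : N ≡ y * y
  N≡yy = trans (cong (16 *_) t≡zz) (e z)
    where
    e : ∀ z → 16 * (z * z) ≡ 2 * (2 * z) * (2 * (2 * z))
    e = ℕR.solve-∀
  N≡2^ : N ≡ 2 ^ (J + J)
  N≡2^ = trans N≡yy (sym (^-distribˡ-+-* 2 J J))
  1≤t : 1 ≤ t
  1≤t = m^n>0 2 (2 * (3 + i))
  1≤N : 1 ≤ N
  1≤N = ≤-trans 1≤t (m≤n*m t 16)
  sm : suc m ≡ 8 * t
  sm = suc-pred (8 * t) {{m*n≢0 8 t {{_}} {{>-nonZero 1≤t}}}}
  m+m<N : suc (m + m) ≤ N
  m+m<N = begin
    suc (m + m) ≤⟨ n≤1+n _ ⟩
    suc (suc (m + m)) ≡⟨ cong suc (+-suc m m) ⟨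
    suc m + suc m ≡⟨ cong₂ _+_ sm sm ⟩
    8 * t + 8 * t ≡⟨ *-distribʳ-+ t 8 8 ⟨
    N ∎
  lower : 2 ^ m ≤ M
  lower = begin
    2 ^ m ≤⟨ 2^m≤2mCm m ⟩
    (m + m) C m ≤⟨ m≤n*m ((m + m) C m) (suc (m + m)) ⟩
    suc (m + m) * ((m + m) C m) ≤⟨ ∣⇒≤ {{>-nonZero (lcmUpTo≥1 N)}} (leibniz (m + m) m M (m≤m+n m m) (lcmUpTo≥1 N)
         λ j 1≤j j≤ → ∣lcmUpTo N j 1≤j (≤-trans j≤ m+m<N)) ⟩
    M ∎
  ppow≤N : ∀ {p} → Prime p → ∀ e → p ^ e ∣ M → p ^ e ≤ N
  ppow≤N pp e d with p^e∣lcmUpTo pp e N d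
  ... | inj₁ le = ≤-trans le 1≤N
  ... | inj₂ le = le
  small : ∀ {p} → Prime p → p ∣ M → p ≤ t
  small {p} pp d = ≮⇒≥ λ t<p → none (p , s≤s (subst (_≤ N) (^-identityʳ p) (ppow≤N pp 1 (subst (_∣ M) (sym (^-identityʳ p)) d))) , pp , t<p)
  cap : ℕ → ℕ
  cap j = [ (λ _ → N) , (λ _ → j) ]′ (≤-<-connex j y)
  cap≤N : ∀ j → j ≤ y → cap j ≤ N
  cap≤N j j≤y with ≤-<-connex j y
  ... | inj₁ _ = ≤-refl
  ... | inj₂ y<j = ⊥-elim (<⇒≱ y<j j≤y)
  cap≤j : ∀ j → y < j → cap j ≤ j
  cap≤j j y<j with ≤-<-connex j y
  ... | inj₁ j≤y = ⊥-elim (<⇒≱ y<j j≤y)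
  ... | inj₂ _ = ≤-refl
  bound : ∀ {p} → Prime p → ∀ e → p ^ e ∣ M → p ^ e ≤ cap p
  bound {p} pp e d with ≤-<-connex p y
  ... | inj₁ _ = ppow≤N pp e d
  bound {p} pp zero d | inj₂ y<p = <⇒≤ (prime>1 pp)
  bound {p} pp (suc zero) d | inj₂ y<p = ≤-reflexive (^-identityʳ p)
  bound {p} pp (suc (suc e)) d | inj₂ y<p = ⊥-elim (<⇒≱ (*-mono-< y<p y<p) (begin
    p * p ≡⟨ cong (p *_) (*-identityʳ p) ⟨
    p ^ 2 ≤⟨ ^-monoʳ-≤ p {{prime⇒nonZero pp}} (s≤s (s≤s (z≤n {e}))) ⟩
    p ^ suc (suc e) ≤⟨ ppow≤N pp (suc (suc e)) d ⟩
    N ≡⟨ N≡yy ⟩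
    y * y ∎))
  upper : M ≤ 2 ^ ((J + J) * y + 2 * t)
  upper = begin
    M ≤⟨ ≤∏ₚ cap t M (lcmUpTo≥1 N) small bound ⟩
    ∏ₚ cap t ≤⟨ ∏ₚ-split cap N y t 1≤N cap≤N cap≤j ⟩
    N ^ y * ∏ₚ id t ≤⟨ *-mono-≤ (≤-reflexive (trans (cong (_^ y) N≡2^) (^-*-assoc 2 (J + J) y))) (primorial≤ (2 * (3 + i))) ⟩
    2 ^ ((J + J) * y) * 2 ^ (2 * t) ≡⟨ ^-distribˡ-+-* 2 ((J + J) * y) (2 * t) ⟨
    2 ^ ((J + J) * y + 2 * t) ∎
  exponents : m ≤ (J + J) * y + 2 * t
  exponents = ≮⇒≥ λ lt → <⇒≱ (^-monoʳ-< 2 (s≤s (s≤s z≤n)) lt) (≤-trans lower upper)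
  1+i≤x : 1 + i ≤ x
  1+i≤x = n<p^n (s≤s (s≤s z≤n)) i
  1≤x : 1 ≤ x
  1≤x = m^n>0 2 i
  -- With y = 32x and z = 8x the claim is 2 + 64x (5 + i) <= 384x^2. It follows from 1 + i <= x and
  -- 1 <= x with 62x^2 to spare.
  slack : ∀ x i → let y = 2 * (2 * (2 * (2 * (2 * x)))); z = 2 * (2 * (2 * x)) in
    2 + ((5 + i + (5 + i)) * y + 2 * (z * z)) + (64 * x * x + (256 * x * x + 2 * (x * x))) + 62 * (x * x)
    ≡ 8 * (z * z) + (64 * x * (1 + i) + (256 * x * 1 + 2 * (1 * 1)))
  slack = ℕR.solve-∀
  absurd : (J + J) * y + 2 * t < m
  absurd = ≤-pred (begin
    2 + ((J + J) * y + 2 * t) ≡⟨ cong (λ t → 2 + ((J + J) * y + 2 * t)) t≡zz ⟩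
    2 + ((J + J) * y + 2 * (z * z)) ≤⟨ linear (62 * (x * x)) (+-mono-≤ (*-monoʳ-≤ (64 * x) 1+i≤x)
      (+-mono-≤ (*-monoʳ-≤ (256 * x) 1≤x) (*-monoʳ-≤ 2 (*-mono-≤ 1≤x 1≤x)))) (slack x i) ⟩
    8 * (z * z) ≡⟨ cong (8 *_) t≡zz ⟨
    8 * t ≡⟨ sm ⟨
    suc m ∎)

2^2[1+a] : ∀ a → 2 ^ (2 * suc a) ≡ 4 * 2 ^ (2 * a)
2^2[1+a] a = trans (cong (2 ^_) (*-suc 2 a)) (^-distribˡ-+-* 2 2 (2 * a))

power-bracket : ∀ t → 1 ≤ t → ∃[ a ] (2 ^ (2 * a) ≤ t × t < 4 * 2 ^ (2 * a))
power-bracket (suc zero) _ = 0 , s≤s z≤n , s≤s (s≤s z≤n)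
power-bracket (suc t@(suc _)) _ with power-bracket t (s≤s z≤n)
... | a , le , lt with suc t <? 4 * 2 ^ (2 * a)
...   | yes lt' = a , m≤n⇒m≤1+n le , lt'
...   | no ¬lt' = suc a , ≤-trans (≤-reflexive (2^2[1+a] a)) (≮⇒≥ ¬lt') , (begin-strict
  suc t ≤⟨ lt ⟩
  4 * 2 ^ (2 * a) <⟨ m<m*n (4 * 2 ^ (2 * a)) 4 {{m*n≢0 4 (2 ^ (2 * a)) {{_}} {{m^n≢0 2 (2 * a)}}}} (s≤s (s≤s z≤n)) ⟩
  4 * 2 ^ (2 * a) * 4 ≡⟨ *-comm (4 * 2 ^ (2 * a)) 4 ⟩
  4 * (4 * 2 ^ (2 * a)) ≡⟨ cong (4 *_) (2^2[1+a] a) ⟨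
  4 * 2 ^ (2 * suc a) ∎)
  where
  open ≤-Reasoning

-- Rounding t up to a power of 4 costs a factor 4, the gap above that power a factor 16.
chebyshev : ∀ t → 1 ≤ t → ∃[ p ] (Prime p × t ≤ p × p ≤ 64 * t)
chebyshev t 1≤t with power-bracket t 1≤t
... | a , le , lt = raise (between (suc a))
  where
  open ≤-Reasoning
  between : ∀ a → ∃[ p ] (Prime p × 2 ^ (2 * a) < p × p ≤ 16 * 2 ^ (2 * a))
  -- The general estimate starts at 4^3; the smaller powers get explicit primes.
  between 0 = 2 , toWitness {a? = prime? 2} tt , s≤s (s≤s z≤n) , toWitness {a? = 2 ≤? 16} tt
  between 1 = 5 , toWitness {a? = prime? 5} tt , s≤s (s≤s (s≤s (s≤s (s≤s z≤n)))) , toWitness {a? = 5 ≤? 64} tt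
  between 2 = 17 , toWitness {a? = prime? 17} tt , toWitness {a? = 17 ≤? 17} tt , toWitness {a? = 17 ≤? 256} tt
  between (suc (suc (suc i))) = prime-between-powers i
  raise : ∃[ p ] (Prime p × 2 ^ (2 * suc a) < p × p ≤ 16 * 2 ^ (2 * suc a)) → _
  raise (p , pp , lo , hi) = p , pp , <⇒≤ (<-trans lt (subst (_< p) (2^2[1+a] a) lo)) , (begin
    p ≤⟨ hi ⟩
    16 * 2 ^ (2 * suc a) ≡⟨ cong (16 *_) (2^2[1+a] a) ⟩
    16 * (4 * 2 ^ (2 * a)) ≡⟨ *-assoc 16 4 (2 ^ (2 * a)) ⟨
    64 * 2 ^ (2 * a) ≤⟨ *-monoʳ-≤ 64 le ⟩
    64 * t ∎)

-- Points on the moment curve modulo a prime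

euclidᶻ : ∀ {p} → Prime p → ∀ i j → pos p ∣ᶻ i *ᶻ j → pos p ∣ᶻ i ⊎ pos p ∣ᶻ j
euclidᶻ {p} pp i j d = ⊎-map ℤS.∣ᵤ⇒∣ ℤS.∣ᵤ⇒∣
  (euclidsLemma ℤ.∣ i ∣ ℤ.∣ j ∣ pp (subst (p ∣_) (ℤP.abs-* i j) (ℤS.∣⇒∣ᵤ d)))

*-cancelʳ-0 : ∀ i j → i *ᶻ j ≡ pos 0 → j ≢ pos 0 → i ≡ pos 0
*-cancelʳ-0 i j e j≢0 = [ id , (λ j≡0 → ⊥-elim (j≢0 j≡0)) ]′ (ℤP.i*j≡0⇒i≡0∨j≡0 i e)

≢⇒-≢0 : ∀ {i j} → i ≢ j → i -ᶻ j ≢ pos 0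
≢⇒-≢0 i≢j e = i≢j (ℤP.i-j≡0⇒i≡j _ _ e)

-- A point congruent to (x, x^2, x^3) modulo p. The quotients `cl` and `cm` are kept as data, so
-- that congruences become ring identities over the integers.
record CurvePoint (p : ℕ) : Set where
  field
    cx cy cz cl cm : ℤ
    y≡ : cy ≡ cx *ᶻ cx +ᶻ cl *ᶻ pos p
    z≡ : cz ≡ cx *ᶻ cx *ᶻ cx +ᶻ cm *ᶻ pos p
open CurvePoint

-- An affine dependence of the projections to the xy-plane only: two vertices of one track project
-- to the same point, which allows their weights to be merged.
record Dependent₃ {p} (α β γ : ℤ) (P Q R : CurvePoint p) : Set where
  field
    Σ1 : α +ᶻ β +ᶻ γ ≡ pos 0
    Σx : α *ᶻ cx P +ᶻ β *ᶻ cx Q +ᶻ γ *ᶻ cx R ≡ pos 0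
    Σy : α *ᶻ cy P +ᶻ β *ᶻ cy Q +ᶻ γ *ᶻ cy R ≡ pos 0

dot : (α β γ δ x y z w : ℤ) → ℤ
dot α β γ δ x y z w = α *ᶻ x +ᶻ β *ᶻ y +ᶻ γ *ᶻ z +ᶻ δ *ᶻ w

record Dependent₄ {p} (α β γ δ : ℤ) (P Q R S : CurvePoint p) : Set where
  field
    Σ1 : α +ᶻ β +ᶻ γ +ᶻ δ ≡ pos 0
    Σx : dot α β γ δ (cx P) (cx Q) (cx R) (cx S) ≡ pos 0
    Σy : dot α β γ δ (cy P) (cy Q) (cy R) (cy S) ≡ pos 0
    Σz : dot α β γ δ (cz P) (cz Q) (cz R) (cz S) ≡ pos 0

rotate₃ : ∀ {p} {P Q R : CurvePoint p} {α β γ} → Dependent₃ α β γ P Q R → Dependent₃ β γ α Q R P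
rotate₃ {P = P} {Q} {R} {α} {β} {γ} D = record
  { Σ1 = trans (perm α β γ) Σ1
  ; Σx = trans (perm (α *ᶻ cx P) (β *ᶻ cx Q) (γ *ᶻ cx R)) Σx
  ; Σy = trans (perm (α *ᶻ cy P) (β *ᶻ cy Q) (γ *ᶻ cy R)) Σy }
  where
  open Dependent₃ D
  perm : ∀ a b c → b +ᶻ c +ᶻ a ≡ a +ᶻ b +ᶻ c
  perm = ℤR.solve-∀

rotate₄ : ∀ {p} {P Q R S : CurvePoint p} {α β γ δ} → Dependent₄ α β γ δ P Q R S → Dependent₄ β γ δ α Q R S P
rotate₄ {P = P} {Q} {R} {S} {α} {β} {γ} {δ} D = record
  { Σ1 = trans (perm α β γ δ) Σ1
  ; Σx = trans (perm (α *ᶻ cx P) (β *ᶻ cx Q) (γ *ᶻ cx R) (δ *ᶻ cx S)) Σx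
  ; Σy = trans (perm (α *ᶻ cy P) (β *ᶻ cy Q) (γ *ᶻ cy R) (δ *ᶻ cy S)) Σy
  ; Σz = trans (perm (α *ᶻ cz P) (β *ᶻ cz Q) (γ *ᶻ cz R) (δ *ᶻ cz S)) Σz }
  where
  open Dependent₄ D
  perm : ∀ a b c d → b +ᶻ c +ᶻ d +ᶻ a ≡ a +ᶻ b +ᶻ c +ᶻ d
  perm = ℤR.solve-∀

module _ {p : ℕ} (pp : Prime p) where

  private
    instance
      p≢0 : ℤ.NonZero (pos p)
      p≢0 = prime⇒nonZero pp

  Apart : ℤ → ℤ → Set
  Apart i j = ¬ pos p ∣ᶻ i -ᶻ j

  apart-sym : ∀ i j → Apart i j → Apart j i
  apart-sym i j ap d = ap (subst (pos p ∣ᶻ_) (flip i j) (ℤS.∣m⇒∣-m d))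
    where
    flip : ∀ i j → -ᶻ (j -ᶻ i) ≡ i -ᶻ j
    flip = ℤR.solve-∀

  /p-< : ∀ q → q *ᶻ pos p ≢ pos 0 → ℤ.∣ q ∣ < ℤ.∣ q *ᶻ pos p ∣
  /p-< q nz = subst (ℤ.∣ q ∣ <_) (sym (ℤP.abs-* q (pos p)))
    (m<m*n ℤ.∣ q ∣ p {{≢-nonZero λ e → nz (cong (_*ᶻ pos p) (ℤP.∣i∣≡0⇒i≡0 {q} e))}} (prime>1 pp))

  -- The functional Σ αᵢ f(xᵢ) vanishes modulo p for every f of small degree; take f with roots at all xᵢ but the first.
  vandermonde₃-∣ : ∀ {α β γ P Q R} → Apart (cx P) (cx Q) → Apart (cx P) (cx R) → Dependent₃ α β γ P Q R → pos p ∣ᶻ α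
  vandermonde₃-∣ {α} {β} {γ} {P} {Q} {R} PQ PR D =
    [ id , ⊥-elim ∘ [ PQ , PR ]′ ∘ euclidᶻ pp (cx P -ᶻ cx Q) (cx P -ᶻ cx R) ]′ (euclidᶻ pp α ((cx P -ᶻ cx Q) *ᶻ (cx P -ᶻ cx R)) (ℤS.divides q (begin
      α *ᶻ ((cx P -ᶻ cx Q) *ᶻ (cx P -ᶻ cx R)) ≡⟨ identity (cx P) (cx Q) (cx R) α β γ (cl P) (cl Q) (cl R) (pos p) ⟩
      sum (cx P *ᶻ cx P +ᶻ cl P *ᶻ pos p) (cx Q *ᶻ cx Q +ᶻ cl Q *ᶻ pos p) (cx R *ᶻ cx R +ᶻ cl R *ᶻ pos p) +ᶻ tail
        ≡⟨ cong (_+ᶻ tail) (trans (sym (cong₂ _+ᶻ_ (cong₂ _+ᶻ_ (cong (α *ᶻ_) (y≡ P)) (cong (β *ᶻ_) (y≡ Q))) (cong (γ *ᶻ_) (y≡ R)))) Σy) ⟩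
      pos 0 +ᶻ (-ᶻ (cx Q +ᶻ cx R) *ᶻ sum (cx P) (cx Q) (cx R) +ᶻ cx Q *ᶻ cx R *ᶻ (α +ᶻ β +ᶻ γ) +ᶻ q *ᶻ pos p)
        ≡⟨ cong₂ (λ u v → pos 0 +ᶻ (-ᶻ (cx Q +ᶻ cx R) *ᶻ u +ᶻ cx Q *ᶻ cx R *ᶻ v +ᶻ q *ᶻ pos p)) Σx Σ1 ⟩
      pos 0 +ᶻ (-ᶻ (cx Q +ᶻ cx R) *ᶻ pos 0 +ᶻ cx Q *ᶻ cx R *ᶻ pos 0 +ᶻ q *ᶻ pos p) ≡⟨ zeros (-ᶻ (cx Q +ᶻ cx R)) (cx Q *ᶻ cx R) (q *ᶻ pos p) ⟩
      q *ᶻ pos p ∎)))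
    where
    open ≡-Reasoning
    open Dependent₃ D
    sum : ℤ → ℤ → ℤ → ℤ
    sum a b c = α *ᶻ a +ᶻ β *ᶻ b +ᶻ γ *ᶻ c
    q tail : ℤ
    q = -ᶻ sum (cl P) (cl Q) (cl R)
    tail = -ᶻ (cx Q +ᶻ cx R) *ᶻ sum (cx P) (cx Q) (cx R) +ᶻ cx Q *ᶻ cx R *ᶻ (α +ᶻ β +ᶻ γ) +ᶻ q *ᶻ pos p
    identity : ∀ x₁ x₂ x₃ α β γ m₁ m₂ m₃ p → α *ᶻ ((x₁ -ᶻ x₂) *ᶻ (x₁ -ᶻ x₃)) ≡
      (α *ᶻ (x₁ *ᶻ x₁ +ᶻ m₁ *ᶻ p) +ᶻ β *ᶻ (x₂ *ᶻ x₂ +ᶻ m₂ *ᶻ p) +ᶻ γ *ᶻ (x₃ *ᶻ x₃ +ᶻ m₃ *ᶻ p))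
      +ᶻ (-ᶻ (x₂ +ᶻ x₃) *ᶻ (α *ᶻ x₁ +ᶻ β *ᶻ x₂ +ᶻ γ *ᶻ x₃) +ᶻ x₂ *ᶻ x₃ *ᶻ (α +ᶻ β +ᶻ γ)
      +ᶻ -ᶻ (α *ᶻ m₁ +ᶻ β *ᶻ m₂ +ᶻ γ *ᶻ m₃) *ᶻ p)
    identity = ℤR.solve-∀
    zeros : ∀ s t u → pos 0 +ᶻ (s *ᶻ pos 0 +ᶻ t *ᶻ pos 0 +ᶻ u) ≡ u
    zeros = ℤR.solve-∀

  dot-0 : ∀ {α β γ δ} s x y z w x' y' z' w' → dot α β γ δ x y z w ≡ pos 0 → dot α β γ δ x' y' z' w' ≡ pos 0 →
    dot α β γ δ (x -ᶻ s *ᶻ x') (y -ᶻ s *ᶻ y') (z -ᶻ s *ᶻ z') (w -ᶻ s *ᶻ w') ≡ pos 0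
  dot-0 {α} {β} {γ} {δ} s x y z w x' y' z' w' e e' = trans (dist α β γ δ x y z w x' y' z' w' s)
    (trans (cong₂ (λ u v → u -ᶻ s *ᶻ v) e e') (zero-comb s))
    where
    zero-comb : ∀ s → pos 0 -ᶻ s *ᶻ pos 0 ≡ pos 0
    zero-comb = ℤR.solve-∀
    dist : ∀ a b c d x y z w x' y' z' w' s →
      a *ᶻ (x -ᶻ s *ᶻ x') +ᶻ b *ᶻ (y -ᶻ s *ᶻ y') +ᶻ c *ᶻ (z -ᶻ s *ᶻ z') +ᶻ d *ᶻ (w -ᶻ s *ᶻ w')
      ≡ (a *ᶻ x +ᶻ b *ᶻ y +ᶻ c *ᶻ z +ᶻ d *ᶻ w) -ᶻ s *ᶻ (a *ᶻ x' +ᶻ b *ᶻ y' +ᶻ c *ᶻ z' +ᶻ d *ᶻ w')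
    dist = ℤR.solve-∀

  dot-∣ : ∀ α β γ δ {x y z w v} k₁ k₂ k₃ k₄ → x ≡ v +ᶻ k₁ *ᶻ pos p → y ≡ k₂ *ᶻ pos p → z ≡ k₃ *ᶻ pos p → w ≡ k₄ *ᶻ pos p →
    dot α β γ δ x y z w ≡ pos 0 → pos p ∣ᶻ α *ᶻ v
  dot-∣ α β γ δ {v = v} k₁ k₂ k₃ k₄ refl refl refl refl e = ℤS.divides (-ᶻ (α *ᶻ k₁ +ᶻ β *ᶻ k₂ +ᶻ γ *ᶻ k₃ +ᶻ δ *ᶻ k₄))
    (trans (isolate α β γ δ v k₁ k₂ k₃ k₄ (pos p)) (trans (cong (_+ᶻ _) e) (ℤP.+-identityˡ _)))
    where
    isolate : ∀ a b c d v k₁ k₂ k₃ k₄ p → a *ᶻ v ≡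
      (a *ᶻ (v +ᶻ k₁ *ᶻ p) +ᶻ b *ᶻ (k₂ *ᶻ p) +ᶻ c *ᶻ (k₃ *ᶻ p) +ᶻ d *ᶻ (k₄ *ᶻ p))
      +ᶻ -ᶻ (a *ᶻ k₁ +ᶻ b *ᶻ k₂ +ᶻ c *ᶻ k₃ +ᶻ d *ᶻ k₄) *ᶻ p
    isolate = ℤR.solve-∀

  -- The coefficients are the signed elementary symmetric functions of the roots. The nested
  -- subtractions let `dot-0` remove one coefficient at a time.
  cubic-value : ∀ a b c (P : CurvePoint p) →
    cz P -ᶻ (a +ᶻ b +ᶻ c) *ᶻ cy P -ᶻ (-ᶻ (a *ᶻ b +ᶻ a *ᶻ c +ᶻ b *ᶻ c)) *ᶻ cx P -ᶻ a *ᶻ b *ᶻ c *ᶻ pos 1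
    ≡ (cx P -ᶻ a) *ᶻ (cx P -ᶻ b) *ᶻ (cx P -ᶻ c) +ᶻ (cm P -ᶻ (a +ᶻ b +ᶻ c) *ᶻ cl P) *ᶻ pos p
  cubic-value a b c P = trans
    (cong₂ (λ z y → z -ᶻ (a +ᶻ b +ᶻ c) *ᶻ y -ᶻ (-ᶻ (a *ᶻ b +ᶻ a *ᶻ c +ᶻ b *ᶻ c)) *ᶻ cx P -ᶻ a *ᶻ b *ᶻ c *ᶻ pos 1) (z≡ P) (y≡ P))
    (factor (cx P) a b c (cl P) (cm P) (pos p))
    where
    factor : ∀ x a b c l m p → x *ᶻ x *ᶻ x +ᶻ m *ᶻ p -ᶻ (a +ᶻ b +ᶻ c) *ᶻ (x *ᶻ x +ᶻ l *ᶻ p)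
      -ᶻ (-ᶻ (a *ᶻ b +ᶻ a *ᶻ c +ᶻ b *ᶻ c)) *ᶻ x -ᶻ a *ᶻ b *ᶻ c *ᶻ pos 1
      ≡ (x -ᶻ a) *ᶻ (x -ᶻ b) *ᶻ (x -ᶻ c) +ᶻ (m -ᶻ (a +ᶻ b +ᶻ c) *ᶻ l) *ᶻ p
    factor = ℤR.solve-∀

  euclid₃ : ∀ α a b c → ¬ pos p ∣ᶻ a → ¬ pos p ∣ᶻ b → ¬ pos p ∣ᶻ c → pos p ∣ᶻ α *ᶻ (a *ᶻ b *ᶻ c) → pos p ∣ᶻ α
  euclid₃ α a b c ¬a ¬b ¬c d with euclidᶻ pp α (a *ᶻ b *ᶻ c) d
  ... | inj₁ r = r
  ... | inj₂ d with euclidᶻ pp (a *ᶻ b) c d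
  ...   | inj₂ r = ⊥-elim (¬c r)
  ...   | inj₁ d with euclidᶻ pp a b d
  ...     | inj₁ r = ⊥-elim (¬a r)
  ...     | inj₂ r = ⊥-elim (¬b r)

  root₁ : ∀ x b c → (x -ᶻ x) *ᶻ b *ᶻ c ≡ pos 0
  root₁ = ℤR.solve-∀

  root₂ : ∀ x b c → b *ᶻ (x -ᶻ x) *ᶻ c ≡ pos 0
  root₂ = ℤR.solve-∀

  root₃ : ∀ x b c → b *ᶻ c *ᶻ (x -ᶻ x) ≡ pos 0
  root₃ = ℤR.solve-∀

  dot-1 : ∀ a b c d → dot a b c d (pos 1) (pos 1) (pos 1) (pos 1) ≡ a +ᶻ b +ᶻ c +ᶻ d
  dot-1 = ones
    where
    ones : ∀ a b c d → a *ᶻ pos 1 +ᶻ b *ᶻ pos 1 +ᶻ c *ᶻ pos 1 +ᶻ d *ᶻ pos 1 ≡ a +ᶻ b +ᶻ c +ᶻ d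
    ones = ℤR.solve-∀

  at-root : ∀ {u v w} → u ≡ v +ᶻ w → v ≡ pos 0 → u ≡ w
  at-root e refl = trans e (ℤP.+-identityˡ _)

  vandermonde₄-∣ : ∀ {α β γ δ P Q R S} → Apart (cx P) (cx Q) → Apart (cx P) (cx R) → Apart (cx P) (cx S) →
    Dependent₄ α β γ δ P Q R S → pos p ∣ᶻ α
  vandermonde₄-∣ {α} {β} {γ} {δ} {P} {Q} {R} {S} PQ PR PS D =
    euclid₃ α (cx P -ᶻ cx Q) (cx P -ᶻ cx R) (cx P -ᶻ cx S) PQ PR PS
      (dot-∣ α β γ δ {g P} {g Q} {g R} {g S} (k P) (k Q) (k R) (k S) (value P)
        (at-root (value Q) (root₁ (cx Q) (cx Q -ᶻ cx R) (cx Q -ᶻ cx S)))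
        (at-root (value R) (root₂ (cx R) (cx R -ᶻ cx Q) (cx R -ᶻ cx S)))
        (at-root (value S) (root₃ (cx S) (cx S -ᶻ cx Q) (cx S -ᶻ cx R)))
        vanish)
    where
    open Dependent₄ D
    s₁ s₂ s₃ : ℤ
    s₁ = cx Q +ᶻ cx R +ᶻ cx S
    s₂ = -ᶻ (cx Q *ᶻ cx R +ᶻ cx Q *ᶻ cx S +ᶻ cx R *ᶻ cx S)
    s₃ = cx Q *ᶻ cx R *ᶻ cx S
    k g₁ g₂ g : CurvePoint p → ℤ
    k T = cm T -ᶻ s₁ *ᶻ cl T
    g₁ T = cz T -ᶻ s₁ *ᶻ cy T
    g₂ T = g₁ T -ᶻ s₂ *ᶻ cx T
    g T = g₂ T -ᶻ s₃ *ᶻ pos 1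
    value = cubic-value (cx Q) (cx R) (cx S)
    vanish : dot α β γ δ (g P) (g Q) (g R) (g S) ≡ pos 0
    vanish = dot-0 {α} {β} {γ} {δ} s₃ (g₂ P) (g₂ Q) (g₂ R) (g₂ S) (pos 1) (pos 1) (pos 1) (pos 1)
      (dot-0 {α} {β} {γ} {δ} s₂ (g₁ P) (g₁ Q) (g₁ R) (g₁ S) (cx P) (cx Q) (cx R) (cx S)
        (dot-0 {α} {β} {γ} {δ} s₁ (cz P) (cz Q) (cz R) (cz S) (cy P) (cy Q) (cy R) (cy S) Σz Σy) Σx)
      (trans (dot-1 α β γ δ) Σ1)

  private
    quot : ∀ {i} → pos p ∣ᶻ i → ℤ
    quot = _∣ᶻ_.quotient

  cancel₃ : ∀ {α β γ P Q R} (a : pos p ∣ᶻ α) (b : pos p ∣ᶻ β) (c : pos p ∣ᶻ γ) →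
    Dependent₃ {p} α β γ P Q R → Dependent₃ (quot a) (quot b) (quot c) P Q R
  cancel₃ {P = P} {Q} {R} (ℤS.divides a refl) (ℤS.divides b refl) (ℤS.divides c refl) D = record
    { Σ1 = ℤP.*-cancelʳ-≡ _ _ (pos p) (trans (factor₁ a b c (pos p)) Σ1)
    ; Σx = cancel (cx P) (cx Q) (cx R) Σx ; Σy = cancel (cy P) (cy Q) (cy R) Σy }
    where
    open Dependent₃ D
    factor₁ : ∀ a b c p → (a +ᶻ b +ᶻ c) *ᶻ p ≡ a *ᶻ p +ᶻ b *ᶻ p +ᶻ c *ᶻ p
    factor₁ = ℤR.solve-∀
    factor : ∀ a b c x y z p → (a *ᶻ x +ᶻ b *ᶻ y +ᶻ c *ᶻ z) *ᶻ p ≡ a *ᶻ p *ᶻ x +ᶻ b *ᶻ p *ᶻ y +ᶻ c *ᶻ p *ᶻ z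
    factor = ℤR.solve-∀
    cancel : ∀ x y z → a *ᶻ pos p *ᶻ x +ᶻ b *ᶻ pos p *ᶻ y +ᶻ c *ᶻ pos p *ᶻ z ≡ pos 0 → a *ᶻ x +ᶻ b *ᶻ y +ᶻ c *ᶻ z ≡ pos 0
    cancel x y z e = ℤP.*-cancelʳ-≡ _ _ (pos p) (trans (factor a b c x y z (pos p)) e)

  cancel₄ : ∀ {α β γ δ P Q R S} (a : pos p ∣ᶻ α) (b : pos p ∣ᶻ β) (c : pos p ∣ᶻ γ) (d : pos p ∣ᶻ δ) →
    Dependent₄ {p} α β γ δ P Q R S → Dependent₄ (quot a) (quot b) (quot c) (quot d) P Q R S
  cancel₄ {P = P} {Q} {R} {S} (ℤS.divides a refl) (ℤS.divides b refl) (ℤS.divides c refl) (ℤS.divides d refl) D = record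
    { Σ1 = ℤP.*-cancelʳ-≡ _ _ (pos p) (trans (factor₁ a b c d (pos p)) Σ1)
    ; Σx = cancel (cx P) (cx Q) (cx R) (cx S) Σx ; Σy = cancel (cy P) (cy Q) (cy R) (cy S) Σy ; Σz = cancel (cz P) (cz Q) (cz R) (cz S) Σz }
    where
    open Dependent₄ D
    factor₁ : ∀ a b c d p → (a +ᶻ b +ᶻ c +ᶻ d) *ᶻ p ≡ a *ᶻ p +ᶻ b *ᶻ p +ᶻ c *ᶻ p +ᶻ d *ᶻ p
    factor₁ = ℤR.solve-∀
    factor : ∀ a b c d x y z w p → (a *ᶻ x +ᶻ b *ᶻ y +ᶻ c *ᶻ z +ᶻ d *ᶻ w) *ᶻ p ≡ a *ᶻ p *ᶻ x +ᶻ b *ᶻ p *ᶻ y +ᶻ c *ᶻ p *ᶻ z +ᶻ d *ᶻ p *ᶻ w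
    factor = ℤR.solve-∀
    cancel : ∀ x y z w → dot (a *ᶻ pos p) (b *ᶻ pos p) (c *ᶻ pos p) (d *ᶻ pos p) x y z w ≡ pos 0 → dot a b c d x y z w ≡ pos 0
    cancel x y z w e = ℤP.*-cancelʳ-≡ (dot a b c d x y z w) (pos 0) (pos p) (trans (factor a b c d x y z w (pos p)) e)

  -- This lifts vanishing modulo p to vanishing over the integers: a nonzero good number would yield
  -- good numbers of ever smaller absolute value.
  descent : (Good : ℤ → Set) → (∀ {α} → Good α → Σ (pos p ∣ᶻ α) (Good ∘ quot)) → ∀ {α} → Good α → α ≡ pos 0
  descent Good divide {α} = go α (<-wellFounded ℤ.∣ α ∣)
    where
    go : ∀ α → Acc _<_ ℤ.∣ α ∣ → Good α → α ≡ pos 0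
    go α (acc rs) good with α ℤ.≟ pos 0 | divide good
    ... | yes e | _ = e
    ... | no α≢0 | ℤS.divides a refl , good' = cong (_*ᶻ pos p) (go a (rs (/p-< a α≢0)) good')

  -- Infinite descent: all weights are divisible by p, and dividing them by p gives another dependency.
  vandermonde₃ : ∀ {α β γ P Q R} → Apart (cx P) (cx Q) → Apart (cx P) (cx R) → Apart (cx Q) (cx R) → Dependent₃ α β γ P Q R → α ≡ pos 0
  vandermonde₃ {P = P} {Q} {R} PQ PR QR D = descent (λ α → ∃[ β ] ∃[ γ ] Dependent₃ α β γ P Q R)
    (λ (_ , _ , D) →
      let a = vandermonde₃-∣ PQ PR D
          b = vandermonde₃-∣ QR (apart-sym (cx P) (cx Q) PQ) (rotate₃ D)
          c = vandermonde₃-∣ (apart-sym (cx P) (cx R) PR) (apart-sym (cx Q) (cx R) QR) (rotate₃ (rotate₃ D))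
      in a , quot b , quot c , cancel₃ a b c D)
    (_ , _ , D)

  vandermonde₄ : ∀ {α β γ δ P Q R S} → Apart (cx P) (cx Q) → Apart (cx P) (cx R) → Apart (cx P) (cx S) →
    Apart (cx Q) (cx R) → Apart (cx Q) (cx S) → Apart (cx R) (cx S) → Dependent₄ α β γ δ P Q R S → α ≡ pos 0
  vandermonde₄ {P = P} {Q} {R} {S} PQ PR PS QR QS RS D = descent (λ α → ∃[ β ] ∃[ γ ] ∃[ δ ] Dependent₄ α β γ δ P Q R S)
    (λ (_ , _ , _ , D) →
      let a = vandermonde₄-∣ PQ PR PS D
          b = vandermonde₄-∣ QR QS (apart-sym (cx P) (cx Q) PQ) (rotate₄ D)
          c = vandermonde₄-∣ RS (apart-sym (cx P) (cx R) PR) (apart-sym (cx Q) (cx R) QR) (rotate₄ (rotate₄ D))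
          d = vandermonde₄-∣ (apart-sym (cx P) (cx S) PS) (apart-sym (cx Q) (cx S) QS) (apart-sym (cx R) (cx S) RS) (rotate₄ (rotate₄ (rotate₄ D)))
      in a , quot b , quot c , quot d , cancel₄ a b c d D)
    (_ , _ , _ , D)

-- Straight-line drawings from such points

Edge-symmetric : ∀ {n} (G : Graph n) {u v} → Edge G u v → Edge G v u
Edge-symmetric G {u} {v} e = trans (adj-sym G v u) e

-- Tracks are not named: two vertices share a track when their `X` agree, and by `Y-col` a track
-- then lies on one vertical line.
record CurvePoints {n} (G : Graph n) (p : ℕ) : Set where
  field
    point     : Fin n → CurvePoint p
  X : Fin n → ℤ
  X v = CurvePoint.cx (point v)
  Y : Fin n → ℤ
  Y v = CurvePoint.cy (point v)
  Z : Fin n → ℤ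
  Z v = CurvePoint.cz (point v)
  field
    Y-col     : ∀ {u v} → X u ≡ X v → Y u ≡ Y v
    separated : ∀ {u v} → X u ≢ X v → ¬ pos p ∣ᶻ X u -ᶻ X v
    distinct  : ∀ {u v} → X u ≡ X v → Z u ≡ Z v → u ≡ v
    proper    : ∀ {u v} → Edge G u v → X u ≢ X v
    no-cross  : ∀ v w x y → X v ≡ X w → X x ≡ X y → Z v ℤ.< Z w → Z x ℤ.< Z y →
                Edge G v y → Edge G w x → ⊥

weights⇒+ : ∀ a b c d → a +ᶻ b ≡ c +ᶻ d → a +ᶻ b +ᶻ -ᶻ c +ᶻ -ᶻ d ≡ pos 0
weights⇒+ a b c d e = trans (move a b c d) (ℤP.i≡j⇒i-j≡0 e)
  where
  move : ∀ a b c d → a +ᶻ b +ᶻ -ᶻ c +ᶻ -ᶻ d ≡ (a +ᶻ b) -ᶻ (c +ᶻ d)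
  move = ℤR.solve-∀

weights⇒* : ∀ a b c d x y z w → a *ᶻ x +ᶻ b *ᶻ y ≡ c *ᶻ z +ᶻ d *ᶻ w →
  a *ᶻ x +ᶻ b *ᶻ y +ᶻ -ᶻ c *ᶻ z +ᶻ -ᶻ d *ᶻ w ≡ pos 0
weights⇒* a b c d x y z w e = trans (move a b c d x y z w) (ℤP.i≡j⇒i-j≡0 e)
  where
  move : ∀ a b c d x y z w → a *ᶻ x +ᶻ b *ᶻ y +ᶻ -ᶻ c *ᶻ z +ᶻ -ᶻ d *ᶻ w ≡ (a *ᶻ x +ᶻ b *ᶻ y) -ᶻ (c *ᶻ z +ᶻ d *ᶻ w)
  move = ℤR.solve-∀

collect⇒+ : ∀ a b c d → a +ᶻ b ≡ c +ᶻ d → b +ᶻ (a -ᶻ c) +ᶻ -ᶻ d ≡ pos 0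
collect⇒+ a b c d e = trans (move a b c d) (ℤP.i≡j⇒i-j≡0 e)
  where
  move : ∀ a b c d → b +ᶻ (a -ᶻ c) +ᶻ -ᶻ d ≡ (a +ᶻ b) -ᶻ (c +ᶻ d)
  move = ℤR.solve-∀

collect⇒* : ∀ a b c d x y w → a *ᶻ x +ᶻ b *ᶻ y ≡ c *ᶻ x +ᶻ d *ᶻ w →
  b *ᶻ y +ᶻ (a -ᶻ c) *ᶻ x +ᶻ -ᶻ d *ᶻ w ≡ pos 0
collect⇒* a b c d x y w e = trans (move a b c d x y w) (ℤP.i≡j⇒i-j≡0 e)
  where
  move : ∀ a b c d x y w → b *ᶻ y +ᶻ (a -ᶻ c) *ᶻ x +ᶻ -ᶻ d *ᶻ w ≡ (a *ᶻ x +ᶻ b *ᶻ y) -ᶻ (c *ᶻ x +ᶻ d *ᶻ w)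
  move = ℤR.solve-∀

only-second : ∀ b x y z w → pos 0 *ᶻ x +ᶻ pos (suc b) *ᶻ y ≡ pos 0 *ᶻ z +ᶻ pos (suc b) *ᶻ w → y ≡ w
only-second b x y z w e = ℤP.*-cancelˡ-≡ (pos (suc b)) y w (trans (sym (ℤP.+-identityˡ _)) (trans e (ℤP.+-identityˡ _)))

-- With positive weights and equal sums, a smaller first term forces a larger second one. This turns
-- a meeting point of two edges between the same two tracks into a crossing of their orders.
balance : ∀ a b {i j k l} → pos (suc a) *ᶻ i +ᶻ pos (suc b) *ᶻ j ≡ pos (suc a) *ᶻ k +ᶻ pos (suc b) *ᶻ l → i ℤ.< k → l ℤ.< j
balance a b e lt = ℤP.≰⇒> λ j≤l → ℤP.<-irrefl e
  (ℤP.+-mono-<-≤ (ℤP.*-monoˡ-<-pos (pos (suc a)) lt) (ℤP.*-monoˡ-≤-nonNeg (pos (suc b)) j≤l))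

+ᶻ-comm-≡ : ∀ a b c d → a +ᶻ b ≡ c +ᶻ d → b +ᶻ a ≡ d +ᶻ c
+ᶻ-comm-≡ a b c d e = trans (ℤP.+-comm b a) (trans e (ℤP.+-comm c d))

-- The point a·u + b·v of the segment uv, weights scaled by a + b, equals the point c·x + d·y of xy.
record Meet {n} (P : Fin n → ℤ) (a b c d : ℕ) (u v x y : Fin n) : Set where
  constructor meet
  field
    eq : pos a *ᶻ P u +ᶻ pos b *ᶻ P v ≡ pos c *ᶻ P x +ᶻ pos d *ᶻ P y

swap₁ : ∀ {n} {P : Fin n → ℤ} {a b c d u v x y} → Meet P a b c d u v x y → Meet P b a c d v u x y
swap₁ {P = P} {a} {b} {c} {d} {u} {v} {x} {y} (meet e) = meet (trans (ℤP.+-comm (pos b *ᶻ P v) (pos a *ᶻ P u)) e)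

swap₂ : ∀ {n} {P : Fin n → ℤ} {a b c d u v x y} → Meet P a b c d u v x y → Meet P a b d c u v y x
swap₂ {P = P} {a} {b} {c} {d} {u} {v} {x} {y} (meet e) = meet (trans e (ℤP.+-comm (pos c *ᶻ P x) (pos d *ᶻ P y)))

record AtVertex (a b : ℕ) {n} (u v x y w : Fin n) : Set where
  constructor at
  field
    endpoint : (w ≡ u × b ≡ 0) ⊎ (w ≡ v × a ≡ 0)
    common   : w ≡ x ⊎ w ≡ y

module _ {n} {G : Graph n} {p : ℕ} (pp : Prime p) (C : CurvePoints G p) where
  open CurvePoints C

  Meets : ∀ (a b c d : ℕ) (u v x y : Fin n) → Set
  Meets a b c d u v x y = Meet X a b c d u v x y × Meet Y a b c d u v x y × Meet Z a b c d u v x y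

  meets-swap₁ : ∀ {a b c d u v x y} → Meets a b c d u v x y → Meets b a c d v u x y
  meets-swap₁ (e , f , g) = swap₁ e , swap₁ f , swap₁ g

  meets-swap₂ : ∀ {a b c d u v x y} → Meets a b c d u v x y → Meets a b d c u v y x
  meets-swap₂ (e , f , g) = swap₂ e , swap₂ f , swap₂ g

  -- The coincidence is an affine dependence of four points on different tracks. Applied to both
  -- ends of uv, it contradicts the positive total weight.
  four-tracks : ∀ {a b c d u v x y} → Meets a b c d u v x y → a + b ≡ c + d →
    X u ≢ X v → X u ≢ X x → X u ≢ X y → X v ≢ X x → X v ≢ X y → X x ≢ X y → a ≡ 0
  four-tracks {a} {b} {c} {d} {u} {v} {x} {y} (meet e₁ , meet e₂ , meet e₃) sum uv ux uy vx vy xy =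
    ℤP.+-injective (vandermonde₄ pp {pos a} {pos b} { -ᶻ pos c} { -ᶻ pos d} {point u} {point v} {point x} {point y}
      (separated uv) (separated ux) (separated uy) (separated vx) (separated vy) (separated xy) record
      { Σ1 = weights⇒+ (pos a) (pos b) (pos c) (pos d) (cong pos sum)
      ; Σx = weights⇒* (pos a) (pos b) (pos c) (pos d) (X u) (X v) (X x) (X y) e₁
      ; Σy = weights⇒* (pos a) (pos b) (pos c) (pos d) (Y u) (Y v) (Y x) (Y y) e₂
      ; Σz = weights⇒* (pos a) (pos b) (pos c) (pos d) (Z u) (Z v) (Z x) (Z y) e₃ })

  -- Merging the weights of u and x leaves a dependence of three projected points, so the weights of
  -- v and y vanish. What remains is a = c, and the third coordinate identifies u with x.
  three-tracks : ∀ {a b c d u v x y} → Meets a b c d u v x y → a + b ≡ c + d → 0 < a + b →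
    X u ≡ X x → X u ≢ X v → X u ≢ X y → X v ≢ X y → b ≡ 0 × u ≡ x
  three-tracks {a} {b} {c} {d} {u} {v} {x} {y} (meet e₁ , meet e₂ , meet e₃) sum q>0 ux uv uy vy =
    b≡0 , distinct ux (final a c sum' q>0' e₃')
    where
    collinear : ∀ (P : Fin n → ℤ) → P u ≡ P x → pos a *ᶻ P u +ᶻ pos b *ᶻ P v ≡ pos c *ᶻ P x +ᶻ pos d *ᶻ P y →
      pos b *ᶻ P v +ᶻ (pos a -ᶻ pos c) *ᶻ P u +ᶻ -ᶻ pos d *ᶻ P y ≡ pos 0
    collinear P ux e = collect⇒* (pos a) (pos b) (pos c) (pos d) (P u) (P v) (P y) (trans e (cong (λ z → pos c *ᶻ z +ᶻ pos d *ᶻ P y) (sym ux)))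
    dep : Dependent₃ (pos b) (pos a -ᶻ pos c) (-ᶻ pos d) (point v) (point u) (point y)
    dep = record { Σ1 = collect⇒+ (pos a) (pos b) (pos c) (pos d) (cong pos sum)
                 ; Σx = collinear X ux e₁ ; Σy = collinear Y (Y-col ux) e₂ }
    b≡0 : b ≡ 0
    b≡0 = ℤP.+-injective (vandermonde₃ pp (separated (uv ∘ sym)) (separated vy) (separated uy) dep)
    neg0 : ∀ d → -ᶻ pos d ≡ pos 0 → d ≡ 0
    neg0 zero _ = refl
    d≡0 : d ≡ 0
    d≡0 = neg0 d (vandermonde₃ pp (separated (vy ∘ sym)) (separated (uy ∘ sym)) (separated (uv ∘ sym)) (rotate₃ (rotate₃ dep)))
    sum' : a ≡ c
    sum' = trans (sym (+-identityʳ a)) (trans (subst₂ (λ b d → a + b ≡ c + d) b≡0 d≡0 sum) (+-identityʳ c))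
    q>0' : 0 < a
    q>0' = subst (0 <_) (trans (cong (a +_) b≡0) (+-identityʳ a)) q>0
    e₃' : pos a *ᶻ Z u ≡ pos c *ᶻ Z x
    e₃' = trans (sym (ℤP.+-identityʳ _)) (trans (subst₂ (λ b d → pos a *ᶻ Z u +ᶻ pos b *ᶻ Z v ≡ pos c *ᶻ Z x +ᶻ pos d *ᶻ Z y) b≡0 d≡0 e₃) (ℤP.+-identityʳ _))
    final : ∀ a c → a ≡ c → 0 < a → pos a *ᶻ Z u ≡ pos c *ᶻ Z x → Z u ≡ Z x
    final (suc a) _ refl _ e = ℤP.*-cancelˡ-≡ (pos (suc a)) (Z u) (Z x) e

  -- The first coordinate forces equal weights on equal tracks. If both weights are positive,
  -- comparing third coordinates gives a crossing or the same edge; a zero weight puts the common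
  -- point at an end.
  two-tracks : ∀ {a b c d u v x y} → Meets a b c d u v x y → a + b ≡ c + d → 0 < a + b →
    Edge G u v → Edge G x y → ¬ (u ≡ x × v ≡ y) →
    X u ≡ X x → X v ≡ X y → (b ≡ 0 × u ≡ x) ⊎ (a ≡ 0 × v ≡ y)
  two-tracks {a} {b} {c} {d} {u} {v} {x} {y} (meet e₁ , _ , meet e₃) sum q>0 Euv Exy diff ux vy =
    cases a b (+-cancelʳ-≡ b a c (trans sum (cong (c +_) (sym b≡d)))) b≡d e₃ q>0
    where
    b≡d : b ≡ d
    b≡d = ℤP.+-injective (ℤP.i-j≡0⇒i≡j (pos b) (pos d) (*-cancelʳ-0 (pos b -ᶻ pos d) (X v -ᶻ X u) (trans
      (move (pos a) (pos b) (pos c) (pos d) (X u) (X v))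
      (trans (cong₂ (λ s t → s -ᶻ X u *ᶻ t) (ℤP.i≡j⇒i-j≡0 (trans e₁ (sym (cong₂ (λ s t → pos c *ᶻ s +ᶻ pos d *ᶻ t) ux vy)))) (ℤP.i≡j⇒i-j≡0 (cong pos sum)))
        (zero-comb (X u))))
      (≢⇒-≢0 (proper Euv ∘ sym))))
      where
      move : ∀ a b c d x y → (b -ᶻ d) *ᶻ (y -ᶻ x) ≡ ((a *ᶻ x +ᶻ b *ᶻ y) -ᶻ (c *ᶻ x +ᶻ d *ᶻ y)) -ᶻ x *ᶻ ((a +ᶻ b) -ᶻ (c +ᶻ d))
      move = ℤR.solve-∀
      zero-comb : ∀ s → pos 0 -ᶻ s *ᶻ pos 0 ≡ pos 0
      zero-comb = ℤR.solve-∀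
    cases : ∀ a b → a ≡ c → b ≡ d → pos a *ᶻ Z u +ᶻ pos b *ᶻ Z v ≡ pos c *ᶻ Z x +ᶻ pos d *ᶻ Z y → 0 < a + b →
      (b ≡ 0 × u ≡ x) ⊎ (a ≡ 0 × v ≡ y)
    cases zero (suc b) refl refl e _ = inj₂ (refl , distinct vy (only-second b (Z u) (Z v) (Z x) (Z y) e))
    cases (suc a) zero refl refl e _ = inj₁ (refl , distinct ux (only-second a (Z v) (Z u) (Z y) (Z x)
      (+ᶻ-comm-≡ (pos (suc a) *ᶻ Z u) (pos 0 *ᶻ Z v) (pos (suc a) *ᶻ Z x) (pos 0 *ᶻ Z y) e)))
    cases (suc a) (suc b) refl refl e _ with ℤP.<-cmp (Z u) (Z x) | ℤP.<-cmp (Z v) (Z y)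
    ... | tri< lt _ _ | _ = ⊥-elim (no-cross u x y v ux (sym vy) lt (balance a b e lt) Euv Exy)
    ... | tri> _ _ gt | _ = ⊥-elim (no-cross x u v y (sym ux) vy gt (balance a b (sym e) gt) Exy Euv)
    ... | tri≈ _ zux _ | tri≈ _ zvy _ = ⊥-elim (diff (distinct ux zux , distinct vy zvy))
    ... | tri≈ ¬lt _ ¬gt | tri< lt _ _ = ⊥-elim (¬gt (balance b a (swapped e) lt))
      where swapped = +ᶻ-comm-≡ (pos (suc a) *ᶻ Z u) (pos (suc b) *ᶻ Z v) (pos (suc a) *ᶻ Z x) (pos (suc b) *ᶻ Z y)
    ... | tri≈ ¬lt _ ¬gt | tri> _ _ gt = ⊥-elim (¬lt (balance b a (swapped (sym e)) gt))
      where swapped = +ᶻ-comm-≡ (pos (suc a) *ᶻ Z x) (pos (suc b) *ᶻ Z y) (pos (suc a) *ᶻ Z u) (pos (suc b) *ᶻ Z v)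

  -- Properness excludes that one end shares its track with both ends of the other edge; up to
  -- swapping ends, two, one or no tracks are shared.
  edges-meet : ∀ {a b c d u v x y} → Meets a b c d u v x y → a + b ≡ c + d → 0 < a + b →
    Edge G u v → Edge G x y → ¬ (u ≡ x × v ≡ y) → ¬ (u ≡ y × v ≡ x) → ∃[ w ] AtVertex a b u v x y w
  edges-meet {a} {b} {c} {d} {u} {v} {x} {y} M sum q>0 Euv Exy d₁ d₂ =
    cases (X u ℤ.≟ X x) (X u ℤ.≟ X y) (X v ℤ.≟ X x) (X v ℤ.≟ X y)
    where
    q>0' : 0 < b + a
    q>0' = subst (0 <_) (+-comm a b) q>0
    sum₁ : b + a ≡ c + d
    sum₁ = trans (+-comm b a) sum
    sum₂ : a + b ≡ d + c
    sum₂ = trans sum (+-comm c d)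
    sum₁₂ : b + a ≡ d + c
    sum₁₂ = trans sum₁ (+-comm c d)
    M₁ : Meets b a c d v u x y
    M₁ = meets-swap₁ {a} {b} {c} {d} M
    M₂ : Meets a b d c u v y x
    M₂ = meets-swap₂ {a} {b} {c} {d} M
    M₁₂ : Meets b a d c v u y x
    M₁₂ = meets-swap₁ {a} {b} {d} {c} M₂
    vu : X v ≢ X u
    vu = proper Euv ∘ sym
    at-u : ∀ {z} → (z ≡ x ⊎ z ≡ y) → b ≡ 0 × u ≡ z → ∃[ w ] AtVertex a b u v x y w
    at-u i (b0 , refl) = u , at (inj₁ (refl , b0)) i
    at-v : ∀ {z} → (z ≡ x ⊎ z ≡ y) → a ≡ 0 × v ≡ z → ∃[ w ] AtVertex a b u v x y w
    at-v i (a0 , refl) = v , at (inj₂ (refl , a0)) i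
    cases : Dec (X u ≡ X x) → Dec (X u ≡ X y) → Dec (X v ≡ X x) → Dec (X v ≡ X y) → ∃[ w ] AtVertex a b u v x y w
    cases (yes ux) (yes uy) _ _ = ⊥-elim (proper Exy (trans (sym ux) uy))
    cases (yes ux) _ (yes vx) _ = ⊥-elim (proper Euv (trans ux (sym vx)))
    cases _ _ (yes vx) (yes vy) = ⊥-elim (proper Exy (trans (sym vx) vy))
    cases _ (yes uy) _ (yes vy) = ⊥-elim (proper Euv (trans uy (sym vy)))
    cases (yes ux) (no uy) (no vx) (yes vy) =
      [ at-u (inj₁ refl) , at-v (inj₂ refl) ]′ (two-tracks {a} {b} {c} {d} M sum q>0 Euv Exy d₁ ux vy)
    cases (no ux) (yes uy) (yes vx) (no vy) =
      [ at-u (inj₂ refl) , at-v (inj₁ refl) ]′ (two-tracks {a} {b} {d} {c} M₂ sum₂ q>0 Euv (Edge-symmetric G Exy) d₂ uy vx)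
    cases (yes ux) (no uy) (no vx) (no vy) =
      at-u (inj₁ refl) (three-tracks {a} {b} {c} {d} M sum q>0 ux (proper Euv) uy vy)
    cases (no ux) (yes uy) (no vx) (no vy) =
      at-u (inj₂ refl) (three-tracks {a} {b} {d} {c} M₂ sum₂ q>0 uy (proper Euv) ux vx)
    cases (no ux) (no uy) (yes vx) (no vy) =
      at-v (inj₁ refl) (three-tracks {b} {a} {c} {d} M₁ sum₁ q>0' vx vu vy uy)
    cases (no ux) (no uy) (no vx) (yes vy) =
      at-v (inj₂ refl) (three-tracks {b} {a} {d} {c} M₁₂ sum₁₂ q>0' vy vu vx ux)
    cases (no ux) (no uy) (no vx) (no vy) = ⊥-elim (<-irrefl (sym (cong₂ _+_
      (four-tracks {a} {b} {c} {d} M sum (proper Euv) ux uy vx vy (proper Exy))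
      (four-tracks {b} {a} {c} {d} M₁ sum₁ vu vx vy ux uy (proper Exy)))) q>0)

  scaled : ∀ b a x y → scaledPt (a + b) b x y ≡ pos a *ᶻ x +ᶻ pos b *ᶻ y
  scaled b a x y = expand (pos a) (pos b) x y
    where
    expand : ∀ a b x y → (a +ᶻ b) *ᶻ x +ᶻ b *ᶻ (y -ᶻ x) ≡ a *ᶻ x +ᶻ b *ᶻ y
    expand = ℤR.solve-∀

  On : ∀ (a b : ℕ) (u v w : Fin n) (P : Fin n → ℤ) → Set
  On a b u v w P = pos (a + b) *ᶻ P w ≡ pos a *ᶻ P u +ᶻ pos b *ᶻ P v

  above-end : ∀ a b {u v w} → Edge G u v → 0 < a + b → X w ≡ X u → On a b u v w X → On a b u v w Z → w ≡ u
  above-end a b {u} {v} {w} Euv q>0 wu eX eZ = distinct wu (cancelled (a + b) q>0 (begin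
      pos (a + b) *ᶻ Z w ≡⟨ eZ ⟩
      pos a *ᶻ Z u +ᶻ pos b *ᶻ Z v ≡⟨ cong (λ s → pos a *ᶻ Z u +ᶻ pos s *ᶻ Z v) b≡0 ⟩
      pos a *ᶻ Z u +ᶻ pos 0 ≡⟨ cong (λ s → pos a *ᶻ Z u +ᶻ pos s *ᶻ Z u) b≡0 ⟨
      pos a *ᶻ Z u +ᶻ pos b *ᶻ Z u ≡⟨ ℤP.*-distribʳ-+ (Z u) (pos a) (pos b) ⟨
      pos (a + b) *ᶻ Z u ∎))
    where
    open ≡-Reasoning
    cancelled : ∀ q {i j} → 0 < q → pos q *ᶻ i ≡ pos q *ᶻ j → i ≡ j
    cancelled (suc q) {i} {j} _ e = ℤP.*-cancelˡ-≡ (pos (suc q)) i j e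
    b≡0 : b ≡ 0
    b≡0 = ℤP.+-injective (*-cancelʳ-0 (pos b) (X v -ᶻ X u) (trans (move (pos a) (pos b) (X u) (X v))
      (ℤP.i≡j⇒i-j≡0 (trans (sym eX) (cong (pos (a + b) *ᶻ_) wu)))) (≢⇒-≢0 (proper Euv ∘ sym)))
      where
      move : ∀ a b x y → b *ᶻ (y -ᶻ x) ≡ (a *ᶻ x +ᶻ b *ᶻ y) -ᶻ (a +ᶻ b) *ᶻ x
      move = ℤR.solve-∀

  On-swap : ∀ a b {u v w} P → On a b u v w P → On b a v u w P
  On-swap a b {u} {v} {w} P e = trans (cong (λ q → pos q *ᶻ P w) (+-comm b a)) (trans e (ℤP.+-comm (pos a *ᶻ P u) (pos b *ᶻ P v)))

  vertex-on-edge : ∀ a b {u v w} → Edge G u v → 0 < a + b → On a b u v w X → On a b u v w Y → On a b u v w Z → w ≡ u ⊎ w ≡ v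
  vertex-on-edge a b {u} {v} {w} Euv q>0 eX eY eZ = cases (X w ℤ.≟ X u) (X w ℤ.≟ X v)
    where
    sum0 : ∀ a b → (a +ᶻ b) +ᶻ -ᶻ a +ᶻ -ᶻ b ≡ pos 0
    sum0 = ℤR.solve-∀
    move : ∀ q a b w x y → q *ᶻ w +ᶻ -ᶻ a *ᶻ x +ᶻ -ᶻ b *ᶻ y ≡ q *ᶻ w -ᶻ (a *ᶻ x +ᶻ b *ᶻ y)
    move = ℤR.solve-∀
    shift : ∀ P → On a b u v w P → pos (a + b) *ᶻ P w +ᶻ -ᶻ pos a *ᶻ P u +ᶻ -ᶻ pos b *ᶻ P v ≡ pos 0
    shift P e = trans (move (pos (a + b)) (pos a) (pos b) (P w) (P u) (P v)) (ℤP.i≡j⇒i-j≡0 e)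
    cases : Dec (X w ≡ X u) → Dec (X w ≡ X v) → w ≡ u ⊎ w ≡ v
    cases (yes wu) _ = inj₁ (above-end a b Euv q>0 wu eX eZ)
    cases (no _) (yes wv) = inj₂ (above-end b a (Edge-symmetric G Euv) (subst (0 <_) (+-comm a b) q>0) wv (On-swap a b X eX) (On-swap a b Z eZ))
    cases (no wu) (no wv) = ⊥-elim (<-irrefl (sym (ℤP.+-injective (vandermonde₃ pp {pos (a + b)} { -ᶻ pos a} { -ᶻ pos b} {point w} {point u} {point v}
      (separated wu) (separated wv) (separated (proper Euv)) record
      { Σ1 = sum0 (pos a) (pos b) ; Σx = shift X eX ; Σy = shift Y eY }))) q>0)

  drawing : Drawing3D G
  drawing = record { px = X ; py = Y ; pz = Z ; injective = λ u v ex _ ez → distinct ex ez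
                   ; vertex-ok = vertex-ok' ; edge-ok = edge-ok' }
    where
    vertex-ok' : ∀ u v w → Edge G u v → (q s : ℕ) → 0 < q → s ≤ q →
      pos q *ᶻ X w ≡ scaledPt q s (X u) (X v) → pos q *ᶻ Y w ≡ scaledPt q s (Y u) (Y v) →
      pos q *ᶻ Z w ≡ scaledPt q s (Z u) (Z v) → w ≡ u ⊎ w ≡ v
    -- Writing q as a + s turns the point at ratio s/q into the integer combination with weights a
    -- and s.
    vertex-ok' u v w Euv q s q>0 s≤q ex ey ez with q ∸ s | m∸n+n≡m s≤q
    ... | a | refl = vertex-on-edge a s Euv q>0 (trans ex (scaled s a (X u) (X v)))
      (trans ey (scaled s a (Y u) (Y v))) (trans ez (scaled s a (Z u) (Z v)))
    edge-ok' : ∀ u v x y → Edge G u v → Edge G x y → ¬ ((u ≡ x × v ≡ y) ⊎ (u ≡ y × v ≡ x)) →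
      (q s t : ℕ) → 0 < q → s ≤ q → t ≤ q →
      scaledPt q s (X u) (X v) ≡ scaledPt q t (X x) (X y) →
      scaledPt q s (Y u) (Y v) ≡ scaledPt q t (Y x) (Y y) →
      scaledPt q s (Z u) (Z v) ≡ scaledPt q t (Z x) (Z y) →
      ∃[ w ] ((w ≡ u ⊎ w ≡ v) × (w ≡ x ⊎ w ≡ y) ×
              pos q *ᶻ X w ≡ scaledPt q s (X u) (X v) ×
              pos q *ᶻ Y w ≡ scaledPt q s (Y u) (Y v) ×
              pos q *ᶻ Z w ≡ scaledPt q s (Z u) (Z v))
    edge-ok' u v x y Euv Exy diff q s t q>0 s≤q t≤q ex ey ez
      with q ∸ s | m∸n+n≡m s≤q | q ∸ t | m∸n+n≡m t≤q
    ... | a | refl | c | e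
      with edges-meet {a} {s} {c} {t} (m X ex , m Y ey , m Z ez) (sym e) q>0 Euv Exy (diff ∘ inj₁) (diff ∘ inj₂)
      where
      m : ∀ P → scaledPt (a + s) s (P u) (P v) ≡ scaledPt (a + s) t (P x) (P y) → Meet P a s c t u v x y
      m P eq = meet (trans (sym (scaled s a (P u) (P v))) (trans eq
        (trans (cong (λ q → scaledPt q t (P x) (P y)) (sym e)) (scaled t c (P x) (P y)))))
    ... | w , at (inj₁ (refl , refl)) com = w , inj₁ refl , com , f X , f Y , f Z
      where
      f : ∀ P → pos (a + 0) *ᶻ P u ≡ scaledPt (a + 0) 0 (P u) (P v)
      f P = sym (ℤP.+-identityʳ _)
    ... | w , at (inj₂ (refl , refl)) com = w , inj₂ refl , com , f X , f Y , f Z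
      where
      f : ∀ P → pos s *ᶻ P v ≡ scaledPt s s (P u) (P v)
      f P = trans (sym (ℤP.+-identityˡ _)) (sym (scaled s 0 (P u) (P v)))

-- Track layouts

record TrackLayout {n} (G : Graph n) (t : ℕ) : Set where
  field
    col ord : Fin n → ℕ
    col<    : ∀ v → col v < t
    ord-inj : ∀ {u v} → col u ≡ col v → ord u ≡ ord v → u ≡ v
    proper  : ∀ {u v} → Edge G u v → col u ≢ col v
    no-X    : ∀ {v w x y} → col v ≡ col w → col x ≡ col y → ord v < ord w → ord x < ord y →
              Edge G v y → Edge G w x → ⊥

singleton-tracks : ∀ {n} (G : Graph n) → TrackLayout G n
singleton-tracks G = record
  { col = toℕ ; ord = λ _ → 0 ; col< = FinP.toℕ<n ; ord-inj = λ e _ → FinP.toℕ-injective e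
  ; proper = λ {u} {v} e c → case FinP.toℕ-injective {i = u} {v} c of λ { refl → true≢false (trans (sym e) (adj-irr G u)) }
  ; no-X = λ _ _ ()
  }

small-∣⇒≡ : ∀ {p a b} → a < p → b < p → pos p ∣ᶻ pos a -ᶻ pos b → a ≡ b
small-∣⇒≡ {p} {a} {b} a<p b<p d with ℤ.∣ a ℤ.⊖ b ∣ in e
... | zero = ℤP.+-injective (ℤP.i-j≡0⇒i≡j (pos a) (pos b) (trans (ℤP.m-n≡m⊖n a b) (ℤP.∣i∣≡0⇒i≡0 e)))
... | suc k = ⊥-elim (<⇒≱ (⊔-pres-<m a<p b<p) (begin
  p ≤⟨ ∣⇒≤ (subst (p ∣_) e (subst (λ i → p ∣ ℤ.∣ i ∣) (ℤP.m-n≡m⊖n a b) (ℤS.∣⇒∣ᵤ d))) ⟩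
  suc k ≡⟨ e ⟨
  ℤ.∣ a ℤ.⊖ b ∣ ≤⟨ ℤP.∣m⊝n∣≤m⊔n a b ⟩
  a ⊔ b ∎))
  where
  open ≤-Reasoning

-- Balanced tracks on the moment curve

module _ {n} {G : Graph n} {t} (L : TrackLayout G t) (1≤t : 1 ≤ t) (t≤n : t ≤ n) where
  open TrackLayout L

  private
    instance
      t≢0 : NonZero t
      t≢0 = >-nonZero 1≤t

    Before : Fin n → Fin n → Set
    Before u v = col u < col v ⊎ (col u ≡ col v × ord u < ord v)

    before? : ∀ u v → Dec (Before u v)
    before? u v = (col u <? col v) ⊎-dec ((col u Data.Nat.≟ col v) ×-dec (ord u <? ord v))

    before-trans : ∀ {u v w} → Before u v → Before v w → Before u w
    before-trans (inj₁ a) (inj₁ b) = inj₁ (<-trans a b)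
    before-trans {u} (inj₁ a) (inj₂ (b , _)) = inj₁ (subst (col u <_) b a)
    before-trans {w = w} (inj₂ (a , _)) (inj₁ b) = inj₁ (subst (_< col w) (sym a) b)
    before-trans (inj₂ (a , a')) (inj₂ (b , b')) = inj₂ (trans a b , <-trans a' b')

    before-irrefl : ∀ {u} → ¬ Before u u
    before-irrefl (inj₁ a) = <-irrefl refl a
    before-irrefl (inj₂ (_ , a)) = <-irrefl refl a

    before-cmp : ∀ u v → Before u v ⊎ u ≡ v ⊎ Before v u
    before-cmp u v with <-cmp (col u) (col v)
    ... | tri< a _ _ = inj₁ (inj₁ a)
    ... | tri> _ _ a = inj₂ (inj₂ (inj₁ a))
    ... | tri≈ _ e _ with <-cmp (ord u) (ord v)
    ...   | tri< a _ _ = inj₁ (inj₂ (e , a))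
    ...   | tri> _ _ a = inj₂ (inj₂ (inj₂ (sym e , a)))
    ...   | tri≈ _ e' _ = inj₂ (inj₁ (ord-inj e e'))

    rank : Fin n → ℕ
    rank v = count (λ u → does (before? u v))

    rank-< : ∀ {u v} → Before u v → rank u < rank v
    rank-< {u} {v} b = count-< (λ w e → dec-true (before? w v) (before-trans (does⇒ (before? w u) e) b))
      (dec-true (before? u v) b) (λ e → before-irrefl (does⇒ (before? u u) e))

    rank<n : ∀ v → rank v < n
    rank<n v = <-≤-trans (count-< {q = λ _ → true} (λ _ _ → refl) {v} refl (λ e → before-irrefl (does⇒ (before? v v) e))) (count≤n {n} (λ _ → true))

    rank-inj : ∀ {u v} → rank u ≡ rank v → u ≡ v
    rank-inj {u} {v} e with before-cmp u v
    ... | inj₁ b        = ⊥-elim (<⇒≢ (rank-< b) e)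
    ... | inj₂ (inj₁ r) = r
    ... | inj₂ (inj₂ b) = ⊥-elim (<⇒≢ (rank-< b) (sym e))

    s : ℕ
    s = suc (n / t)

    -- Cutting the ranking into blocks of length s splits the tracks; since colour and block number both
    -- increase along the ranking, their sum determines them.
    track : Fin n → ℕ
    track v = col v + rank v / s

    track-mono : ∀ {u v} → Before u v → track u ≡ track v → col u ≡ col v × rank u / s ≡ rank v / s
    track-mono {u} {v} b e = c≡ , +-cancelˡ-≡ (col u) _ _ (trans e (cong (_+ rank v / s) (sym c≡)))
      where
      c≤ : col u ≤ col v
      c≤ = [ <⇒≤ , ≤-reflexive ∘ proj₁ ]′ b
      r≤ : rank u / s ≤ rank v / s
      r≤ = /-monoˡ-≤ s (<⇒≤ (rank-< b))
      c≡ : col u ≡ col v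
      c≡ = ≤-antisym c≤ (+-cancelʳ-≤ (rank v / s) (col v) (col u) (≤-trans (≤-reflexive (sym e)) (+-monoʳ-≤ (col u) r≤)))

    track-determines : ∀ {u v} → track u ≡ track v → col u ≡ col v × rank u / s ≡ rank v / s
    track-determines {u} {v} e with before-cmp u v
    ... | inj₁ b = track-mono b e
    ... | inj₂ (inj₁ refl) = refl , refl
    ... | inj₂ (inj₂ b) = let x , y = track-mono b (sym e) in sym x , sym y

    n<ts : n < t * s
    n<ts = begin-strict
      n ≡⟨ m≡m%n+[m/n]*n n t ⟩
      n % t + n / t * t <⟨ +-monoˡ-< (n / t * t) (m%n<n n t) ⟩
      t + n / t * t ≡⟨ *-comm s t ⟩
      t * s ∎
      where open ≤-Reasoning

    track<2t : ∀ v → track v < 2 * t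
    track<2t v = ≤-trans (+-mono-<-≤ (col< v) (<⇒≤ (m<n*o⇒m/o<n {rank v} {t} {s} (<-trans (rank<n v) n<ts))))
      (≤-reflexive (cong (t +_) (sym (+-identityʳ t))))

    module _ {p} (pp : Prime p) (2t≤p : 2 * t ≤ p) where
      instance
        p≢0 : NonZero p
        p≢0 = prime⇒nonZero pp

      x y z : Fin n → ℕ
      x v = track v
      y v = (track v * track v) % p
      z v = p * (rank v % s) + (track v * track v * track v) % p

      pos-% : ∀ a → pos (a % p) ≡ pos a +ᶻ -ᶻ pos (a / p) *ᶻ pos p
      pos-% a = trans (move (pos (a % p)) (pos (a / p)) (pos p)) (cong (_+ᶻ -ᶻ pos (a / p) *ᶻ pos p)
        (trans (cong (pos (a % p) +ᶻ_) (sym (ℤP.pos-* (a / p) p))) (cong pos (sym (m≡m%n+[m/n]*n a p)))))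
        where
        move : ∀ r q p → r ≡ (r +ᶻ q *ᶻ p) +ᶻ -ᶻ q *ᶻ p
        move = ℤR.solve-∀

      offset-< : ∀ {u v} → track u ≡ track v → z u < z v → rank u % s < rank v % s
      offset-< {u} {v} e lt = *-cancelˡ-< p _ _ (+-cancelʳ-< ((track v * track v * track v) % p) _ _
        (subst (λ k → p * (rank u % s) + (k * k * k) % p < z v) e lt))

      offset-≡ : ∀ {u v} → track u ≡ track v → z u ≡ z v → rank u % s ≡ rank v % s
      offset-≡ {u} {v} e eq = *-cancelˡ-≡ _ _ p (+-cancelʳ-≡ ((track v * track v * track v) % p) _ _
        (subst (λ k → p * (rank u % s) + (k * k * k) % p ≡ z v) e eq))

      ord-< : ∀ {u v} → track u ≡ track v → z u < z v → ord u < ord v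
      ord-< {u} {v} e lt with before-cmp u v
      ... | inj₁ (inj₁ c) = ⊥-elim (<⇒≢ c (proj₁ (track-determines {u} {v} e)))
      ... | inj₁ (inj₂ (_ , o)) = o
      ... | inj₂ (inj₁ refl) = ⊥-elim (<-irrefl refl lt)
      ... | inj₂ (inj₂ b) = ⊥-elim (<⇒≱ (rank-< b) (<⇒≤ (begin-strict
        rank u ≡⟨ m≡m%n+[m/n]*n (rank u) s ⟩
        rank u % s + rank u / s * s <⟨ +-monoˡ-< (rank u / s * s) (offset-< {u} {v} e lt) ⟩
        rank v % s + rank u / s * s ≡⟨ cong (λ q → rank v % s + q * s) (proj₂ (track-determines {u} {v} e)) ⟩
        rank v % s + rank v / s * s ≡⟨ m≡m%n+[m/n]*n (rank v) s ⟨
        rank v ∎)))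
        where open ≤-Reasoning

      curve-points : CurvePoints G p
      curve-points = record
        { point = point
        ; Y-col = λ e → cong (λ k → pos ((k * k) % p)) (ℤP.+-injective e)
        ; separated = λ {u} {v} ne d → ne (cong pos (small-∣⇒≡ (x<p u) (x<p v) d))
        ; distinct = λ {u} {v} ex ez → distinct' u v (ℤP.+-injective ex) (ℤP.+-injective ez)
        ; proper = λ {u} {v} e ex → proper e (proj₁ (track-determines {u} {v} (ℤP.+-injective ex)))
        ; no-cross = λ v w a b e e' lt lt' → no-X (proj₁ (track-determines {v} {w} (ℤP.+-injective e))) (proj₁ (track-determines {a} {b} (ℤP.+-injective e')))
            (ord-< {v} {w} (ℤP.+-injective e) (ℤP.drop‿+<+ lt)) (ord-< {a} {b} (ℤP.+-injective e') (ℤP.drop‿+<+ lt'))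
        }
        where
        x<p : ∀ v → x v < p
        x<p v = <-≤-trans (track<2t v) 2t≤p
        point : Fin n → CurvePoint p
        point v = record { cx = pos (x v) ; cy = pos (y v) ; cz = pos (z v) ; cl = -ᶻ pos (k * k / p) ; cm = pos (rank v % s) -ᶻ pos (k³ / p)
          ; y≡ = trans (pos-% (k * k)) (cong (_+ᶻ -ᶻ pos (k * k / p) *ᶻ pos p) (ℤP.pos-* k k)) ; z≡ = begin
          pos (p * (rank v % s)) +ᶻ pos (k³ % p) ≡⟨ cong₂ _+ᶻ_ (ℤP.pos-* p (rank v % s)) (pos-% k³) ⟩
          pos p *ᶻ pos (rank v % s) +ᶻ (pos k³ +ᶻ -ᶻ pos (k³ / p) *ᶻ pos p) ≡⟨ move (pos p) (pos (rank v % s)) (pos k³) (pos (k³ / p)) ⟩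
          pos k³ +ᶻ (pos (rank v % s) -ᶻ pos (k³ / p)) *ᶻ pos p
            ≡⟨ cong (_+ᶻ (pos (rank v % s) -ᶻ pos (k³ / p)) *ᶻ pos p) (trans (ℤP.pos-* (k * k) k) (cong (_*ᶻ pos k) (ℤP.pos-* k k))) ⟩
          pos k *ᶻ pos k *ᶻ pos k +ᶻ (pos (rank v % s) -ᶻ pos (k³ / p)) *ᶻ pos p ∎ }
          where
          open ≡-Reasoning
          k = track v
          k³ = k * k * k
          move : ∀ p r c q → p *ᶻ r +ᶻ (c +ᶻ -ᶻ q *ᶻ p) ≡ c +ᶻ (r -ᶻ q) *ᶻ p
          move = ℤR.solve-∀
        distinct' : ∀ u v → track u ≡ track v → z u ≡ z v → u ≡ v
        distinct' u v e ez = rank-inj (begin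
          rank u ≡⟨ m≡m%n+[m/n]*n (rank u) s ⟩
          rank u % s + rank u / s * s ≡⟨ cong₂ (λ r q → r + q * s) (offset-≡ {u} {v} e ez) (proj₂ (track-determines {u} {v} e)) ⟩
          rank v % s + rank v / s * s ≡⟨ m≡m%n+[m/n]*n (rank v) s ⟨
          rank v ∎)
          where open ≡-Reasoning

      in-range : ∀ {N} (f : Fin n → ℕ) → (∀ v → f v < N) → InRange (pos ∘ f) N
      in-range {N} f f<N = pos 0 , λ v → ℤ.+≤+ z≤n , ℤP.≤-trans (ℤ.+≤+ (≤-trans (≤-reflexive (+-comm (f v) 1)) (f<N v))) (ℤP.≤-reflexive (sym (ℤP.+-identityˡ (pos N))))

      -- A block has n/t + 1 places of height p, which makes at most K (n + t) in total; t <= n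
      -- turns this into 2 K n.
      z-bound : ∀ K → p ≤ K * t → ∀ v → z v < (K + K) * n
      z-bound K p≤ v = begin-strict
        p * (rank v % s) + (track v * track v * track v) % p <⟨ +-monoʳ-< (p * (rank v % s)) (m%n<n (track v * track v * track v) p) ⟩
        p * (rank v % s) + p ≡⟨ trans (+-comm _ p) (sym (*-suc p (rank v % s))) ⟩
        p * suc (rank v % s) ≤⟨ *-mono-≤ p≤ (m%n<n (rank v) s) ⟩
        K * t * s ≡⟨ expand K t (n / t) ⟩
        K * (t + n / t * t) ≤⟨ *-monoʳ-≤ K (+-mono-≤ t≤n (m/n*n≤m n t)) ⟩
        K * (n + n) ≡⟨ double K n ⟩
        (K + K) * n ∎
        where
        open ≤-Reasoning
        expand : ∀ K t q → K * t * (1 + q) ≡ K * (t + q * t)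
        expand = ℕR.solve-∀
        double : ∀ K n → K * (n + n) ≡ (K + K) * n
        double = ℕR.solve-∀

  -- The prime is at most 64 (2t) = 128t. `K` remains a variable equal to 128 so that products with
  -- it do not unfold.
  short-tracks⇒drawing : ∀ K → K ≡ 128 → HasDrawing G ((K + K) * t) ((K + K) * t) ((K + K) * n)
  short-tracks⇒drawing K K≡ = draw (chebyshev (2 * t) (≤-trans 1≤t (m≤n*m t 2)))
    where
    draw : ∃[ p ] (Prime p × 2 * t ≤ p × p ≤ 64 * (2 * t)) → HasDrawing G ((K + K) * t) ((K + K) * t) ((K + K) * n)
    draw (p , pp , 2t≤p , p≤64·2t) = drawing pp (curve-points pp 2t≤p) ,
      in-range pp 2t≤p (x pp 2t≤p) (λ v → ≤-trans (track<2t v) (≤-trans 2t≤p p≤2Kt)) ,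
      in-range pp 2t≤p (y pp 2t≤p) (λ v → ≤-trans (m%n<n (track v * track v) p {{prime⇒nonZero pp}}) p≤2Kt) ,
      in-range pp 2t≤p (z pp 2t≤p) (z-bound pp 2t≤p K p≤Kt)
      where
      p≤Kt : p ≤ K * t
      p≤Kt = subst (λ K → p ≤ K * t) (sym K≡) (subst (p ≤_) (sym (*-assoc 64 2 t)) p≤64·2t)
      p≤2Kt : p ≤ (K + K) * t
      p≤2Kt = ≤-trans p≤Kt (*-monoˡ-≤ t (m≤m+n K K))

InRange-mono : ∀ {n} {f : Fin n → ℤ} {X X'} → X ≤ X' → InRange f X → InRange f X'
InRange-mono X≤X' (c , h) = c , λ v → proj₁ (h v) , ℤP.≤-trans (proj₂ (h v)) (ℤP.+-monoʳ-≤ c (ℤ.+≤+ X≤X'))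

HasDrawing-mono : ∀ {n} {G : Graph n} {X X' Y Y' Z Z'} → X ≤ X' → Y ≤ Y' → Z ≤ Z' → HasDrawing G X Y Z → HasDrawing G X' Y' Z'
HasDrawing-mono lx ly lz (D , ix , iy , iz) = D , InRange-mono lx ix , InRange-mono ly iy , InRange-mono lz iz

tracks⇒drawing : ∃[ C ] (∀ {n} {G : Graph n} {t} → 1 ≤ n → 1 ≤ t → TrackLayout G t → HasDrawing G (C * t) (C * t) (C * n))
tracks⇒drawing = 128 + 128 , λ {n} {G} {t} → go 128 refl {n} {G} {t}
  where
  go : ∀ K → K ≡ 128 → ∀ {n} {G : Graph n} {t} → 1 ≤ n → 1 ≤ t → TrackLayout G t → HasDrawing G ((K + K) * t) ((K + K) * t) ((K + K) * n)
  go K K≡ {n} {G} {t} 1≤n 1≤t L with t ≤? n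
  ... | yes t≤n = short-tracks⇒drawing L 1≤t t≤n K K≡
  -- With more tracks than vertices, one track per vertex is cheaper and restores t <= n.
  ... | no t≰n  = HasDrawing-mono (*-monoʳ-≤ (K + K) (<⇒≤ (≰⇒> t≰n))) (*-monoʳ-≤ (K + K) (<⇒≤ (≰⇒> t≰n))) ≤-refl
    (short-tracks⇒drawing (singleton-tracks G) 1≤n ≤-refl K K≡)

-- Elimination orders from tree decompositions

argmin : ∀ {n} (f : Fin n → ℕ) (p : Fin n → Bool) {x} → p x ≡ true → ∃[ y ] (p y ≡ true × (∀ z → p z ≡ true → f y ≤ f z))
argmin f p {x} = go x (<-wellFounded (f x))
  where
  go : ∀ x → Acc _<_ (f x) → p x ≡ true → ∃[ y ] (p y ≡ true × (∀ z → p z ≡ true → f y ≤ f z))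
  go x (acc rs) px with FinP.any? (λ z → (p z BoolP.≟ true) ×-dec (f z <? f x))
  ... | yes (z , pz , lt) = go z (rs lt) pz
  ... | no none           = x , px , λ z pz → ≮⇒≥ λ lt → none (z , pz , lt)

bounded : ∀ {n} (f : Fin n → ℕ) → ∃[ M ] (∀ v → f v < M)
bounded {zero}  f = 0 , λ ()
bounded {suc n} f with bounded (f ∘ suc)
... | M , h = suc (f zero) ⊔ M , λ where
  zero    → m≤m⊔n (suc (f zero)) M
  (suc v) → <-≤-trans (h v) (m≤n⊔m (suc (f zero)) M)

-- Functions defined by recursion along a rank, without unfolding a well-founded recursion.
ranked-choice : ∀ {n} {A : Set} (rank : Fin n → ℕ) (P : Fin n → (Fin n → A) → A → Set) →
  A → (∀ v f → ∃[ a ] P v f a) →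
  (∀ v f g a → (∀ u → rank u < rank v → f u ≡ g u) → P v f a → P v g a) →
  ∃[ f ] (∀ v → P v f (f v))
ranked-choice {n} {A} rank P a₀ choose local with bounded rank
... | M , rank<M = proj₁ (approx M) , λ v → proj₂ (approx M) v (rank<M v)
  where
  approx : ∀ m → ∃[ f ] (∀ v → rank v < m → P v f (f v))
  approx zero = (λ _ → a₀) , λ _ ()
  approx (suc m) with approx m
  ... | f , Pf = g , Pg
    where
    ext : ∀ v → Dec (rank v < m) → A
    ext v (yes _) = f v
    ext v (no _)  = proj₁ (choose v f)
    g : Fin n → A
    g v = ext v (rank v <? m)
    ext-old : ∀ v d → rank v < m → f v ≡ ext v d
    ext-old v (yes _) _  = refl
    ext-old v (no ¬l) lt = ⊥-elim (¬l lt)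
    P-ext : ∀ v d → P v f (ext v d)
    P-ext v (yes l) = Pf v l
    P-ext v (no _)  = proj₂ (choose v f)
    Pg : ∀ v → rank v < suc m → P v g (g v)
    Pg v (s≤s rv≤m) = local v f g (g v) (λ u lt → ext-old u (rank u <? m) (<-≤-trans lt rv≤m)) (P-ext v (rank v <? m))

data Desc {m} (T : Tree m) (r : Fin (suc m)) : Fin (suc m) → Set where
  self  : Desc T r r
  child : ∀ {i} → Desc T r (par T i) → Desc T r (suc i)

Desc-≥ : ∀ {m} {T : Tree m} {r x} → Desc T r x → toℕ r ≤ toℕ x
Desc-≥ self = ≤-refl
Desc-≥ {T = T} (child {i} d) = ≤-trans (Desc-≥ d) (m≤n⇒m≤1+n (par-le T i))

walk-start : ∀ {X : Set} {A : X → X → Set} {S a b} → WalkIn A S a b → S a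
walk-start (here s)     = s
walk-start (step s _ _) = s

-- The subtree at `suc i` is joined to the rest only by the edge to its parent, so a walk leaving it
-- visits that parent.
walk-exit : ∀ {m} {T : Tree m} {S i a b} → WalkIn (TAdj T) S a b → Desc T (suc i) a → ¬ Desc T (suc i) b → S (par T i)
walk-exit (here _) d ¬d = ⊥-elim (¬d d)
walk-exit (step _ (j , inj₁ (refl , refl)) w) self ¬d = walk-start w
walk-exit (step _ (j , inj₁ (refl , refl)) w) (child d) ¬d = walk-exit w d ¬d
walk-exit (step _ (j , inj₂ (refl , refl)) w) d ¬d = walk-exit w (child d) ¬d

-- Indices grow away from the root, so a node with smaller index lies outside the subtree at
-- `suc i`.
connected-par : ∀ {m} {T : Tree m} {S} → ConnectedIn T S → ∀ {i y} → S (suc i) → S y → toℕ y ≤ toℕ i → S (par T i)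
connected-par {T = T} {S = S} conn {i} {y} s s' y≤i = walk-exit {T = T} {S = S} (conn (suc i) y s s') self λ d → <⇒≱ (Desc-≥ d) y≤i

module Tops {n m} {G : Graph n} {T : Tree m} (D : TreeDecomposition G m T) where

  inBag : Fin (suc m) → Fin n → Bool
  inBag x v = Vec.lookup (bag D x) v

  ∈⇒inBag : ∀ {x v} → v Subset.∈ bag D x → inBag x v ≡ true
  ∈⇒inBag = VecP.[]=⇒lookup

  inBag⇒∈ : ∀ {x v} → inBag x v ≡ true → v Subset.∈ bag D x
  inBag⇒∈ {x} {v} e = VecP.lookup⇒[]= v (bag D x) e

  private
    topmost : ∀ v → ∃[ x ] (inBag x v ≡ true × (∀ z → inBag z v ≡ true → toℕ x ≤ toℕ z))
    topmost v = argmin toℕ (λ x → inBag x v) (∈⇒inBag (proj₂ (cover D v)))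

  top : Fin n → Fin (suc m)
  top v = proj₁ (topmost v)

  top-in : ∀ v → inBag (top v) v ≡ true
  top-in v = proj₁ (proj₂ (topmost v))

  top-least : ∀ {v z} → inBag z v ≡ true → toℕ (top v) ≤ toℕ z
  top-least {v} {z} = proj₂ (proj₂ (topmost v)) z

  -- Lexicographic: topmost bag first, vertex number as tie-break, for which the factor `n` leaves
  -- room.
  time : Fin n → ℕ
  time v = toℕ (top v) * n + toℕ v

  time⇒top : ∀ {u v} → time u ≤ time v → toℕ (top u) ≤ toℕ (top v)
  time⇒top {u} {v} le = ≮⇒≥ λ lt → <⇒≱ (begin-strict
    toℕ (top v) * n + toℕ v <⟨ +-monoʳ-< (toℕ (top v) * n) (FinP.toℕ<n v) ⟩
    toℕ (top v) * n + n ≡⟨ +-comm _ n ⟩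
    suc (toℕ (top v)) * n ≤⟨ *-monoˡ-≤ n lt ⟩
    toℕ (top u) * n ≤⟨ m≤m+n _ (toℕ u) ⟩
    time u ∎) le
    where open ≤-Reasoning

  time-inj : ∀ {u v} → time u ≡ time v → u ≡ v
  time-inj {u} {v} e = FinP.toℕ-injective (+-cancelˡ-≡ (toℕ (top v) * n) _ _
    (trans (cong (λ x → x * n + toℕ u) (sym (≤-antisym (time⇒top {u} {v} (≤-reflexive e)) (time⇒top {v} {u} (≤-reflexive (sym e)))))) e))

  -- a connected set of nodes contains the path from any of its nodes up to its topmost node
  up : ∀ {u v} x → inBag x u ≡ true → inBag x v ≡ true → toℕ (top u) ≤ toℕ (top v) → inBag (top v) u ≡ true
  up {u} {v} x = go x (<-wellFounded (toℕ x))
    where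
    go : ∀ x → Acc _<_ (toℕ x) → inBag x u ≡ true → inBag x v ≡ true → toℕ (top u) ≤ toℕ (top v) → inBag (top v) u ≡ true
    go x (acc rs) xu xv le with m≤n⇒m<n∨m≡n (top-least xv)
    ... | inj₂ e = subst (λ y → inBag y u ≡ true) (sym (FinP.toℕ-injective e)) xu
    go (suc i) (acc rs) xu xv le | inj₁ (s≤s lt) = go (par T i) (rs (s≤s (par-le T i)))
      (∈⇒inBag (connected-par {T = T} {S = λ x → u Subset.∈ bag D x} (connected D u) (inBag⇒∈ xu) (inBag⇒∈ (top-in u)) (≤-trans le lt)))
      (∈⇒inBag (connected-par {T = T} {S = λ x → v Subset.∈ bag D x} (connected D v) (inBag⇒∈ xv) (inBag⇒∈ (top-in v)) lt)) le

  rest≤ : ∀ {k} → TDWidth≤ D k → ∀ v → count (inBag (top v) ∖ v) ≤ k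
  rest≤ {k} width v = ≤-pred (begin
    suc (count (inBag (top v) ∖ v)) ≤⟨ count-∖< (inBag (top v)) (top-in v) ⟩
    count (inBag (top v)) ≡⟨ count-Subset (bag D (top v)) ⟨
    Subset.∣ bag D (top v) ∣ ≤⟨ width (top v) ⟩
    suc k ∎)
    where open ≤-Reasoning

-- A perfect elimination order of a chordal supergraph: back v is the clique of earlier neighbours of v.
record Elimination {n} (G : Graph n) (k : ℕ) : Set where
  field
    time       : Fin n → ℕ
    time-inj   : ∀ {u v} → time u ≡ time v → u ≡ v
    back       : Fin n → Fin n → Bool
    back-<     : ∀ {v u} → back v u ≡ true → time u < time v
    back-count : ∀ v → count (back v) ≤ k
    clique     : ∀ {v u w} → back v u ≡ true → back v w ≡ true → time u < time w → back w u ≡ true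
    edge       : ∀ {u v} → Edge G u v → time u < time v → back v u ≡ true

-- `back v` consists of the earlier vertices in the topmost bag of v. Both `clique` and `edge` are
-- instances of `up`: of two vertices sharing a bag, the earlier one lies in the topmost bag of the
-- later one.
elimination : ∀ {n} {G : Graph n} {k} → HasTD G k → Elimination G k
elimination {n} {G} {k} (m , T , D , width) = record
  { time = time ; time-inj = time-inj ; back = back
  ; back-< = λ {v} {u} b → back-< {v} {u} b
  ; back-count = λ v → ≤-trans
      (count-mono λ u b → ∖-true (inBag (top v)) (back-in {v} {u} b) λ { refl → <-irrefl refl (back-< {v} {u} b) }) (rest≤ width v)
  ; clique = λ {v} {u} {w} bu bw lt → mk-back lt (up (top v) (back-in {v} {u} bu) (back-in {v} {w} bw) (time⇒top {u} {w} (<⇒≤ lt)))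
  ; edge = λ {u} {v} e lt → let x , xu , xv = edge-in D u v e in
      mk-back lt (up x (∈⇒inBag xu) (∈⇒inBag xv) (time⇒top {u} {v} (<⇒≤ lt)))
  }
  where
  open Tops D
  back : Fin n → Fin n → Bool
  back v u = does (time u <? time v) ∧ inBag (top v) u
  back-< : ∀ {v u} → back v u ≡ true → time u < time v
  back-< {v} {u} b = does⇒ (time u <? time v) (∧-left b)
  back-in : ∀ {v u} → back v u ≡ true → inBag (top v) u ≡ true
  back-in {v} {u} b = ∧-right {does (time u <? time v)} b
  mk-back : ∀ {u v} → time u < time v → inBag (top v) u ≡ true → back v u ≡ true
  mk-back {u} {v} lt e = trans (cong (_∧ inBag (top v) u) (dec-true (time u <? time v) lt)) e

-- Vertex separation orders

record VertexSeparation {n} (G : Graph n) (K : ℕ) : Set where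
  field
    ord       : Fin n → ℕ
    ord-inj   : ∀ {u v} → ord u ≡ ord v → u ≡ v
    act       : Fin n → Fin n → Bool
    act-count : ∀ x → count (act x) ≤ K
    active    : ∀ {u x z} → ord u < ord x → ord x ≤ ord z → Edge G u z → act x u ≡ true

-- The bags containing u form an interval. An edge uz has a bag at or after the first bag of x, and
-- u starts no later than x, so the interval covers the first bag of x.
pathwidth⇒separation : ∀ {n} {G : Graph n} {k} → HasPD G k → VertexSeparation G k
pathwidth⇒separation {n} {G} {k} (m , D , width) = record
  { ord = time ; ord-inj = time-inj ; act = λ x → inBag (top x) ∖ x
  ; act-count = rest≤ width
  ; active = λ {u} {x} {z} u<x x≤z e → let y , yu , yz = edge-in D u z e in
      ∖-true (inBag (top x)) (down u (top x) (time⇒top {u} {x} (<⇒≤ u<x)) y (≤-trans (time⇒top {x} {z} x≤z) (top-least (∈⇒inBag yz))) (∈⇒inBag yu)) λ { refl → <-irrefl refl u<x }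
  }
  where
  open Tops D
  down : ∀ u r → toℕ (top u) ≤ toℕ r → ∀ y → toℕ r ≤ toℕ y → inBag y u ≡ true → inBag r u ≡ true
  down u r top≤r y = go y (<-wellFounded (toℕ y))
    where
    go : ∀ y → Acc _<_ (toℕ y) → toℕ r ≤ toℕ y → inBag y u ≡ true → inBag r u ≡ true
    go y (acc rs) r≤y yu with m≤n⇒m<n∨m≡n r≤y
    ... | inj₂ e = subst (λ y → inBag y u ≡ true) (sym (FinP.toℕ-injective e)) yu
    go (suc i) (acc rs) r≤y yu | inj₁ (s≤s lt) = go (par (pathTree m) i) (rs (s≤s (≤-reflexive (FinP.toℕ-inject₁ i))))
      (≤-trans lt (≤-reflexive (sym (FinP.toℕ-inject₁ i))))
      (∈⇒inBag (connected-par {T = pathTree m} {S = λ x → u Subset.∈ bag D x} (connected D u) (inBag⇒∈ yu) (inBag⇒∈ (top-in u)) (≤-trans top≤r lt)))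

-- The conclusion is restricted to earlier u, so that the condition on a colour depends only on
-- colours already fixed, as `ranked-choice` demands.
greedy : ∀ {n K} (rank : Fin n → ℕ) (avoid : Fin n → Fin n → Bool) → (∀ x → count (avoid x) ≤ K) →
  ∃[ col ] (∀ x u → avoid x u ≡ true → rank u < rank x → col u ≢ (Fin (suc K) ∋ col x))
greedy {n} {K} rank avoid avoid≤K = ranked-choice rank
  (λ x col c → ∀ u → avoid x u ≡ true → rank u < rank x → col u ≢ c) zero
  (λ x col → let c , h = missing-colour (avoid x) col (avoid≤K x) in c , λ u a _ → h u a)
  (λ x col col' c agree h u a lt e → h u a lt (trans (agree u lt) e))

-- In a crossing, v before w on one track forces y before w, while x before y on the other forces w
-- before y.
separation⇒tracks : ∀ {n} {G : Graph n} {K} → VertexSeparation G K → TrackLayout G (suc K)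
separation⇒tracks {n} {G} {K} S with greedy (VertexSeparation.ord S) (VertexSeparation.act S) (VertexSeparation.act-count S)
... | col , avoids = record
  { col = toℕ ∘ col ; ord = ord ; col< = FinP.toℕ<n ∘ col ; ord-inj = λ _ → ord-inj
  ; proper = λ {u} {v} e c → proper' e (FinP.toℕ-injective c)
  ; no-X = λ {v} {w} {x} {y} cvw cxy v<w x<y Evy Ewx →
      <-asym (later {v} {w} {y} (FinP.toℕ-injective cvw) v<w Evy) (later {x} {y} {w} (FinP.toℕ-injective cxy) x<y (Edge-symmetric G Ewx))
  }
  where
  open VertexSeparation S
  -- a vertex stays active until its last neighbour, so its colour is not reused before
  later : ∀ {v w y} → col v ≡ col w → ord v < ord w → Edge G v y → ord y < ord w
  later {v} {w} {y} c v<w e = ≰⇒> λ w≤y → avoids w v (active v<w w≤y e) v<w c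
  proper' : ∀ {u v} → Edge G u v → col u ≢ col v
  proper' {u} {v} e c with <-cmp (ord u) (ord v)
  ... | tri< lt _ _ = <-irrefl refl (later c lt e)
  ... | tri> _ _ gt = <-irrefl refl (later (sym c) gt (Edge-symmetric G e))
  ... | tri≈ _ eq _ with ord-inj eq
  ...   | refl = true≢false (trans (sym e) (adj-irr G u))

-- Splitting a chordal graph at its earliest vertex

module Splitting {n} {G : Graph n} {k} (E : Elimination G k) where
  open Elimination E

  Adj : Fin n → Fin n → Set
  Adj u v = back u v ≡ true ⊎ back v u ≡ true

  Edge⇒Adj : ∀ {u v} → Edge G u v → Adj u v
  Edge⇒Adj {u} {v} e with <-cmp (time u) (time v)
  ... | tri< lt _ _ = inj₂ (edge e lt)
  ... | tri> _ _ gt = inj₁ (edge (Edge-symmetric G e) gt)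
  ... | tri≈ _ eq _ with time-inj eq
  ...   | refl = ⊥-elim (true≢false (trans (sym e) (adj-irr G u)))

  -- Reachability of v along earlier neighbours. In the chordal supergraph this is the component of
  -- v among the vertices not earlier than v.
  data Below (v : Fin n) : Fin n → Set where
    root : Below v v
    step : ∀ {x b} → back x b ≡ true → Below v b → Below v x

  Below-≥ : ∀ {v x} → Below v x → time v ≤ time x
  Below-≥ root       = ≤-refl
  Below-≥ (step b d) = ≤-trans (Below-≥ d) (<⇒≤ (back-< b))

  below? : ∀ v x → Dec (Below v x)
  below? v x = go x (<-wellFounded (time x))
    where
    go : ∀ x → Acc _<_ (time x) → Dec (Below v x)
    go x (acc rs) with x Fin.≟ v
    ... | yes refl = yes root
    ... | no x≢v with FinP.any? (λ b → decide b)
      where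
      decide : ∀ b → Dec (Σ (back x b ≡ true) λ _ → Below v b)
      decide b with back x b BoolP.≟ true
      ... | no ¬e = no (¬e ∘ proj₁)
      ... | yes e = map′ (e ,_) proj₂ (go b (rs (back-< e)))
    ...   | yes (b , e , d) = yes (step e d)
    ...   | no none = no λ { root → x≢v refl ; (step e d) → none (_ , e , d) }

  -- The neighbour x and the next link b of the chain are both earlier neighbours of u, hence
  -- adjacent. So x is either attached above b or pushed further down the chain.
  back-of-below : ∀ {v u x} → Below v u → back u x ≡ true → Below v x ⊎ back v x ≡ true
  back-of-below root e = inj₂ e
  back-of-below {x = x} (step {b = b} ub d) e with <-cmp (time x) (time b)
  ... | tri< lt _ _ = back-of-below d (clique e ub lt)
  ... | tri> _ _ gt = inj₁ (step (clique ub e gt) d)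
  ... | tri≈ _ eq _ with time-inj eq
  ...   | refl = inj₁ d

  -- D is a union of components of the graph minus the earlier bag Z
  record Region (D Z : Fin n → Bool) : Set where
    field
      Z-count : count Z ≤ suc k
      Z-<-D   : ∀ {z d} → Z z ≡ true → D d ≡ true → time z < time d
      closed  : ∀ {x u} → D x ≡ true → Adj x u → D u ≡ true ⊎ Z u ≡ true

    disjoint : ∀ {u} → Z u ≡ true → D u ≢ true
    disjoint z d = <-irrefl refl (Z-<-D z d)

  -- Taking out the first vertex v of a region leaves the rest of its component, attached to the bag
  -- of v, and the other components, still attached to `Z`.
  record Split (D Z : Fin n → Bool) : Set where
    field
      v         : Fin n
      D₀ D₁ Z₁  : Fin n → Bool
      v∈D       : D v ≡ true
      region₀   : Region D₀ Z
      region₁   : Region D₁ Z₁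
      parts     : ∀ x → D x ≡ true → x ≡ v ⊎ D₀ x ≡ true ⊎ D₁ x ≡ true
      D₀⊆D      : ∀ x → D₀ x ≡ true → D x ≡ true
      D₁⊆D      : ∀ x → D₁ x ≡ true → D x ≡ true
      v∉D₀      : D₀ v ≢ true
      v∉D₁      : D₁ v ≢ true
      D₀∩D₁     : ∀ x → D₀ x ≡ true → D₁ x ≢ true

    sizes : 1 + count D₀ + count D₁ ≤ count D
    sizes = begin
      1 + count D₀ + count D₁ ≤⟨ s≤s (≤-trans (count-+ D₀ D₁ (D ∖ v) (λ _ → false) bits) (≤-reflexive (trans (cong (count (D ∖ v) +_) (count-false {n})) (+-identityʳ _)))) ⟩
      suc (count (D ∖ v)) ≤⟨ count-∖< D v∈D ⟩
      count D ∎
      where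
      open ≤-Reasoning
      bits : ∀ x → bit (D₀ x) + bit (D₁ x) ≤ bit ((D ∖ v) x) + 0
      bits x with D₀ x in e₀ | D₁ x in e₁
      ... | false | false = z≤n
      ... | true  | false = ≤-reflexive (cong (λ b → bit b + 0) (sym (∖-true D (D₀⊆D x e₀) λ { refl → v∉D₀ e₀ })))
      ... | false | true  = ≤-reflexive (cong (λ b → bit b + 0) (sym (∖-true D (D₁⊆D x e₁) λ { refl → v∉D₁ e₁ })))
      ... | true  | true  = ⊥-elim (D₀∩D₁ x e₀ e₁)

  split : ∀ {D Z x} → Region D Z → D x ≡ true → Split D Z
  split {D} {Z} {x} R Dx = record
    { v = v ; D₀ = D₀ ; D₁ = D₁ ; Z₁ = Z₁ ; v∈D = Dv
    ; region₀ = record { Z-count = Z-count ; Z-<-D = λ z d → Z-<-D z (∧-left d) ; closed = closed₀ }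
    ; region₁ = record { Z-count = Z₁-count ; Z-<-D = λ {z} {d} → Z₁-<-D₁ {z} {d} ; closed = closed₁ }
    ; parts = parts
    ; D₀⊆D = λ x e → ∧-left e ; D₁⊆D = λ x e → proj₁ (∧-true (proj₁ (∖-true⁻ (λ x → D x ∧ does (below? v x)) e)))
    ; v∉D₀ = λ e → proj₂ (D₀⁻ e) root ; v∉D₁ = λ e → proj₂ (proj₂ (D₁⁻ e)) refl
    ; D₀∩D₁ = λ x e₀ e₁ → proj₂ (D₀⁻ e₀) (proj₁ (proj₂ (D₁⁻ e₁)))
    }
    where
    open Region R
    first : ∃[ v ] (D v ≡ true × (∀ z → D z ≡ true → time v ≤ time z))
    first = argmin time D Dx
    v = proj₁ first
    Dv = proj₁ (proj₂ first)
    v≤ = proj₂ (proj₂ first)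
    D₀ D₁ Z₁ : Fin n → Bool
    D₀ x = D x ∧ not (does (below? v x))
    D₁ = (λ x → D x ∧ does (below? v x)) ∖ v
    Z₁ x = does (x Fin.≟ v) ∨ back v x
    D₀⁺ : ∀ {x} → D x ≡ true → ¬ Below v x → D₀ x ≡ true
    D₀⁺ {x} d ¬b rewrite d | dec-false (below? v x) ¬b = refl
    D₀⁻ : ∀ {x} → D₀ x ≡ true → D x ≡ true × ¬ Below v x
    D₀⁻ {x} e = ∧-left e , λ b → not-true (∧-right {D x} e) (dec-true (below? v x) b)
    D₁⁺ : ∀ {x} → D x ≡ true → Below v x → x ≢ v → D₁ x ≡ true
    D₁⁺ {x} d b ne = ∖-true (λ x → D x ∧ does (below? v x)) (trans (cong (_∧ does (below? v x)) d) (dec-true (below? v x) b)) ne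
    D₁⁻ : ∀ {x} → D₁ x ≡ true → D x ≡ true × Below v x × x ≢ v
    D₁⁻ {x} e with ∖-true⁻ (λ x → D x ∧ does (below? v x)) {v} {x} e
    ... | e' , ne = ∧-left e' , does⇒ (below? v x) (∧-right {D x} e') , ne
    Z₁-count : count Z₁ ≤ suc k
    Z₁-count = ≤-trans (count-∨ (λ x → does (x Fin.≟ v)) (back v)) (+-mono-≤ (≤-reflexive (count-singleton v)) (back-count v))
    Z₁⁻ : ∀ {z} → Z₁ z ≡ true → time z ≤ time v
    Z₁⁻ {z} e with ∨-true {does (z Fin.≟ v)} e
    ... | inj₁ z≡v = ≤-reflexive (cong time (does⇒ (z Fin.≟ v) z≡v))
    ... | inj₂ b   = <⇒≤ (back-< b)
    Z₁-<-D₁ : ∀ {z d} → Z₁ z ≡ true → D₁ d ≡ true → time z < time d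
    Z₁-<-D₁ {z} {d} zz dd with D₁⁻ dd
    ... | _ , b , ne = ≤-<-trans (Z₁⁻ zz) (≤∧≢⇒< (Below-≥ b) λ e → ne (sym (time-inj e)))
    back-v⇒Z₁ : ∀ {u} → back v u ≡ true → Z₁ u ≡ true
    back-v⇒Z₁ {u} b rewrite b = BoolP.∨-zeroʳ _
    closed₀ : ∀ {x u} → D₀ x ≡ true → Adj x u → D₀ u ≡ true ⊎ Z u ≡ true
    closed₀ {x} {u} e a = go (D₀⁻ e) (closed (proj₁ (D₀⁻ e)) a) (below? v u) a
      where
      go : D x ≡ true × ¬ Below v x → D u ≡ true ⊎ Z u ≡ true → Dec (Below v u) → Adj x u → D₀ u ≡ true ⊎ Z u ≡ true
      go _ (inj₂ Zu) _ _ = inj₂ Zu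
      go _ (inj₁ Du) (no ¬bu) _ = inj₁ (D₀⁺ Du ¬bu)
      go (Dx , ¬bx) (inj₁ Du) (yes bu) (inj₁ xu) = ⊥-elim (¬bx (step xu bu))
      -- An earlier neighbour x of u that is not below v would lie in `back v` and so precede v, the
      -- first vertex of `D`.
      go (Dx , ¬bx) (inj₁ Du) (yes bu) (inj₂ ux) = ⊥-elim ([ ¬bx , (λ vx → <⇒≱ (back-< vx) (v≤ x Dx)) ]′ (back-of-below bu ux))
    closed₁ : ∀ {x u} → D₁ x ≡ true → Adj x u → D₁ u ≡ true ⊎ Z₁ u ≡ true
    closed₁ {x} {u} e (inj₁ xu) = go (D₁⁻ e) (u Fin.≟ v) (closed (proj₁ (D₁⁻ e)) (inj₁ xu))
      where
      go : D x ≡ true × Below v x × x ≢ v → Dec (u ≡ v) → D u ≡ true ⊎ Z u ≡ true → D₁ u ≡ true ⊎ Z₁ u ≡ true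
      go (Dx , bx , x≢v) d c with back-of-below bx xu
      ... | inj₂ vu = inj₂ (back-v⇒Z₁ vu)
      go (Dx , bx , x≢v) (yes u≡v) c | inj₁ bu = inj₂ (cong (_∨ back v u) (dec-true (u Fin.≟ v) u≡v))
      go (Dx , bx , x≢v) (no u≢v) (inj₁ Du) | inj₁ bu = inj₁ (D₁⁺ Du bu u≢v)
      go (Dx , bx , x≢v) (no u≢v) (inj₂ Zu) | inj₁ bu = ⊥-elim (<⇒≱ (Z-<-D Zu Dv) (Below-≥ bu))
    closed₁ {x} {u} e (inj₂ ux) with D₁⁻ e
    ... | Dx , bx , x≢v with closed Dx (inj₂ ux)
    ...   | inj₁ Du = inj₁ (D₁⁺ Du (step ux bx) λ { refl → <⇒≱ (back-< ux) (Below-≥ bx) })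
    ...   | inj₂ Zu = ⊥-elim (<-asym (Z-<-D Zu Dx) (back-< ux))
    parts : ∀ x → D x ≡ true → x ≡ v ⊎ D₀ x ≡ true ⊎ D₁ x ≡ true
    parts x Dx = go (x Fin.≟ v) (below? v x)
      where
      go : Dec (x ≡ v) → Dec (Below v x) → x ≡ v ⊎ D₀ x ≡ true ⊎ D₁ x ≡ true
      go (yes e) _       = inj₁ e
      go (no _)  (no ¬b) = inj₂ (inj₁ (D₀⁺ Dx ¬b))
      go (no ne) (yes b) = inj₂ (inj₂ (D₁⁺ Dx b ne))

  whole : Region (λ _ → true) (λ _ → false)
  whole = record { Z-count = ≤-trans (≤-reflexive (count-false {n})) z≤n ; Z-<-D = λ () ; closed = λ _ _ → inj₁ refl }

  -- `D` holds at least a third of `S` and, up to one vertex, at most two thirds; its complement is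
  -- then balanced too.
  record Separator (S : Fin n → Bool) : Set where
    field
      D Z    : Fin n → Bool
      region : Region D Z
      lower  : count S ≤ 3 * count (λ x → S x ∧ D x)
      upper  : 3 * count (λ x → S x ∧ D x) ≤ 3 + 2 * count S

  -- While `D` holds too much of `S`, descend into a part with at least a third. If both parts have
  -- less, then together with the removed vertex they hold at most the allowed two thirds plus one,
  -- a contradiction.
  separator : ∀ S → Separator S
  separator S = go whole (<-wellFounded _) (≤-trans (m≤n*m (count S) 3) (*-monoʳ-≤ 3 (count-mono {p = S} {q = λ x → S x ∧ true} λ i e → cong (_∧ true) e)))
    where
    σ = count S
    w : (Fin n → Bool) → ℕ
    w D = count (λ x → S x ∧ D x)
    go : ∀ {D Z} → Region D Z → Acc _<_ (count D) → σ ≤ 3 * w D → Separator S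
    go {D} {Z} R (acc rs) lo with 3 * w D ≤? 3 + 2 * σ
    ... | yes hi = record { D = D ; Z = Z ; region = R ; lower = lo ; upper = hi }
    ... | no ¬hi with count-∃ (λ x → S x ∧ D x) (n≢0⇒n>0 λ e → ¬hi (≤-trans (≤-reflexive (cong (3 *_) e)) z≤n))
    ...   | x , SDx with split R (∧-right {S x} SDx)
    ...     | P with σ ≤? 3 * w (Split.D₀ P) | σ ≤? 3 * w (Split.D₁ P)
    ...       | yes lo₀ | _ = go (Split.region₀ P) (rs (≤-trans (s≤s (m≤m+n _ (count (Split.D₁ P)))) (Split.sizes P))) lo₀
    ...       | no _ | yes lo₁ = go (Split.region₁ P) (rs (≤-trans (s≤s (m≤n+m _ (count (Split.D₀ P)))) (Split.sizes P))) lo₁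
    ...       | no ¬lo₀ | no ¬lo₁ = ⊥-elim (¬hi (linear 2 (+-mono-≤ (*-monoʳ-≤ 3 total) (+-mono-≤ (≰⇒> ¬lo₀) (≰⇒> ¬lo₁))) (slack (w D) (w D₀) (w D₁) σ)))
      where
      open Split P
      total : w D ≤ 1 + (w D₀ + w D₁)
      total = begin
        w D ≤⟨ count-mono covered ⟩
        count (λ x → does (x Fin.≟ v) ∨ ((S x ∧ D₀ x) ∨ (S x ∧ D₁ x))) ≤⟨ count-∨ (λ x → does (x Fin.≟ v)) _ ⟩
        count (λ x → does (x Fin.≟ v)) + count (λ x → (S x ∧ D₀ x) ∨ (S x ∧ D₁ x))
          ≤⟨ +-mono-≤ (≤-reflexive (count-singleton v)) (count-∨ (λ x → S x ∧ D₀ x) (λ x → S x ∧ D₁ x)) ⟩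
        1 + (w D₀ + w D₁) ∎
        where
        open ≤-Reasoning
        covered : ∀ x → S x ∧ D x ≡ true → does (x Fin.≟ v) ∨ ((S x ∧ D₀ x) ∨ (S x ∧ D₁ x)) ≡ true
        covered x e with ∧-true {S x} e
        ... | Sx , Dx rewrite Sx with parts x Dx
        ...   | inj₁ x≡v rewrite dec-true (x Fin.≟ v) x≡v = refl
        ...   | inj₂ (inj₁ d₀) rewrite d₀ = BoolP.∨-zeroʳ _
        ...   | inj₂ (inj₂ d₁) rewrite d₁ | BoolP.∨-zeroʳ (D₀ x) = BoolP.∨-zeroʳ _
      slack : ∀ a b c σ → 3 * a + (3 * (1 + (b + c)) + (σ + σ)) + 2 ≡ 3 + 2 * σ + (3 * a + ((1 + 3 * b) + (1 + 3 * c)))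
      slack = ℕR.solve-∀

  -- An ordering of D in which few vertices of D and Z stay active; act x over-approximates the set of
  -- active vertices just before x.
  record Layout (D Z : Fin n → Bool) (a : ℕ) : Set where
    field
      ord    : Fin n → ℕ
      inj    : ∀ {x y} → D x ≡ true → D y ≡ true → ord x ≡ ord y → x ≡ y
      act    : Fin n → Fin n → Bool
      few    : ∀ {x} → D x ≡ true → count (act x) ≤ a
      active : ∀ {u x z} → D x ≡ true → D z ≡ true → ord x ≤ ord z → Adj z u →
               Z u ≡ true ⊎ (D u ≡ true × ord u < ord x) → act x u ≡ true

  -- The order is v, then the small part, then the large part. During the small part the bag `Zₗ`
  -- may wait for the large part, at a cost of `suc k`. Afterwards no vertex of the small part is
  -- active, as the large part sees only itself and `Zₗ`.
  module _ {D Z Dₛ Zₛ Dₗ Zₗ : Fin n → Bool} {a : ℕ} (v : Fin n)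
    (R : Region D Z) (Rₛ : Region Dₛ Zₛ) (Rₗ : Region Dₗ Zₗ)
    (Lₛ : Layout Dₛ Zₛ a) (Lₗ : Layout Dₗ Zₗ (a + suc k))
    (parts : ∀ x → D x ≡ true → x ≡ v ⊎ Dₛ x ≡ true ⊎ Dₗ x ≡ true)
    (Dₛ⊆D : ∀ x → Dₛ x ≡ true → D x ≡ true) (Dₗ⊆D : ∀ x → Dₗ x ≡ true → D x ≡ true)
    (v∉Dₛ : Dₛ v ≢ true) (v∉Dₗ : Dₗ v ≢ true) (apart : ∀ x → Dₛ x ≡ true → Dₗ x ≢ true) where

    private
      module S = Layout Lₛ
      module L = Layout Lₗ

      M = proj₁ (bounded S.ord)

      data Place (x : Fin n) : Set where
        first : x ≡ v → Place x
        small : Dₛ x ≡ true → Place x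
        large : Dₗ x ≡ true → Place x
        none  : Place x

      place : ∀ x → Place x
      place x with x Fin.≟ v | Dₛ x BoolP.≟ true | Dₗ x BoolP.≟ true
      ... | yes e | _ | _ = first e
      ... | no _ | yes e | _ = small e
      ... | no _ | no _ | yes e = large e
      ... | no _ | no _ | no _ = none

      ordₚ : ∀ {x} → Place x → ℕ
      ordₚ (first _)     = 0
      ordₚ {x} (small _) = suc (S.ord x)
      ordₚ {x} (large _) = suc (M + L.ord x)
      ordₚ none          = 0

      actₚ : ∀ {x} → Place x → Fin n → Bool
      actₚ (first _)     u = Z u
      actₚ {x} (small _) u = S.act x u ∨ Zₗ u
      actₚ {x} (large _) u = L.act x u
      actₚ none          u = false

      ¬none : ∀ {x} → D x ≡ true → place x ≢ none
      ¬none {x} Dx e with x Fin.≟ v | Dₛ x BoolP.≟ true | Dₗ x BoolP.≟ true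
      ... | no a | no b | no c = [ a , [ b , c ]′ ]′ (parts x Dx)

      s<l : ∀ x y → ¬ suc (M + L.ord y) ≤ suc (S.ord x)
      s<l x y le = <⇒≱ (proj₂ (bounded S.ord) x) (≤-trans (m≤m+n M _) (≤-pred le))

    combine : Layout D Z (a + suc k)
    combine = record
      { ord = λ x → ordₚ (place x) ; act = λ x → actₚ (place x)
      ; inj = λ {x} {y} Dx Dy → inj' (place x) (place y) (¬none Dx) (¬none Dy)
      ; few = λ {x} Dx → few' (place x)
      ; active = λ {u} {x} {z} Dx Dz le adj pre → active' (place x) (place z) (place u) (¬none Dx) (¬none Dz) le adj
          (⊎-map id (λ (Du , lt) → Du , ¬none Du , lt) pre)
      }
      where
      inj' : ∀ {x y} (p : Place x) (q : Place y) → p ≢ none → q ≢ none → ordₚ p ≡ ordₚ q → x ≡ y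
      inj' none _ ¬n _ _ = ⊥-elim (¬n refl)
      inj' _ none _ ¬n _ = ⊥-elim (¬n refl)
      inj' (first refl) (first refl) _ _ _ = refl
      inj' (small a) (small b) _ _ e = S.inj a b (suc-injective e)
      inj' (large a) (large b) _ _ e = L.inj a b (+-cancelˡ-≡ M _ _ (suc-injective e))
      inj' {x} {y} (small a) (large b) _ _ e = ⊥-elim (s<l x y (≤-reflexive (sym e)))
      inj' {x} {y} (large a) (small b) _ _ e = ⊥-elim (s<l y x (≤-reflexive e))
      few' : ∀ {x} (p : Place x) → count (actₚ p) ≤ a + suc k
      few' (first _) = m≤n⇒m≤o+n a (Region.Z-count R)
      few' {x} (small e) = ≤-trans (count-∨ (S.act x) Zₗ) (+-mono-≤ (S.few e) (Region.Z-count Rₗ))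
      few' {x} (large e) = L.few e
      few' none = ≤-trans (≤-reflexive (count-false {n})) z≤n
      active' : ∀ {u x z} (p : Place x) (q : Place z) (r : Place u) → p ≢ none → q ≢ none → ordₚ p ≤ ordₚ q → Adj z u →
        Z u ≡ true ⊎ (D u ≡ true × r ≢ none × ordₚ r < ordₚ p) → actₚ p u ≡ true
      active' none _ _ ¬n _ _ _ _ = ⊥-elim (¬n refl)
      active' _ none _ _ ¬n _ _ _ = ⊥-elim (¬n refl)
      active' (first _) _ _ _ _ _ _ (inj₁ Zu) = Zu
      active' (small _) (first _) _ _ _ () _ _
      active' (large _) (first _) _ _ _ () _ _
      active' {u} {x} {z} (large _) (small _) _ _ _ le _ _ = ⊥-elim (s<l z x le)
      active' {u} {x} {z} (small a) (small b) r _ _ le adj pre with Region.closed Rₛ b adj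
      ... | inj₂ Zu = cong (_∨ Zₗ u) (S.active a b (≤-pred le) adj (inj₁ Zu))
      ... | inj₁ Du = cong (_∨ Zₗ u) (S.active a b (≤-pred le) adj (inj₂ (Du , before r pre)))
        where
        before : (r : Place u) → Z u ≡ true ⊎ (D u ≡ true × r ≢ none × ordₚ r < suc (S.ord x)) → S.ord u < S.ord x
        before _ (inj₁ Zu) = ⊥-elim (Region.disjoint R Zu (Dₛ⊆D u Du))
        before (first refl) (inj₂ _) = ⊥-elim (v∉Dₛ Du)
        before (small _) (inj₂ (_ , _ , lt)) = ≤-pred lt
        before (large e) (inj₂ _) = ⊥-elim (apart u Du e)
        before none (inj₂ (_ , ¬n , _)) = ⊥-elim (¬n refl)
      active' {u} {x} {z} (small a) (large b) r _ _ le adj pre with Region.closed Rₗ b adj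
      ... | inj₂ Zu = trans (cong (S.act x u ∨_) Zu) (BoolP.∨-zeroʳ _)
      ... | inj₁ Du = ⊥-elim (absurd r pre)
        where
        absurd : (r : Place u) → Z u ≡ true ⊎ (D u ≡ true × r ≢ none × ordₚ r < suc (S.ord x)) → ⊥
        absurd _ (inj₁ Zu) = Region.disjoint R Zu (Dₗ⊆D u Du)
        absurd (first refl) (inj₂ _) = v∉Dₗ Du
        absurd (small e) (inj₂ _) = apart u e Du
        absurd (large _) (inj₂ (_ , _ , lt)) = s<l x u (<⇒≤ lt)
        absurd none (inj₂ (_ , ¬n , _)) = ¬n refl
      active' {u} {x} {z} (large a) (large b) r _ _ le adj pre with Region.closed Rₗ b adj
      ... | inj₂ Zu = L.active a b (+-cancelˡ-≤ M _ _ (≤-pred le)) adj (inj₁ Zu)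
      ... | inj₁ Du = L.active a b (+-cancelˡ-≤ M _ _ (≤-pred le)) adj (inj₂ (Du , before r pre))
        where
        before : (r : Place u) → Z u ≡ true ⊎ (D u ≡ true × r ≢ none × ordₚ r < suc (M + L.ord x)) → L.ord u < L.ord x
        before _ (inj₁ Zu) = ⊥-elim (Region.disjoint R Zu (Dₗ⊆D u Du))
        before (first refl) (inj₂ _) = ⊥-elim (v∉Dₗ Du)
        before (small e) (inj₂ _) = ⊥-elim (apart u e Du)
        before (large _) (inj₂ (_ , _ , lt)) = +-cancelˡ-< M _ _ (≤-pred lt)
        before none (inj₂ (_ , ¬n , _)) = ⊥-elim (¬n refl)

  -- Laying out the smaller part first costs one extra bag, so every vertex pays for at most log₂ n bags.
  layout : ∀ {D Z} e → Region D Z → count D < 2 ^ e → Layout D Z (e * suc k)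
  layout {D} {Z} e R = go e R (<-wellFounded (count D))
    where
    empty : ∀ {D Z a} → ¬ 1 ≤ count D → Layout D Z a
    empty {D} ¬D = record { ord = λ _ → 0 ; inj = λ Dx → ⊥-elim (¬D (count-pos {p = D} Dx)) ; act = λ _ _ → false
      ; few = λ Dx → ⊥-elim (¬D (count-pos {p = D} Dx)) ; active = λ Dx → ⊥-elim (¬D (count-pos {p = D} Dx)) }
    halve : ∀ s l d e → 1 + s + l ≤ d → d < 2 * e → s ≤ l → s < e
    halve s l d e le lt s≤l = ≰⇒> λ e≤s → <⇒≱ lt (≤-trans (*-monoʳ-≤ 2 e≤s) (≤-trans (≤-reflexive (cong (s +_) (+-identityʳ s))) (≤-trans (+-monoʳ-≤ s s≤l) (≤-trans (n≤1+n _) le))))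
    go : ∀ e {D Z} → Region D Z → Acc _<_ (count D) → count D < 2 ^ e → Layout D Z (e * suc k)
    go e {D} R (acc rs) lt with 1 ≤? count D
    ... | no ¬D = empty ¬D
    go zero {D} R (acc rs) lt | yes 1≤D = ⊥-elim (<⇒≱ lt 1≤D)
    go (suc e) {D} {Z} R (acc rs) lt | yes 1≤D with count-∃ D 1≤D
    ... | x , Dx with split R Dx
    ...   | P = cases (≤-total (count D₀) (count D₁))
      where
      open Split P
      lt₀ : count D₀ < count D
      lt₀ = ≤-trans (s≤s (m≤m+n _ (count D₁))) sizes
      lt₁ : count D₁ < count D
      lt₁ = ≤-trans (s≤s (m≤n+m _ (count D₀))) sizes
      -- The large part keeps the exponent `suc e`, whose budget is one bag above that of the small
      -- part; the latter has fewer than 2^e vertices by `halve`.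
      large : ∀ {D' Z'} → Region D' Z' → count D' < count D → Layout D' Z' (e * suc k + suc k)
      large {D'} {Z'} R' lt' = subst (Layout D' Z') (+-comm (suc k) (e * suc k)) (go (suc e) R' (rs lt') (<-trans lt' lt))
      cases : count D₀ ≤ count D₁ ⊎ count D₁ ≤ count D₀ → Layout D Z (suc e * suc k)
      cases (inj₁ 0≤1) = subst (Layout D Z) (+-comm (e * suc k) (suc k)) (combine v R region₀ region₁
        (go e region₀ (rs lt₀) (halve _ _ _ (2 ^ e) sizes lt 0≤1)) (large region₁ lt₁)
        parts D₀⊆D D₁⊆D v∉D₀ v∉D₁ D₀∩D₁)
      cases (inj₂ 1≤0) = subst (Layout D Z) (+-comm (e * suc k) (suc k)) (combine v R region₁ region₀
        (go e region₁ (rs lt₁) (halve _ _ _ (2 ^ e) (≤-trans (s≤s (≤-reflexive (+-comm (count D₁) (count D₀)))) sizes) lt 1≤0)) (large region₀ lt₀)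
        (λ x Dx → [ inj₁ , [ inj₂ ∘ inj₂ , inj₂ ∘ inj₁ ]′ ]′ (parts x Dx)) D₁⊆D D₀⊆D v∉D₁ v∉D₀ (λ x d₁ d₀ → D₀∩D₁ x d₀ d₁))

treewidth⇒separation : ∀ {n} {G : Graph n} {k} → Elimination G k → ∀ e → n < 2 ^ e → VertexSeparation G (e * suc k)
treewidth⇒separation {n} {G} {k} E e n<2^e = record
  { ord = ord ; ord-inj = inj refl refl ; act = act ; act-count = λ x → few refl
  ; active = λ u<x x≤z uz → active refl refl x≤z (Edge⇒Adj (Edge-symmetric G uz)) (inj₂ (refl , u<x)) }
  where
  open Splitting E
  open Layout (layout e whole (≤-<-trans (count≤n {n} _) n<2^e))

-- Tree-partitions

-- Nodes of the tree are addressed by their path from the root, last step first.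
data Near : List ℕ → List ℕ → Set where
  same   : ∀ {a} → Near a a
  above  : ∀ {a} i → Near a (i ∷ a)
  beneath : ∀ {a} i → Near (i ∷ a) a

_≟ᴸ_ : (a b : List ℕ) → Dec (a ≡ b)
_≟ᴸ_ = ListP.≡-dec Data.Nat._≟_

-- All addresses live in one infinite tree, so partitions can be hung below a node or glued at their
-- roots without renumbering nodes.
record AddressPartition {n} (G : Graph n) (K : ℕ) : Set where
  field
    addr : Fin n → List ℕ
    near : ∀ {u v} → Edge G u v → Near (addr u) (addr v)
    size : ∀ a → count (λ v → does (addr v ≟ᴸ a)) ≤ K

-- To bound a bag one may fix a vertex in it, which then identifies the node of the bag.
count-≤-if-∃ : ∀ {n K} (p : Fin n → Bool) → (∀ x → p x ≡ true → count p ≤ K) → count p ≤ K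
count-≤-if-∃ p h with 1 ≤? count p
... | yes c = let x , px = count-∃ p c in h x px
... | no ¬c = ≤-trans (≤-pred (≰⇒> ¬c)) z≤n

tree-addresses : ∀ {m} (T : Tree m) → ∃[ f ] ((f zero ≡ List.[]) × (∀ i → f (suc i) ≡ toℕ i ∷ f (par T i)))
tree-addresses {m} T with ranked-choice toℕ P [] choose local
  where
  P : Fin (suc m) → (Fin (suc m) → List ℕ) → List ℕ → Set
  P zero    f a = a ≡ []
  P (suc i) f a = a ≡ toℕ i ∷ f (par T i)
  choose : ∀ x f → ∃[ a ] P x f a
  choose zero    f = [] , refl
  choose (suc i) f = toℕ i ∷ f (par T i) , refl
  local : ∀ x f g a → (∀ u → toℕ u < toℕ x → f u ≡ g u) → P x f a → P x g a
  local zero    f g a agree e = e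
  local (suc i) f g a agree e = trans e (cong (toℕ i ∷_) (agree (par T i) (s≤s (par-le T i))))
... | f , Pf = f , Pf zero , λ i → Pf (suc i)

tree-partition⇒addresses : ∀ {n} {G : Graph n} {K} → HasTP G K → AddressPartition G K
tree-partition⇒addresses {n} {G} {K} (m , T , P , width) with tree-addresses T
... | f , f0 , fs = record
  { addr = f ∘ node P
  ; near = λ {u} {v} e → [ (λ eq → subst (λ x → Near (f (node P u)) (f x)) eq same) , adjacent ]′ (TreePartition.edge-ok P u v e)
  ; size = λ a → count-≤-if-∃ (λ v → does (f (node P v) ≟ᴸ a)) λ x px → begin
      count (λ v → does (f (node P v) ≟ᴸ a)) ≤⟨ count-mono (λ v pv → trans (VecP.lookup∘tabulate (λ v → does (node P v Fin.≟ node P x)) v)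
          (dec-true (node P v Fin.≟ node P x) (f-inj _ _ (trans (does⇒ (f (node P v) ≟ᴸ a) pv) (sym (does⇒ (f (node P x) ≟ᴸ a) px)))))) ⟩
      count (Vec.lookup (TPbag P (node P x))) ≡⟨ count-Subset (TPbag P (node P x)) ⟨
      Subset.∣ TPbag P (node P x) ∣ ≤⟨ width (node P x) ⟩
      K ∎
  }
  where
  open ≤-Reasoning
  adjacent : ∀ {x y} → TAdj T x y → Near (f x) (f y)
  adjacent (i , inj₁ (refl , refl)) = subst (λ a → Near a (f (par T i))) (sym (fs i)) (beneath (toℕ i))
  adjacent (i , inj₂ (refl , refl)) = subst (Near (f (par T i))) (sym (fs i)) (above (toℕ i))
  f-inj : ∀ x y → f x ≡ f y → x ≡ y
  f-inj zero    zero    e = refl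
  f-inj zero    (suc j) e = case trans (sym f0) (trans e (fs j)) of λ ()
  f-inj (suc i) zero    e = case trans (sym f0) (trans (sym e) (fs i)) of λ ()
  f-inj (suc i) (suc j) e = cong suc (FinP.toℕ-injective (ListP.∷-injectiveˡ (trans (sym (fs i)) (trans e (fs j)))))

-- the numeral with digits in 1 .. N − 1 sorts addresses in breadth-first order
bfs-key : ℕ → List ℕ → ℕ
bfs-key N []      = 0
bfs-key N (i ∷ a) = bfs-key N a * N + suc i

bfs-key-mono : ∀ {N i} a b j → suc i < N → bfs-key N a < bfs-key N b → bfs-key N (i ∷ a) < bfs-key N (j ∷ b)
bfs-key-mono {N} {i} a b j i<N lt = begin-strict
  bfs-key N a * N + suc i <⟨ +-monoʳ-< (bfs-key N a * N) i<N ⟩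
  bfs-key N a * N + N ≡⟨ +-comm _ N ⟩
  suc (bfs-key N a) * N ≤⟨ *-monoˡ-≤ N lt ⟩
  bfs-key N b * N ≤⟨ m≤m+n _ (suc j) ⟩
  bfs-key N b * N + suc j ∎
  where open ≤-Reasoning

Digits : ℕ → List ℕ → Set
Digits N = All (λ i → suc i < N)

bfs-key-inj : ∀ {N} a b → Digits N a → Digits N b → bfs-key N a ≡ bfs-key N b → a ≡ b
bfs-key-inj [] [] _ _ _ = refl
bfs-key-inj {N} [] (j ∷ b) _ _ e = case trans e (+-suc _ j) of λ ()
bfs-key-inj {N} (i ∷ a) [] _ _ e = case trans (sym e) (+-suc _ i) of λ ()
bfs-key-inj {N} (i ∷ a) (j ∷ b) (i<N All.∷ da) (j<N All.∷ db) e with <-cmp (bfs-key N a) (bfs-key N b)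
... | tri< lt _ _ = ⊥-elim (<⇒≢ (bfs-key-mono a b j i<N lt) e)
... | tri> _ _ gt = ⊥-elim (<⇒≢ (bfs-key-mono b a i j<N gt) (sym e))
... | tri≈ _ eq _ with bfs-key-inj a b da db eq
...   | refl = cong (_∷ a) (suc-injective (+-cancelˡ-≡ (bfs-key N a * N) _ _ e))

next : Fin 3 → Fin 3
next zero             = suc zero
next (suc zero)       = suc (suc zero)
next (suc (suc zero)) = zero

next≢ : ∀ x → next x ≢ x
next≢ zero ()
next≢ (suc zero) ()
next≢ (suc (suc zero)) ()

-- This is why depth is taken modulo 3: modulo 2, an edge downwards and an edge upwards could join
-- the same two colours.
next²≢ : ∀ x → next (next x) ≢ x
next²≢ zero ()
next²≢ (suc zero) ()
next²≢ (suc (suc zero)) ()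

layer : List ℕ → Fin 3
layer []      = zero
layer (_ ∷ a) = next (layer a)

largest-digit : ∀ {n} (f : Fin n → List ℕ) → ∃[ N ] (∀ v → Digits N (f v))
largest-digit f with bounded (λ v → List.foldr _⊔_ 0 (f v))
... | M , h = suc M , λ v → digits (f v) (h v)
  where
  digits : ∀ a → List.foldr _⊔_ 0 a < M → Digits (suc M) a
  digits []      lt = All.[]
  digits (i ∷ a) lt = s≤s (≤-<-trans (m≤m⊔n i _) lt) All.∷ digits a (≤-<-trans (m≤n⊔m i _) lt)

-- The layers force two edges between the same tracks to be both inside bags, both downwards or both
-- upwards. In breadth-first order, children of an earlier node come before those of a later one, so
-- neither kind crosses.
addresses⇒tracks : ∀ {n} {G : Graph n} {K} → AddressPartition G K → TrackLayout G (3 * K)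
addresses⇒tracks {n} {G} {K} P with largest-digit (AddressPartition.addr P)
... | N , digits = record
  { col = λ v → toℕ (Fin.combine (layer (addr v)) (slot v)) ; ord = λ v → bfs-key N (addr v)
  ; col< = λ v → FinP.toℕ<n (Fin.combine (layer (addr v)) (slot v))
  ; ord-inj = λ {u} {v} c o → slot-inj (bfs-key-inj (addr u) (addr v) (digits u) (digits v) o) (same-slot u v c)
  ; proper = proper'
  ; no-X = λ {v} {w} {x} {y} cvw cxy v<w x<y vy wx →
      no-X' (same-layer v w cvw) (same-layer x y cxy) (digits v) (digits w) (digits x) (digits y) v<w x<y (near vy) (near wx)
  }
  where
  open AddressPartition P
  index : Fin n → ℕ
  index v = count (λ u → does (addr u ≟ᴸ addr v) ∧ does (toℕ u <? toℕ v))
  index<K : ∀ v → index v < K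
  index<K v = <-≤-trans (count-< {q = λ u → does (addr u ≟ᴸ addr v)} (λ u e → ∧-left e) {v} (dec-true (addr v ≟ᴸ addr v) refl)
    (λ e → <-irrefl refl (does⇒ (toℕ v <? toℕ v) (∧-right {does (addr v ≟ᴸ addr v)} e)))) (size (addr v))
  slot : Fin n → Fin K
  slot v = fromℕ< (index<K v)
  index-< : ∀ {u v} → addr u ≡ addr v → toℕ u < toℕ v → index u < index v
  index-< {u} {v} e lt = count-<
    (λ w h → let h₁ , h₂ = ∧-true {does (addr w ≟ᴸ addr u)} h in
       cong₂ _∧_ (dec-true (addr w ≟ᴸ addr v) (trans (does⇒ (addr w ≟ᴸ addr u) h₁) e))
                 (dec-true (toℕ w <? toℕ v) (<-trans (does⇒ (toℕ w <? toℕ u) h₂) lt)))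
    {u} (cong₂ _∧_ (dec-true (addr u ≟ᴸ addr v) e) (dec-true (toℕ u <? toℕ v) lt))
    (λ h → <-irrefl refl (does⇒ (toℕ u <? toℕ u) (∧-right {does (addr u ≟ᴸ addr u)} h)))
  slot-inj : ∀ {u v} → addr u ≡ addr v → slot u ≡ slot v → u ≡ v
  slot-inj {u} {v} e s with FinP.fromℕ<-injective (index u) (index v) (index<K u) (index<K v) s | <-cmp (toℕ u) (toℕ v)
  ... | i | tri< lt _ _ = ⊥-elim (<⇒≢ (index-< e lt) i)
  ... | i | tri> _ _ gt = ⊥-elim (<⇒≢ (index-< (sym e) gt) (sym i))
  ... | i | tri≈ _ eq _ = FinP.toℕ-injective eq
  same-layer : ∀ u v → toℕ (Fin.combine (layer (addr u)) (slot u)) ≡ toℕ (Fin.combine (layer (addr v)) (slot v)) → layer (addr u) ≡ layer (addr v)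
  same-layer u v e = FinP.combine-injectiveˡ (layer (addr u)) (slot u) (layer (addr v)) (slot v) (FinP.toℕ-injective e)
  same-slot : ∀ u v → toℕ (Fin.combine (layer (addr u)) (slot u)) ≡ toℕ (Fin.combine (layer (addr v)) (slot v)) → slot u ≡ slot v
  same-slot u v e = FinP.combine-injectiveʳ (layer (addr u)) (slot u) (layer (addr v)) (slot v) (FinP.toℕ-injective e)
  near-layer : ∀ {a b} → Near a b → layer a ≡ layer b → a ≡ b
  near-layer same _ = refl
  near-layer (above {a} i) e = ⊥-elim (next≢ (layer a) (sym e))
  near-layer (beneath {a} i) e = ⊥-elim (next≢ (layer a) e)
  proper' : ∀ {u v} → Edge G u v → toℕ (Fin.combine (layer (addr u)) (slot u)) ≢ toℕ (Fin.combine (layer (addr v)) (slot v))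
  proper' {u} {v} e c with slot-inj (near-layer (near e) (same-layer u v c)) (same-slot u v c)
  ... | refl = true≢false (trans (sym e) (adj-irr G u))
  no-X' : ∀ {v w x y} → layer v ≡ layer w → layer x ≡ layer y → Digits N v → Digits N w → Digits N x → Digits N y →
    bfs-key N v < bfs-key N w → bfs-key N x < bfs-key N y → Near v y → Near w x → ⊥
  no-X' _ _ _ _ _ _ v<w x<y same same = <-asym v<w x<y
  no-X' {w = w} vw xy _ _ _ _ _ _ same (above i) = next≢ (layer w) (trans xy vw)
  no-X' {x = x} vw xy _ _ _ _ _ _ same (beneath i) = next≢ (layer x) (trans (sym vw) (sym xy))
  no-X' {v = v} vw xy _ _ _ _ _ _ (above i) same = next≢ (layer v) (trans (sym xy) (sym vw))
  no-X' {v = v} {w} {x} {y} vw xy _ _ (x₀ All.∷ _) (y₀ All.∷ _) v<w x<y (above i) (above j) = <-asym x<y (bfs-key-mono v w j y₀ v<w)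
  no-X' {v = v} {x = x} vw xy _ _ _ _ _ _ (above i) (beneath j) = next²≢ (layer x) (trans (cong next (sym vw)) (sym xy))
  no-X' {y = y} vw xy _ _ _ _ _ _ (beneath i) same = next≢ (layer y) (trans vw xy)
  no-X' {w = w} {y = y} vw xy _ _ _ _ _ _ (beneath i) (above j) = next²≢ (layer w) (trans (cong next xy) vw)
  no-X' {x = x} {y} vw xy (v₀ All.∷ _) (w₀ All.∷ _) _ _ v<w x<y (beneath i) (beneath j) = <-asym v<w (bfs-key-mono x y i w₀ x<y)

-- Tree-partitions of graphs of bounded treewidth and degree

degree≤ : ∀ {n} (G : Graph n) v → count (adj G v) ≤ maxDeg G
degree≤ {n} G v = begin
  count (adj G v) ≡⟨ count-filter (λ u → T? (adj G v u)) id ⟨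
  deg G v ≤⟨ ≤-max (deg G) v ⟩
  List.foldr _⊔_ 0 (List.tabulate (deg G)) ≡⟨ cong (List.foldr _⊔_ 0) (ListP.map-tabulate id (deg G)) ⟨
  maxDeg G ∎
  where
  open ≤-Reasoning
  ≤-max : ∀ {n} (f : Fin n → ℕ) i → f i ≤ List.foldr _⊔_ 0 (List.tabulate f)
  ≤-max f zero    = m≤m⊔n (f zero) _
  ≤-max f (suc i) = ≤-trans (≤-max (f ∘ suc) i) (m≤n⊔m (f zero) _)

Near-map : ∀ {a b} (f : ℕ → ℕ) → Near a b → Near (List.map f a) (List.map f b)
Near-map f same        = same
Near-map f (above i)   = above (f i)
Near-map f (beneath i) = beneath (f i)

Near-snoc : ∀ {a b} → Near a b → Near (a List.∷ʳ 0) (b List.∷ʳ 0)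
Near-snoc same        = same
Near-snoc (above i)   = above i
Near-snoc (beneath i) = beneath i

Near-sym : ∀ {a b} → Near a b → Near b a
Near-sym same        = same
Near-sym (above i)   = beneath i
Near-sym (beneath i) = above i

∧-intro : ∀ {a b} → a ≡ true → b ≡ true → a ∧ b ≡ true
∧-intro refl refl = refl

not-intro : ∀ {a} → a ≢ true → not a ≡ true
not-intro {true}  h = ⊥-elim (h refl)
not-intro {false} h = refl

∨-introˡ : ∀ {a b} → a ≡ true → a ∨ b ≡ true
∨-introˡ refl = refl

∨-introʳ : ∀ {a b} → b ≡ true → a ∨ b ≡ true
∨-introʳ {a} refl = BoolP.∨-zeroʳ a

count-disjoint : ∀ {n} {p q r : Fin n → Bool} → (∀ i → p i ≡ true → r i ≡ true) → (∀ i → q i ≡ true → r i ≡ true) →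
  (∀ i → p i ≡ true → q i ≢ true) → count p + count q ≤ count r
count-disjoint {n} {p} {q} {r} pr qr pq = ≤-trans (count-+ p q r (λ _ → false) (λ i → bits (p i) (q i) (r i) (pr i) (qr i) (pq i)))
  (≤-reflexive (trans (cong (count r +_) (count-false {n})) (+-identityʳ _)))
  where
  bits : ∀ a b c → (a ≡ true → c ≡ true) → (b ≡ true → c ≡ true) → (a ≡ true → b ≢ true) → bit a + bit b ≤ bit c + 0
  bits false false c _ _ _ = z≤n
  bits true true c _ _ ab = ⊥-elim (ab refl refl)
  bits true false c ac _ _ rewrite ac refl = ≤-refl
  bits false true c _ bc _ rewrite bc refl = ≤-refl

module Partitioning {n} {G : Graph n} {k} (E : Elimination G k) (U : ℕ)
  (bag≤U : 12 * suc k ≤ U) (nbrs≤U : maxDeg G * (12 * suc k) ≤ U) where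
  open Splitting E

  h = suc k

  -- A tree-partition of the subgraph on W with S inside the root bag. The slack 4h in the bound on the root bag
  -- pays for the separator that is counted twice when two partitions are merged at their roots.
  record Partition (W S : Fin n → Bool) : Set where
    field
      addr      : Fin n → List ℕ
      near      : ∀ {u v} → W u ≡ true → W v ≡ true → Edge G u v → Near (addr u) (addr v)
      S-rooted : ∀ {v} → S v ≡ true → addr v ≡ []
      root-size : count (λ v → W v ∧ does (addr v ≟ᴸ [])) + 4 * h ≤ 2 * (count S ⊔ 4 * h)
      size      : ∀ a → count (λ v → W v ∧ does (addr v ≟ᴸ a)) ≤ 2 * U

  4h≤12h : 4 * h ≤ 12 * h
  4h≤12h = *-monoˡ-≤ h (m≤m+n 4 8)

  root≤2U : ∀ (S : Fin n → Bool) → count S ≤ U → 2 * (count S ⊔ 4 * h) ≤ 2 * U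
  root≤2U S S≤U = *-monoʳ-≤ 2 (⊔-lub S≤U (≤-trans 4h≤12h bag≤U))

  -- the bag S, below it a partition of the rest whose root contains the neighbours of S
  module Peel {W S : Fin n → Bool} (S⊆W : ∀ v → S v ≡ true → W v ≡ true) (S≤ : count S ≤ 12 * h) where

    W' N : Fin n → Bool
    W' v = W v ∧ not (S v)
    N v = any (λ s → S s ∧ adj G s v) ∧ W' v

    N⊆W' : ∀ v → N v ≡ true → W' v ≡ true
    N⊆W' v e = ∧-right {any (λ s → S s ∧ adj G s v)} e

    N≤U : count N ≤ U
    N≤U = begin
      count N ≤⟨ count-mono {p = N} {q = λ v → any (λ s → S s ∧ adj G s v)} (λ v e → ∧-left {any (λ s → S s ∧ adj G s v)} e) ⟩
      count (λ v → any (λ s → S s ∧ adj G s v)) ≤⟨ count-⋃ S (adj G) (degree≤ G) ⟩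
      maxDeg G * count S ≤⟨ *-monoʳ-≤ (maxDeg G) S≤ ⟩
      maxDeg G * (12 * h) ≤⟨ nbrs≤U ⟩
      U ∎
      where open ≤-Reasoning

    W'<W : ∀ {v} → S v ≡ true → count W' < count W
    W'<W {v} Sv = count-< {p = W'} {q = W} (λ v e → ∧-left {W v} e) (S⊆W v Sv) (λ e → not-true (∧-right {W v} e) Sv)

    module _ (P : Partition W' N) where
      private module P = Partition P

      addr : Fin n → List ℕ
      -- Addresses end at the root, so appending 0 hangs the partition below child 0 of the new
      -- root.
      addr v = if S v then [] else P.addr v List.∷ʳ 0

      addr-S : ∀ {v} → S v ≡ true → addr v ≡ []
      addr-S e rewrite e = refl

      addr-W' : ∀ {v} → S v ≢ true → addr v ≡ P.addr v List.∷ʳ 0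
      addr-W' {v} e with S v
      ... | true  = ⊥-elim (e refl)
      ... | false = refl

      snoc≢[] : ∀ (a : List ℕ) → a List.∷ʳ 0 ≢ []
      snoc≢[] [] ()
      snoc≢[] (_ ∷ _) ()

      addr-[] : ∀ {v} → addr v ≡ [] → S v ≡ true
      addr-[] {v} e with S v
      ... | true  = refl
      ... | false = ⊥-elim (snoc≢[] (P.addr v) e)

      W'⁺ : ∀ {v} → W v ≡ true → S v ≢ true → W' v ≡ true
      W'⁺ w ¬s = ∧-intro w (not-intro ¬s)

      N⁺ : ∀ {u v} → S u ≡ true → W' v ≡ true → Edge G u v → N v ≡ true
      N⁺ {u} {v} Su W'v e = ∧-intro (any-true (λ s → S s ∧ adj G s v) (∧-intro Su e)) W'v

      hang : ∀ {u v} → S u ≡ true → W v ≡ true → S v ≢ true → Edge G u v → Near (addr u) (addr v)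
      hang {u} {v} Su Wv ¬Sv e = subst₂ Near (sym (addr-S Su)) (sym (trans (addr-W' ¬Sv) (cong (List._∷ʳ 0) (P.S-rooted (N⁺ Su (W'⁺ Wv ¬Sv) e))))) (above 0)

      near' : ∀ {u v} → W u ≡ true → W v ≡ true → Edge G u v → Near (addr u) (addr v)
      near' {u} {v} Wu Wv e = go (S u BoolP.≟ true) (S v BoolP.≟ true)
        where
        go : Dec (S u ≡ true) → Dec (S v ≡ true) → Near (addr u) (addr v)
        go (yes Su) (yes Sv) = subst₂ Near (sym (addr-S Su)) (sym (addr-S Sv)) same
        go (yes Su) (no ¬Sv) = hang Su Wv ¬Sv e
        go (no ¬Su) (yes Sv) = Near-sym (hang Sv Wu ¬Su (Edge-symmetric G e))
        go (no ¬Su) (no ¬Sv) = subst₂ Near (sym (addr-W' ¬Su)) (sym (addr-W' ¬Sv)) (Near-snoc (P.near (W'⁺ Wu ¬Su) (W'⁺ Wv ¬Sv) e))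

      root≤S : count (λ v → W v ∧ does (addr v ≟ᴸ [])) ≤ count S
      root≤S = count-mono λ v e → addr-[] (does⇒ (addr v ≟ᴸ []) (∧-right {W v} e))

      peel : Partition W S
      peel = record
        { addr = addr ; near = near' ; S-rooted = addr-S
        ; root-size = ≤-trans (+-mono-≤ (≤-trans root≤S (m≤m⊔n (count S) (4 * h))) (m≤n⊔m (count S) (4 * h)))
            (≤-reflexive (cong ((count S ⊔ 4 * h) +_) (sym (+-identityʳ _))))
        ; size = λ a → count-≤-if-∃ (λ v → W v ∧ does (addr v ≟ᴸ a)) λ x e →
            size' a x (does⇒ (addr x ≟ᴸ a) (∧-right {W x} e)) (S x BoolP.≟ true)
        }
        where
        open ≤-Reasoning
        size' : ∀ a x → addr x ≡ a → Dec (S x ≡ true) → count (λ v → W v ∧ does (addr v ≟ᴸ a)) ≤ 2 * U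
        size' a x refl (yes Sx) = begin
          count (λ v → W v ∧ does (addr v ≟ᴸ addr x)) ≡⟨ cong (λ a → count (λ v → W v ∧ does (addr v ≟ᴸ a))) (addr-S Sx) ⟩
          count (λ v → W v ∧ does (addr v ≟ᴸ [])) ≤⟨ root≤S ⟩
          count S ≤⟨ ≤-trans S≤ bag≤U ⟩
          U ≤⟨ m≤n*m U 2 ⟩
          2 * U ∎
        size' a x refl (no ¬Sx) = ≤-trans (count-mono {q = λ v → W' v ∧ does (P.addr v ≟ᴸ P.addr x)} λ v e →
            let Wv , av = ∧-true {W v} e
                eq = does⇒ (addr v ≟ᴸ addr x) av
                ¬Sv = λ Sv → snoc≢[] (P.addr x) (trans (sym (addr-W' ¬Sx)) (trans (sym eq) (addr-S Sv)))
            in ∧-intro (W'⁺ Wv ¬Sv) (dec-true (P.addr v ≟ᴸ P.addr x)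
                 (ListP.∷ʳ-injectiveˡ (P.addr v) (P.addr x) (trans (sym (addr-W' ¬Sv)) (trans eq (addr-W' ¬Sx))))))
          (P.size (P.addr x))

  -- Both sides contain the part of the separator in `W` and have it in their root bags, so
  -- identifying the two roots is consistent.
  module Merge {W S : Fin n → Bool} (S⊆W : ∀ v → S v ≡ true → W v ≡ true) (S≤U : count S ≤ U) (S> : 12 * h < count S)
    (sep : Separator S) where
    open Separator sep
    open Region region

    W₁ W₂ S₁ S₂ : Fin n → Bool
    W₁ v = W v ∧ (D v ∨ Z v)
    W₂ v = W v ∧ not (D v)
    S₁ v = W v ∧ ((S v ∧ D v) ∨ Z v)
    S₂ v = W v ∧ ((S v ∧ not (D v)) ∨ Z v)

    S₁⊆W₁ : ∀ v → S₁ v ≡ true → W₁ v ≡ true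
    S₁⊆W₁ v e = let Wv , s = ∧-true {W v} e in ∧-intro Wv
      ([ (λ SD → ∨-introˡ (∧-right {S v} SD)) , ∨-introʳ ]′ (∨-true {S v ∧ D v} s))

    S₂⊆W₂ : ∀ v → S₂ v ≡ true → W₂ v ≡ true
    S₂⊆W₂ v e = let Wv , s = ∧-true {W v} e in ∧-intro Wv
      ([ (λ SD → ∧-right {S v} SD) , (λ Zv → not-intro (disjoint Zv)) ]′ (∨-true {S v ∧ not (D v)} s))

    a = count (λ v → S v ∧ D v)
    b = count (λ v → S v ∧ not (D v))
    c = count S

    a+b≤c : a + b ≤ c
    a+b≤c = count-disjoint (λ v e → ∧-left e) (λ v e → ∧-left e)
      (λ v e f → not-true (∧-right {S v} f) (∧-right {S v} e))

    c≤a+b : c ≤ a + b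
    c≤a+b = count-split S D

    S₁≤ : count S₁ ≤ a + h
    S₁≤ = ≤-trans (count-mono λ v e → ∧-right {W v} e) (≤-trans (count-∨ (λ v → S v ∧ D v) Z) (+-monoʳ-≤ a Z-count))

    S₂≤ : count S₂ ≤ b + h
    S₂≤ = ≤-trans (count-mono λ v e → ∧-right {W v} e) (≤-trans (count-∨ (λ v → S v ∧ not (D v)) Z) (+-monoʳ-≤ b Z-count))

    -- From 3a <= 3 + 2c this needs 3 + 9h <= c, which 12h < c provides. It leaves a surplus 2h
    -- after the separator is added to the side.
    a+3h≤c : a + 3 * h ≤ c
    a+3h≤c = *-cancelˡ-≤ 3 (linear (1 + 3 * k) (+-mono-≤ S> upper) (slack a c k))
      where
      slack : ∀ a c k → 3 * (a + 3 * (1 + k)) + (c + (3 + 2 * c)) + (1 + 3 * k) ≡ 3 * c + (1 + 12 * (1 + k) + 3 * a)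
      slack = ℕR.solve-∀

    3b≤2c : 3 * b ≤ 2 * c
    3b≤2c = linear 0 (+-mono-≤ lower (*-monoʳ-≤ 3 a+b≤c)) (slack a b c)
      where
      slack : ∀ a b c → 3 * b + (3 * a + 3 * c) + 0 ≡ 2 * c + (c + 3 * (a + b))
      slack = ℕR.solve-∀

    b+3h≤c : b + 3 * h ≤ c
    b+3h≤c = *-cancelˡ-≤ 3 (linear (4 + 3 * k) (+-mono-≤ S> 3b≤2c) (slack b c k))
      where
      slack : ∀ b c k → 3 * (b + 3 * (1 + k)) + (c + 2 * c) + (4 + 3 * k) ≡ 3 * c + (1 + 12 * (1 + k) + 3 * b)
      slack = ℕR.solve-∀

    h≤3h : h ≤ 3 * h
    h≤3h = m≤n*m h 3

    S₁≤U : count S₁ ≤ U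
    S₁≤U = ≤-trans S₁≤ (≤-trans (+-monoʳ-≤ a h≤3h) (≤-trans a+3h≤c S≤U))

    S₂≤U : count S₂ ≤ U
    S₂≤U = ≤-trans S₂≤ (≤-trans (+-monoʳ-≤ b h≤3h) (≤-trans b+3h≤c S≤U))

    W₂<W : count W₂ < count W
    W₂<W = ≤-trans (≤-trans (≤-reflexive (+-comm 1 _)) (+-monoʳ-≤ (count W₂) 1≤a))
      (count-disjoint (λ v e → ∧-left e) (λ v e → S⊆W v (∧-left e))
        (λ v e f → not-true (∧-right {W v} e) (∧-right {S v} f)))
      where
      1≤a : 1 ≤ a
      1≤a = n≢0⇒n>0 λ e → n≮0 (≤-trans S> (≤-trans lower (≤-reflexive (cong (3 *_) e))))

    W₁<W : count W₁ < count W
    W₁<W = ≤-trans (≤-trans (≤-reflexive (+-comm 1 _)) (+-monoʳ-≤ (count W₁) 1≤q))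
      (count-disjoint (λ v e → ∧-left e) (λ v e → S⊆W v (∧-left (∧-left e)))
        (λ v e f → let SD , ¬Z = ∧-true {S v ∧ not (D v)} f in
           [ not-true (∧-right {S v} SD) , not-true ¬Z ]′ (∨-true {D v} (∧-right {W v} e))))
      where
      -- The vertices of `S` outside `D` and `Z` certify that the first side is smaller: b >= 3h
      -- exceeds the size of `Z`.
      q = count (λ v → (S v ∧ not (D v)) ∧ not (Z v))
      b≤h+q : b ≤ h + q
      b≤h+q = ≤-trans (count-split (λ v → S v ∧ not (D v)) Z)
        (+-monoˡ-≤ q (≤-trans (count-mono λ v e → ∧-right {S v ∧ not (D v)} e) Z-count))
      1≤q : 1 ≤ q
      1≤q = +-cancelˡ-≤ h 1 q (≤-trans (+-cancelˡ-≤ a _ _ (≤-trans (≤-trans (+-monoʳ-≤ a (+h h (s≤s z≤n))) a+3h≤c) c≤a+b)) b≤h+q)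
        where
        +h : ∀ h → 1 ≤ h → h + 1 ≤ 3 * h
        +h h 1≤h = +-monoʳ-≤ h (≤-trans 1≤h (m≤m+n h _))

    -- This is the amortised inequality behind `root-size`: the two root bags have at most 2 (σ₁ +
    -- σ₂) - 8h vertices, and 2c - 4h are allowed. The maxima with 4h are harmless because a + 3h, b
    -- + 3h and 12h are all at most c.
    σ₁+σ₂≤ : (count S₁ ⊔ 4 * h) + (count S₂ ⊔ 4 * h) ≤ c + 2 * h
    σ₁+σ₂≤ = ≤-trans (+-mono-≤ (⊔-monoˡ-≤ (4 * h) S₁≤) (⊔-monoˡ-≤ (4 * h) S₂≤)) (cases (⊔-sel (a + h) (4 * h)) (⊔-sel (b + h) (4 * h)))
      where
      open ≤-Reasoning
      e₁ : ∀ a b h → (a + h) + (b + h) ≡ (a + b) + 2 * h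
      e₁ = ℕR.solve-∀
      e₂ : ∀ a h → (a + h) + 4 * h ≡ (a + 3 * h) + 2 * h
      e₂ = ℕR.solve-∀
      e₃ : ∀ b h → 4 * h + (b + h) ≡ (b + 3 * h) + 2 * h
      e₃ = ℕR.solve-∀
      e₄ : ∀ h → 4 * h + 4 * h + 6 * h ≡ 12 * h + 2 * h
      e₄ = ℕR.solve-∀
      cases : ∀ {x y} → x ≡ a + h ⊎ x ≡ 4 * h → y ≡ b + h ⊎ y ≡ 4 * h → x + y ≤ c + 2 * h
      cases (inj₁ refl) (inj₁ refl) = ≤-trans (≤-reflexive (e₁ a b h)) (+-monoˡ-≤ (2 * h) a+b≤c)
      cases (inj₁ refl) (inj₂ refl) = ≤-trans (≤-reflexive (e₂ a h)) (+-monoˡ-≤ (2 * h) a+3h≤c)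
      cases (inj₂ refl) (inj₁ refl) = ≤-trans (≤-reflexive (e₃ b h)) (+-monoˡ-≤ (2 * h) b+3h≤c)
      cases (inj₂ refl) (inj₂ refl) = ≤-trans (m≤m+n (4 * h + 4 * h) (6 * h)) (≤-trans (≤-reflexive (e₄ h)) (+-monoˡ-≤ (2 * h) (<⇒≤ S>)))

    module _ (P₁ : Partition W₁ S₁) (P₂ : Partition W₂ S₂) where
      private
        module P₁ = Partition P₁
        module P₂ = Partition P₂

      -- Even and odd digits keep the two trees disjoint below their common root.
      even odd : ℕ → ℕ
      even i = 2 * i
      odd i  = suc (2 * i)

      map-even-inj : ∀ a b → List.map even a ≡ List.map even b → a ≡ b
      map-even-inj a b = ListP.map-injective λ {i} {j} → *-cancelˡ-≡ i j 2

      map-odd-inj : ∀ a b → List.map odd a ≡ List.map odd b → a ≡ b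
      map-odd-inj a b = ListP.map-injective λ {i} {j} e → *-cancelˡ-≡ i j 2 (suc-injective e)

      even-odd : ∀ a b → List.map even a ≡ List.map odd b → List.map even a ≡ []
      even-odd [] [] e = refl
      even-odd (i ∷ a) (j ∷ b) e = ⊥-elim (even≢odd i j (ListP.∷-injectiveˡ e))

      addr : Fin n → List ℕ
      addr v = if D v ∨ Z v then List.map even (P₁.addr v) else List.map odd (P₂.addr v)

      addr₁ : ∀ {v} → W₁ v ≡ true → addr v ≡ List.map even (P₁.addr v)
      addr₁ {v} e rewrite proj₂ (∧-true {W v} e) = refl

      addr₂ : ∀ {v} → W₂ v ≡ true → addr v ≡ List.map odd (P₂.addr v)
      addr₂ {v} e with D v in Dv | Z v in Zv
      ... | true | _ = ⊥-elim (not-true (∧-right {W v} e) refl)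
      ... | false | false = refl
      -- A vertex of `Z` is addressed by the first partition, but both partitions put it at the
      -- root.
      ... | false | true = trans (cong (List.map even) (P₁.S-rooted (∧-intro (∧-left {W v} e) (∨-introʳ {S v ∧ D v} Zv))))
        (sym (cong (List.map odd) (P₂.S-rooted (∧-intro (∧-left {W v} e) (∨-introʳ {S v ∧ not (D v)} Zv)))))

      W₁⁺ : ∀ {v} → W v ≡ true → D v ≡ true ⊎ Z v ≡ true → W₁ v ≡ true
      W₁⁺ {v} Wv d = ∧-intro Wv ([ ∨-introˡ , ∨-introʳ {D v} ]′ d)

      side : ∀ v → W v ≡ true → W₁ v ≡ true ⊎ W₂ v ≡ true
      side v Wv = go (D v BoolP.≟ true)
        where
        go : Dec (D v ≡ true) → W₁ v ≡ true ⊎ W₂ v ≡ true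
        go (yes d) = inj₁ (W₁⁺ Wv (inj₁ d))
        go (no ¬d) = inj₂ (∧-intro Wv (not-intro ¬d))

      near' : ∀ {u v} → W u ≡ true → W v ≡ true → Edge G u v → Near (addr u) (addr v)
      near' {u} {v} Wu Wv e = go (D u BoolP.≟ true) (D v BoolP.≟ true)
        where
        near₁ : W₁ u ≡ true → W₁ v ≡ true → Near (addr u) (addr v)
        near₁ u₁ v₁ = subst₂ Near (sym (addr₁ u₁)) (sym (addr₁ v₁)) (Near-map even (P₁.near u₁ v₁ e))
        near₂ : W₂ u ≡ true → W₂ v ≡ true → Near (addr u) (addr v)
        near₂ u₂ v₂ = subst₂ Near (sym (addr₂ u₂)) (sym (addr₂ v₂)) (Near-map odd (P₂.near u₂ v₂ e))
        go : Dec (D u ≡ true) → Dec (D v ≡ true) → Near (addr u) (addr v)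
        go (yes d) _ = near₁ (W₁⁺ Wu (inj₁ d)) (W₁⁺ Wv (closed d (Edge⇒Adj e)))
        go (no _) (yes d) = near₁ (W₁⁺ Wu (closed d (Edge⇒Adj (Edge-symmetric G e)))) (W₁⁺ Wv (inj₁ d))
        go (no ¬du) (no ¬dv) = near₂ (∧-intro Wu (not-intro ¬du)) (∧-intro Wv (not-intro ¬dv))

      root' : ∀ {v} → S v ≡ true → addr v ≡ []
      root' {v} Sv = go (D v BoolP.≟ true)
        where
        go : Dec (D v ≡ true) → addr v ≡ []
        go (yes d) = trans (addr₁ (W₁⁺ (S⊆W v Sv) (inj₁ d))) (cong (List.map even) (P₁.S-rooted (∧-intro (S⊆W v Sv) (∨-introˡ (∧-intro Sv d)))))
        go (no ¬d) = trans (addr₂ (∧-intro (S⊆W v Sv) (not-intro ¬d))) (cong (List.map odd) (P₂.S-rooted (∧-intro (S⊆W v Sv) (∨-introˡ (∧-intro Sv (not-intro ¬d))))))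

      r r₁ r₂ : ℕ
      r  = count (λ v → W v ∧ does (addr v ≟ᴸ []))
      r₁ = count (λ v → W₁ v ∧ does (P₁.addr v ≟ᴸ []))
      r₂ = count (λ v → W₂ v ∧ does (P₂.addr v ≟ᴸ []))

      r≤ : r ≤ r₁ + r₂
      r≤ = ≤-trans (count-mono split-root) (count-∨ (λ v → W₁ v ∧ does (P₁.addr v ≟ᴸ [])) (λ v → W₂ v ∧ does (P₂.addr v ≟ᴸ [])))
        where
        split-root : ∀ v → W v ∧ does (addr v ≟ᴸ []) ≡ true → (W₁ v ∧ does (P₁.addr v ≟ᴸ [])) ∨ (W₂ v ∧ does (P₂.addr v ≟ᴸ [])) ≡ true
        split-root v e with ∧-true {W v} e
        ... | Wv , av with side v Wv
        ...   | inj₁ w = ∨-introˡ (∧-intro w (dec-true (P₁.addr v ≟ᴸ []) (map-even-inj (P₁.addr v) [] (trans (sym (addr₁ w)) (does⇒ (addr v ≟ᴸ []) av)))))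
        ...   | inj₂ w = ∨-introʳ {W₁ v ∧ does (P₁.addr v ≟ᴸ [])} (∧-intro w (dec-true (P₂.addr v ≟ᴸ []) (map-odd-inj (P₂.addr v) [] (trans (sym (addr₂ w)) (does⇒ (addr v ≟ᴸ []) av)))))

      root-size' : r + 4 * h ≤ 2 * (c ⊔ 4 * h)
      root-size' = ≤-trans (linear 0 (+-mono-≤ (+-mono-≤ r≤ (*-monoʳ-≤ 2 σ₁+σ₂≤)) (+-mono-≤ P₁.root-size P₂.root-size))
          (slack r r₁ r₂ (count S₁ ⊔ 4 * h) (count S₂ ⊔ 4 * h) c h))
        (*-monoʳ-≤ 2 (m≤m⊔n c (4 * h)))
        where
        slack : ∀ r r₁ r₂ s t c h → r + 4 * h + ((r₁ + r₂) + 2 * (c + 2 * h) + (2 * s + 2 * t)) + 0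
          ≡ 2 * c + (r + 2 * (s + t) + (r₁ + 4 * h + (r₂ + 4 * h)))
        slack = ℕR.solve-∀

      merge : Partition W S
      merge = record
        { addr = addr ; near = near' ; S-rooted = root' ; root-size = root-size'
        ; size = λ a → count-≤-if-∃ (λ v → W v ∧ does (addr v ≟ᴸ a)) λ x e →
            let Wx , ax = ∧-true {W x} e in size' a x (does⇒ (addr x ≟ᴸ a) ax) (side x Wx) (addr x ≟ᴸ [])
        }
        where
        size' : ∀ a x → addr x ≡ a → W₁ x ≡ true ⊎ W₂ x ≡ true → Dec (addr x ≡ []) → count (λ v → W v ∧ does (addr v ≟ᴸ a)) ≤ 2 * U
        size' a x refl _ (yes x[]) = ≤-trans (≤-reflexive (cong (λ a → count (λ v → W v ∧ does (addr v ≟ᴸ a))) x[]))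
          (≤-trans (m≤m+n r (4 * h)) (≤-trans root-size' (root≤2U S S≤U)))
        size' a x refl (inj₁ x₁) (no ¬x[]) = ≤-trans (count-mono {q = λ v → W₁ v ∧ does (P₁.addr v ≟ᴸ P₁.addr x)} λ v e →
            let Wv , av = ∧-true {W v} e ; eq = does⇒ (addr v ≟ᴸ addr x) av in
            [ (λ v₁ → ∧-intro v₁ (dec-true (P₁.addr v ≟ᴸ P₁.addr x) (map-even-inj (P₁.addr v) (P₁.addr x) (trans (sym (addr₁ v₁)) (trans eq (addr₁ x₁))))))
            , (λ v₂ → ⊥-elim (¬x[] (trans (addr₁ x₁) (even-odd (P₁.addr x) (P₂.addr v) (trans (sym (addr₁ x₁)) (trans (sym eq) (addr₂ v₂))))))) ]′ (side v Wv))
          (P₁.size (P₁.addr x))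
        size' a x refl (inj₂ x₂) (no ¬x[]) = ≤-trans (count-mono {q = λ v → W₂ v ∧ does (P₂.addr v ≟ᴸ P₂.addr x)} λ v e →
            let Wv , av = ∧-true {W v} e ; eq = does⇒ (addr v ≟ᴸ addr x) av in
            [ (λ v₁ → ⊥-elim (¬x[] (trans (sym eq) (trans (addr₁ v₁) (even-odd (P₁.addr v) (P₂.addr x) (trans (sym (addr₁ v₁)) (trans eq (addr₂ x₂))))))))
            , (λ v₂ → ∧-intro v₂ (dec-true (P₂.addr v ≟ᴸ P₂.addr x) (map-odd-inj (P₂.addr v) (P₂.addr x) (trans (sym (addr₂ v₂)) (trans eq (addr₂ x₂)))))) ]′ (side v Wv))
          (P₂.size (P₂.addr x))

  partition : ∀ {W S} → (∀ v → S v ≡ true → W v ≡ true) → count S ≤ U → Partition W S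
  partition {W} {S} = go (<-wellFounded (count W))
    where
    go : ∀ {W S} → Acc _<_ (count W) → (∀ v → S v ≡ true → W v ≡ true) → count S ≤ U → Partition W S
    go {W} {S} (acc rs) S⊆W S≤U = cases (count S ≤? 12 * h) (1 ≤? count S) (1 ≤? count W)
      where
      open ≤-Reasoning
      cases : Dec (count S ≤ 12 * h) → Dec (1 ≤ count S) → Dec (1 ≤ count W) → Partition W S
      cases (no S≰) _ _ = M.merge (go (rs M.W₁<W) M.S₁⊆W₁ M.S₁≤U) (go (rs M.W₂<W) M.S₂⊆W₂ M.S₂≤U)
        where module M = Merge S⊆W S≤U (≰⇒> S≰) (separator S)
      cases (yes S≤) (yes S≥1) _ = P.peel (go (rs (P.W'<W (proj₂ (count-∃ S S≥1)))) P.N⊆W' P.N≤U)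
        where module P = Peel S⊆W S≤
      -- Peeling an empty set would make no progress, so a single vertex w is placed in the root
      -- instead.
      cases (yes S≤) (no S≡∅) (yes W≥1) = record
        { addr = Q.addr ; near = Q.near ; S-rooted = λ Sv → ⊥-elim (S≡∅ (count-pos {p = S} Sv)) ; size = Q.size
        ; root-size = ≤-trans Q.root-size (*-monoʳ-≤ 2 (⊔-lub (≤-trans (≤-reflexive (count-singleton w)) 1≤σ) (m≤n⊔m (count S) (4 * h)))) }
        where
        w = proj₁ (count-∃ W W≥1)
        1≤σ : 1 ≤ count S ⊔ 4 * h
        1≤σ = ≤-trans (s≤s z≤n) (m≤n⊔m (count S) (4 * h))
        sing : Fin n → Bool
        sing v = does (v Fin.≟ w)
        module P = Peel {W} {sing} (λ v e → subst (λ v → W v ≡ true) (sym (does⇒ (v Fin.≟ w) e)) (proj₂ (count-∃ W W≥1)))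
          (≤-trans (≤-reflexive (count-singleton w)) (s≤s z≤n))
        module Q = Partition (P.peel (go (rs (P.W'<W {w} (dec-true (w Fin.≟ w) refl))) P.N⊆W' P.N≤U))
      cases (yes S≤) (no S≡∅) (no W≡∅) = record
        { addr = λ _ → [] ; near = λ Wu → ⊥-elim (W≡∅ (count-pos {p = W} Wu)) ; S-rooted = λ _ → refl
        ; root-size = ≤-trans (+-mono-≤ (≤-trans (none []) z≤n) (m≤n⊔m (count S) (4 * h))) (m≤m+n (count S ⊔ 4 * h) _)
        ; size = λ a → ≤-trans (none a) z≤n }
        where
        none : ∀ a → count (λ v → W v ∧ does ([] ≟ᴸ a)) ≤ 0
        none a = ≤-trans (count-mono {q = W} λ v e → ∧-left {W v} e) (≤-pred (≰⇒> W≡∅))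

-- U is the bound on the neighbourhood of a peeled bag of 12 (k + 1) vertices; bags stay within 2U.
bounded-degree-partition : ∀ {n} {G : Graph n} {k} → Elimination G k → 1 ≤ maxDeg G → AddressPartition G (2 * (maxDeg G * (12 * suc k)))
bounded-degree-partition {n} {G} {k} E 1≤Δ = record
  { addr = addr ; near = near refl refl ; size = size }
  where
  open Partitioning E (maxDeg G * (12 * suc k)) (m≤n*m (12 * suc k) (maxDeg G) {{>-nonZero 1≤Δ}}) ≤-refl
  open Partition (partition {λ _ → true} {λ _ → false} (λ _ ()) (≤-trans (≤-reflexive (count-false {n})) z≤n))

-- Monotone edge labellings (queue layouts) of chordal graphs

-- A layer of the chordal supergraph is again described by an elimination order; the edgeless graph
-- is the graph it is formally attached to.
edgeless : ∀ n → Graph n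
edgeless n = record { adj = λ _ _ → false ; adj-sym = λ _ _ → refl ; adj-irr = λ _ → refl }

-- Edges vu with u earlier than v in the elimination order, sharing a label, form a monotone matching from v to u
-- with respect to ord.
record Labelling {n} {G : Graph n} {k} (E : Elimination G k) (ℓ : ℕ) : Set where
  open Elimination E
  field
    ord     : Fin n → ℕ
    ord-inj : ∀ {u v} → ord u ≡ ord v → u ≡ v
    label   : Fin n → Fin n → ℕ
    label<  : ∀ {v u} → back v u ≡ true → label v u < ℓ
    mono    : ∀ {v u v' u'} → back v u ≡ true → back v' u' ≡ true → label v u ≡ label v' u' →
              ord v ≤ ord v' → ord u ≤ ord u'

module Layering {n} {G : Graph n} {k} (E : Elimination G (suc k)) (x₀ : Fin n) where
  open Elimination E

  private
    -- Breadth-first depth: one more than the least depth of an earlier neighbour, and 0 where there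
    -- is none.
    IsDepth : Fin n → (Fin n → ℕ) → ℕ → Set
    IsDepth v f a = (∀ u → back v u ≡ true → a ≤ suc (f u)) ×
      ((∃[ u ] (back v u ≡ true × a ≡ suc (f u))) ⊎ ((∀ u → back v u ≢ true) × a ≡ 0))

    depths : ∃[ f ] (∀ v → IsDepth v f (f v))
    depths = ranked-choice time IsDepth 0 choose local
      where
      choose : ∀ v f → ∃[ a ] IsDepth v f a
      choose v f with FinP.any? (λ u → back v u BoolP.≟ true)
      ... | no none = 0 , (λ u b → ⊥-elim (none (u , b))) , inj₂ ((λ u b → none (u , b)) , refl)
      ... | yes (x , b) with argmin f (back v) b
      ...   | y , by , min = suc (f y) , (λ u b → s≤s (min u b)) , inj₁ (y , by , refl)
      local : ∀ v f g a → (∀ u → time u < time v → f u ≡ g u) → IsDepth v f a → IsDepth v g a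
      local v f g a agree (le , r) = (λ u b → subst (λ x → a ≤ suc x) (agree u (back-< b)) (le u b)) ,
        ⊎-map (λ (u , b , e) → u , b , trans e (cong suc (agree u (back-< b)))) id r

  depth : Fin n → ℕ
  depth = proj₁ depths

  depth≤suc : ∀ {v u} → back v u ≡ true → depth v ≤ suc (depth u)
  depth≤suc {v} {u} = proj₁ (proj₂ depths v) u

  -- The earlier neighbour y that determines the depth of v is adjacent to u, so u is at most one
  -- deeper than y. Hence earlier neighbours lie in the layer of v or the one above.
  depth-mono : ∀ {v u} → back v u ≡ true → depth u ≤ depth v
  depth-mono {v} = go (<-wellFounded (time v))
    where
    go : ∀ {v} → Acc _<_ (time v) → ∀ {u} → back v u ≡ true → depth u ≤ depth v
    go {v} (acc rs) {u} bu with proj₂ (proj₂ depths v)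
    ... | inj₂ (none , _) = ⊥-elim (none u bu)
    ... | inj₁ (y , by , e) = ≤-trans step' (≤-reflexive (sym e))
      where
      step' : depth u ≤ suc (depth y)
      step' with <-cmp (time u) (time y)
      ... | tri< lt _ _ = m≤n⇒m≤1+n (go (rs (back-< by)) (clique bu by lt))
      ... | tri> _ _ gt = depth≤suc (clique by bu gt)
      ... | tri≈ _ eq _ with time-inj eq
      ...   | refl = n≤1+n _

  same-layer : Fin n → Fin n → Bool
  same-layer v u = back v u ∧ does (depth u Data.Nat.≟ depth v)

  same⁺ : ∀ {v u} → back v u ≡ true → depth u ≡ depth v → same-layer v u ≡ true
  same⁺ {v} {u} b e = ∧-intro b (dec-true (depth u Data.Nat.≟ depth v) e)

  same⁻ : ∀ {v u} → same-layer v u ≡ true → back v u ≡ true × depth u ≡ depth v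
  same⁻ {v} {u} e = let b , d = ∧-true {back v u} e in b , does⇒ (depth u Data.Nat.≟ depth v) d

  -- A vertex with an earlier neighbour has one in the layer above, so at least one of the `suc k`
  -- places is lost within the layer.
  inner : Elimination (edgeless n) k
  inner = record
    { time = time ; time-inj = time-inj ; back = same-layer ; back-< = λ e → back-< (proj₁ (same⁻ e))
    ; back-count = few
    ; clique = λ su sw lt → let bu , du = same⁻ su ; bw , dw = same⁻ sw in same⁺ (clique bu bw lt) (trans du (sym dw))
    ; edge = λ () }
    where
    few : ∀ v → count (same-layer v) ≤ k
    few v with proj₂ (proj₂ depths v)
    ... | inj₂ (none , _) = count-≤-if-∃ (same-layer v) λ u e → ⊥-elim (none u (proj₁ (same⁻ e)))
    ... | inj₁ (y , by , e) = ≤-pred (<-≤-trans (count-< {p = same-layer v} {q = back v} (λ u e → proj₁ (same⁻ e)) by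
            (λ s → <⇒≢ (n<1+n _) (trans (proj₂ (same⁻ s)) e))) (back-count v))

  private
    IsPortal : Fin n → (Fin n → Fin n) → Fin n → Set
    IsPortal v f a = (∃[ u ] (same-layer v u ≡ true × a ≡ f u)) ⊎
      ((∀ u → same-layer v u ≢ true) × (∀ u → back v u ≡ true → back v a ≡ true × time u ≤ time a))

    portals : ∃[ f ] (∀ v → IsPortal v f (f v))
    portals = ranked-choice time IsPortal x₀ choose local
      where
      argmax : ∀ (p : Fin n → Bool) {x} → p x ≡ true → ∃[ y ] (p y ≡ true × (∀ z → p z ≡ true → time z ≤ time y))
      argmax p {x} px with bounded time
      ... | M , time<M with argmin (λ z → M ∸ time z) p px
      ...   | y , py , min = y , py , λ z pz → ∸-cancelʳ-≤ (<⇒≤ (time<M z)) (min z pz)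
      choose : ∀ v f → ∃[ a ] IsPortal v f a
      choose v f with FinP.any? (λ u → same-layer v u BoolP.≟ true)
      ... | yes (u , s) = f u , inj₁ (u , s , refl)
      ... | no none with FinP.any? (λ u → back v u BoolP.≟ true)
      -- Without earlier neighbours the value is a dummy: such a vertex has depth 0, where `tail`
      -- discards it.
      ...   | no none' = v , inj₂ ((λ u s → none (u , s)) , λ u b → ⊥-elim (none' (u , b)))
      ...   | yes (x , b) with argmax (back v) b
      ...     | y , by , max = y , inj₂ ((λ u s → none (u , s)) , λ u b → by , max u b)
      local : ∀ v f g a → (∀ u → time u < time v → f u ≡ g u) → IsPortal v f a → IsPortal v g a
      local v f g a agree (inj₁ (u , s , e)) = inj₁ (u , s , trans e (agree u (back-< (proj₁ (same⁻ s)))))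
      local v f g a agree (inj₂ r) = inj₂ r

  -- The upper neighbours of a component of a layer form a clique; w v is the latest vertex of the clique above v.
  w : Fin n → Fin n
  w = proj₁ portals

  private
    is-portal : ∀ v → IsPortal v w (w v)
    is-portal = proj₂ portals

  w-same : ∀ {v u} → same-layer v u ≡ true → w v ≡ w u
  w-same {v} = go (<-wellFounded (time v))
    where
    go : ∀ {v} → Acc _<_ (time v) → ∀ {u} → same-layer v u ≡ true → w v ≡ w u
    go {v} (acc rs) {u} s with is-portal v
    ... | inj₂ (none , _) = ⊥-elim (none u s)
    ... | inj₁ (y , sy , e) with <-cmp (time u) (time y)
    ...   | tri< lt _ _ = trans e (go (rs (Elimination.back-< inner sy)) (Elimination.clique inner s sy lt))
    ...   | tri> _ _ gt = trans e (sym (go (rs (Elimination.back-< inner s)) (Elimination.clique inner sy s gt)))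
    ...   | tri≈ _ eq _ with time-inj eq
    ...     | refl = e

  -- At the first vertex of a component of the layer, the clique above is `back v` and w v its
  -- latest member. Otherwise c passes to a same-layer neighbour u: it cannot be later than u, since
  -- `depth-mono` would put it into the layer of v.
  w-upper : ∀ {v c} → back v c ≡ true → depth c ≢ depth v → c ≡ w v ⊎ back (w v) c ≡ true
  w-upper {v} = go (<-wellFounded (time v))
    where
    go : ∀ {v} → Acc _<_ (time v) → ∀ {c} → back v c ≡ true → depth c ≢ depth v → c ≡ w v ⊎ back (w v) c ≡ true
    go {v} (acc rs) {c} b ne with is-portal v
    ... | inj₂ (_ , max) = latest (m≤n⇒m<n∨m≡n (proj₂ (max c b)))
      where
      latest : time c < time (w v) ⊎ time c ≡ time (w v) → c ≡ w v ⊎ back (w v) c ≡ true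
      latest (inj₁ lt) = inj₂ (clique b (proj₁ (max c b)) lt)
      latest (inj₂ eq) = inj₁ (time-inj eq)
    ... | inj₁ (u , s , e) = subst (λ x → c ≡ x ⊎ back x c ≡ true) (sym e)
            (go (rs (back-< bu)) back-uc (λ eq → ne (trans eq du)))
      where
      bu = proj₁ (same⁻ s)
      du = proj₂ (same⁻ s)
      back-uc : back u c ≡ true
      back-uc with <-cmp (time c) (time u)
      ... | tri< lt _ _ = clique b bu lt
      ... | tri> _ _ gt = ⊥-elim (ne (≤-antisym (depth-mono b) (≤-trans (≤-reflexive (sym du)) (depth-mono (clique bu b gt)))))
      ... | tri≈ _ eq _ with time-inj eq
      ...   | refl = ⊥-elim (ne du)

  depth-above : ∀ {v c} → back v c ≡ true → depth c ≢ depth v → depth v ≡ suc (depth c)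
  depth-above b ne = ≤-antisym (depth≤suc b) (≤∧≢⇒< (depth-mono b) ne)

  depth-w : ∀ {v d} → depth v ≡ suc d → depth (w v) ≡ d
  depth-w {v} = go (<-wellFounded (time v))
    where
    go : ∀ {v d} → Acc _<_ (time v) → depth v ≡ suc d → depth (w v) ≡ d
    go {v} (acc rs) e with is-portal v | proj₂ (proj₂ depths v)
    ... | inj₁ (u , s , eq) | _ = trans (cong depth eq) (go (rs (Elimination.back-< inner s)) (trans (proj₂ (same⁻ s)) e))
    ... | inj₂ _ | inj₂ (_ , e0) = case trans (sym e) e0 of λ ()
    ... | inj₂ (none , max) | inj₁ (y , by , _) = let bw = proj₁ (max y by) in
      suc-injective (trans (sym (depth-above bw λ eq → none (w v) (same⁺ bw eq))) e)

  module Lift {ℓ} (L : Labelling inner ℓ) where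
    private
      module L = Labelling L

      N : ℕ
      N = suc (proj₁ (bounded (λ v → suc (L.ord v))))

      digit<N : ∀ v → suc (L.ord v) < N
      digit<N v = m<n⇒m<1+n (proj₂ (bounded (λ v → suc (L.ord v))) v)

      tail : ℕ → ℕ → ℕ
      tail zero    x = 0
      tail (suc _) x = x

      -- A positional numeral in base `N`: vertices are compared by their portals in the layer
      -- above, and ties are broken by the order inside the layers.
      orders : ∃[ f ] (∀ v → f v ≡ tail (depth v) (f (w v)) * N + suc (L.ord v))
      orders = ranked-choice depth (λ v f a → a ≡ tail (depth v) (f (w v)) * N + suc (L.ord v)) 0 (λ v f → _ , refl) local
        where
        local : ∀ v f g a → (∀ u → depth u < depth v → f u ≡ g u) →
          a ≡ tail (depth v) (f (w v)) * N + suc (L.ord v) → a ≡ tail (depth v) (g (w v)) * N + suc (L.ord v)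
        local v f g a agree e with depth v in d
        ... | zero  = e
        ... | suc _ = trans e (cong (λ x → x * N + suc (L.ord v)) (agree (w v) (≤-reflexive (cong suc (depth-w d)))))

    ord t : Fin n → ℕ
    ord = proj₁ orders
    t v = tail (depth v) (ord (w v))

    private
      ord≡ : ∀ v → ord v ≡ t v * N + suc (L.ord v)
      ord≡ = proj₂ orders

      t-same : ∀ {v u} → same-layer v u ≡ true → t u ≡ t v
      t-same s = cong₂ tail (proj₂ (same⁻ s)) (cong ord (sym (w-same s)))

      t-above : ∀ {v c} → back v c ≡ true → depth c ≢ depth v → t v ≡ ord (w v)
      t-above {v} b ne = cong (λ d → tail d (ord (w v))) (depth-above b ne)

      t< : ∀ {v v'} → t v < t v' → ord v < ord v'
      t< {v} {v'} lt = begin-strict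
        ord v ≡⟨ ord≡ v ⟩
        t v * N + suc (L.ord v) <⟨ +-monoʳ-< (t v * N) (digit<N v) ⟩
        t v * N + N ≡⟨ +-comm _ N ⟩
        suc (t v) * N ≤⟨ *-monoˡ-≤ N lt ⟩
        t v' * N ≤⟨ m≤m+n _ (suc (L.ord v')) ⟩
        t v' * N + suc (L.ord v') ≡⟨ ord≡ v' ⟨
        ord v' ∎
        where open ≤-Reasoning

      ord≤⇒t≤ : ∀ {v v'} → ord v ≤ ord v' → t v ≤ t v'
      ord≤⇒t≤ le = ≮⇒≥ λ lt → <⇒≱ (t< lt) le

      ord⇔ : ∀ {v v'} → t v ≡ t v' → ord v ≤ ord v' → L.ord v ≤ L.ord v'
      ord⇔ {v} {v'} e le = ≤-pred (+-cancelˡ-≤ (t v' * N) _ _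
        (≤-trans (≤-reflexive (trans (cong (λ x → x * N + suc (L.ord v)) (sym e)) (sym (ord≡ v)))) (≤-trans le (≤-reflexive (ord≡ v')))))

      ord⇐ : ∀ {v v'} → t v ≡ t v' → L.ord v ≤ L.ord v' → ord v ≤ ord v'
      ord⇐ {v} {v'} e le = ≤-trans (≤-reflexive (trans (ord≡ v) (cong (λ x → x * N + suc (L.ord v)) e)))
        (≤-trans (+-monoʳ-≤ (t v' * N) (s≤s le)) (≤-reflexive (sym (ord≡ v'))))

    ord-inj : ∀ {u v} → ord u ≡ ord v → u ≡ v
    ord-inj {u} {v} e = L.ord-inj (≤-antisym (ord⇔ te (≤-reflexive e)) (ord⇔ (sym te) (≤-reflexive (sym e))))
      where
      te : t u ≡ t v
      te = ≤-antisym (ord≤⇒t≤ (≤-reflexive e)) (ord≤⇒t≤ (≤-reflexive (sym e)))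

    -- An edge to the layer above that misses the portal borrows the label of the edge from the
    -- portal to the same vertex, shifted past ℓ. This gives the recurrence l -> 2l + 1.
    label : Fin n → Fin n → ℕ
    label v u = if same-layer v u then L.label v u else (if does (u Fin.≟ w v) then ℓ else suc ℓ + L.label (w v) u)

    data Kind (v u : Fin n) : ℕ → Set where
      inside  : same-layer v u ≡ true → Kind v u (L.label v u)
      portal  : t v ≡ ord (w v) → u ≡ w v → Kind v u ℓ
      through : t v ≡ ord (w v) → same-layer (w v) u ≡ true → Kind v u (suc ℓ + L.label (w v) u)

    kind : ∀ {v u} → back v u ≡ true → Kind v u (label v u)
    kind {v} {u} b with same-layer v u in s | u Fin.≟ w v
    ... | true  | _ = inside s
    ... | false | d = outside d
      where
      ne : depth u ≢ depth v
      ne d = true≢false (trans (sym (same⁺ b d)) s)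
      outside : (d : Dec (u ≡ w v)) → Kind v u (if does d then ℓ else suc ℓ + L.label (w v) u)
      outside (yes e) = portal (t-above b ne) e
      outside (no u≢w) = through (t-above b ne) ([ ⊥-elim ∘ u≢w , (λ bw → same⁺ bw (sym (depth-w (depth-above b ne)))) ]′ (w-upper b ne))

    kind-< : ∀ {v u l} → Kind v u l → l < ℓ + suc ℓ
    kind-< (inside s)    = ≤-trans (L.label< s) (m≤m+n ℓ _)
    kind-< (portal _ _)  = m<m+n ℓ (s≤s z≤n)
    kind-< (through _ s) = ≤-trans (≤-reflexive (sym (+-suc (suc ℓ) _))) (≤-trans (+-monoʳ-≤ (suc ℓ) (L.label< s)) (≤-reflexive (+-comm (suc ℓ) ℓ)))

    -- Both ends of an edge inside a layer have the same leading part `t`, so either `t` decides at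
    -- both ends or the inner order does.
    inside-mono : ∀ {v u v' u'} → same-layer v u ≡ true → same-layer v' u' ≡ true → L.label v u ≡ L.label v' u' →
      ord v ≤ ord v' → ord u ≤ ord u'
    inside-mono {v} {u} {v'} {u'} s s' e le with m≤n⇒m<n∨m≡n (ord≤⇒t≤ {v} {v'} le)
    ... | inj₁ lt = <⇒≤ (t< (subst₂ _<_ (sym (t-same s)) (sym (t-same s')) lt))
    ... | inj₂ eq = ord⇐ (trans (t-same s) (trans eq (sym (t-same s')))) (L.mono s s' e (ord⇔ eq le))

    -- The step from v to its portal is monotone because the portal's position is the leading part
    -- of `ord v`. An edge passing the portal continues with an edge inside a layer.
    kind-mono : ∀ {v u v' u' l l'} → Kind v u l → Kind v' u' l' → l ≡ l' → ord v ≤ ord v' → ord u ≤ ord u'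
    kind-mono (inside s) (inside s') e le = inside-mono s s' e le
    kind-mono {v} {_} {v'} (portal tv refl) (portal tv' refl) _ le = subst₂ _≤_ tv tv' (ord≤⇒t≤ {v} {v'} le)
    kind-mono {v} {_} {v'} (through tv s) (through tv' s') e le =
      inside-mono s s' (+-cancelˡ-≡ (suc ℓ) _ _ e) (subst₂ _≤_ tv tv' (ord≤⇒t≤ {v} {v'} le))
    kind-mono (inside s) (portal _ _) e _ = ⊥-elim (<⇒≢ (L.label< s) e)
    kind-mono (portal _ _) (inside s) e _ = ⊥-elim (<⇒≢ (L.label< s) (sym e))
    kind-mono (inside s) (through _ _) e _ = ⊥-elim (<⇒≢ (≤-trans (L.label< s) (≤-trans (n≤1+n ℓ) (m≤m+n (suc ℓ) _))) e)
    kind-mono (through _ _) (inside s) e _ = ⊥-elim (<⇒≢ (≤-trans (L.label< s) (≤-trans (n≤1+n ℓ) (m≤m+n (suc ℓ) _))) (sym e))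
    kind-mono (portal _ _) (through _ _) e _ = ⊥-elim (<⇒≢ (s≤s (m≤m+n ℓ _)) e)
    kind-mono (through _ _) (portal _ _) e _ = ⊥-elim (<⇒≢ (s≤s (m≤m+n ℓ _)) (sym e))

    lift : Labelling E (ℓ + suc ℓ)
    lift = record { ord = ord ; ord-inj = ord-inj ; label = label ; label< = λ b → kind-< (kind b)
                  ; mono = λ b b' → kind-mono (kind b) (kind b') }

queues : ℕ → ℕ
queues zero    = 0
queues (suc k) = queues k + suc (queues k)

labelling : ∀ {n} {G : Graph n} k (E : Elimination G k) → Labelling E (queues k)
labelling {zero} k E = record { ord = λ () ; ord-inj = λ { {()} } ; label = λ () ; label< = λ { {()} } ; mono = λ { {()} } }
labelling {suc n} zero E = record { ord = time ; ord-inj = time-inj ; label = λ _ _ → 0 ; label< = λ {v} b → none v b ; mono = λ {v} b → none v b }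
  where
  open Elimination E
  none : ∀ v {u} {A : Set} → back v u ≡ true → A
  none v b = ⊥-elim (<⇒≱ (count-pos {p = back v} b) (back-count v))
labelling {suc n} (suc k) E = Layering.Lift.lift E zero (labelling k (Layering.inner E zero))

-- Tracks from a labelling

residue : ∀ m .{{_ : NonZero m}} (x : Fin m) c → c < m → ∃[ a ] ((toℕ {m} a + toℕ x) % m ≡ c)
residue m x c c<m = fromℕ< (m%n<n (c + (m ∸ toℕ x)) m) , (begin
  (toℕ (fromℕ< (m%n<n (c + (m ∸ toℕ x)) m)) + toℕ x) % m ≡⟨ cong (λ y → (y + toℕ x) % m) (FinP.toℕ-fromℕ< (m%n<n (c + (m ∸ toℕ x)) m)) ⟩
  ((c + (m ∸ toℕ x)) % m + toℕ x) % m ≡⟨ %-distribˡ-+ ((c + (m ∸ toℕ x)) % m) (toℕ x) m ⟩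
  ((c + (m ∸ toℕ x)) % m % m + toℕ x % m) % m ≡⟨ cong (λ y → (y + toℕ x % m) % m) (m%n%n≡m%n (c + (m ∸ toℕ x)) m) ⟩
  ((c + (m ∸ toℕ x)) % m + toℕ x % m) % m ≡⟨ %-distribˡ-+ (c + (m ∸ toℕ x)) (toℕ x) m ⟨
  (c + (m ∸ toℕ x) + toℕ x) % m ≡⟨ cong (_% m) (trans (+-assoc c (m ∸ toℕ x) (toℕ x)) (cong (c +_) (m∸n+n≡m (<⇒≤ (FinP.toℕ<n x))))) ⟩
  (c + m) % m ≡⟨ [m+n]%n≡m%n c m ⟩
  c % m ≡⟨ m<n⇒m%n≡m c<m ⟩
  c ∎)
  where open ≡-Reasoning

module LabelledTracks {n} {G : Graph n} {k ℓ} (E : Elimination G k) (L : Labelling E ℓ)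
  (col : Fin n → Fin (suc k)) (col-back : ∀ {v u} → Elimination.back E v u ≡ true → col u ≢ col v) where
  open Elimination E
  open Labelling L

  private
    back-unique : ∀ {v u u'} → back v u ≡ true → back v u' ≡ true → col u ≡ col u' → u ≡ u'
    back-unique {v} {u} {u'} b b' e with <-cmp (time u) (time u')
    ... | tri< lt _ _ = ⊥-elim (col-back (clique b b' lt) e)
    ... | tri> _ _ gt = ⊥-elim (col-back (clique b' b gt) (sym e))
    ... | tri≈ _ eq _ = time-inj eq

    m : ℕ
    -- There are 2ℓ codes; the extra residue keeps the modulus nonzero when ℓ is 0.
    m = suc (ℓ + ℓ)

    -- Records the direction of the edge in time relative to the colours: codes from ℓ on mean that
    -- the earlier end has the larger colour.
    downwards : Fin n → Fin n → ℕ
    downwards v u = if does (col v FinP.<? col u) then ℓ else 0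

    code : Fin n → Fin n → ℕ
    code v u = label v u + downwards v u

    code<m : ∀ {v u} → back v u ≡ true → code v u < m
    code<m {v} {u} b = s≤s (+-mono-≤ (<⇒≤ (label< b)) (h (does (col v FinP.<? col u))))
      where
      h : ∀ b → (if b then ℓ else 0) ≤ ℓ
      h true  = ≤-refl
      h false = z≤n

    -- The shifts solve shift v (col u) + shift u (col v) = code v u modulo m for every edge; the system is
    -- triangular, since v has at most one earlier neighbour of each colour.
    Shift : Fin n → (Fin n → Fin (suc k) → Fin m) → (Fin (suc k) → Fin m) → Set
    Shift v f a = ∀ u → back v u ≡ true → (toℕ (a (col u)) + toℕ (f u (col v))) % m ≡ code v u

    shifts : ∃[ f ] (∀ v → Shift v f (f v))
    shifts = ranked-choice time Shift (λ _ → zero) choose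
      (λ v f g a agree h u b → trans (cong (λ (x : Fin (suc k) → Fin m) → (toℕ (a (col u)) + toℕ (x (col v))) % m) (sym (agree u (back-< b)))) (h u b))
      where
      choose : ∀ v (f : Fin n → Fin (suc k) → Fin m) → ∃[ a ] Shift v f a
      choose v f = a , λ u b → solves u b (earlier (col u))
        where
        Earlier : Fin (suc k) → Set
        Earlier j = ∃[ u ] (back v u ≡ true × col u ≡ j)
        earlier : ∀ j → Dec (Earlier j)
        earlier j = FinP.any? (λ u → (back v u BoolP.≟ true) ×-dec (col u Fin.≟ j))
        value : ∀ {j} → Dec (Earlier j) → Fin m
        value (yes (u , b , _)) = proj₁ (residue m (f u (col v)) (code v u) (code<m b))
        value (no _)            = zero
        a : Fin (suc k) → Fin m
        a j = value (earlier j)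
        solves : ∀ u → back v u ≡ true → (d : Dec (Earlier (col u))) → (toℕ (value d) + toℕ (f u (col v))) % m ≡ code v u
        solves u b (no none) = ⊥-elim (none (u , b , refl))
        solves u b (yes (u' , b' , e)) = subst (λ z → (toℕ (value (yes (u' , b' , e))) + toℕ (f z (col v))) % m ≡ code v z)
          (back-unique b' b e) (proj₂ (residue m (f u' (col v)) (code v u') (code<m b')))

    shift : Fin n → Fin (suc k) → Fin m
    shift = proj₁ shifts

    -- The colour together with all shifts of the vertex. The code of an edge is a sum of one shift
    -- from each end, so it depends only on the two tracks.
    track : Fin n → Fin (suc k * m ^ suc k)
    track v = Fin.combine (col v) (Fin.funToFin (shift v))

    same-col : ∀ {u v} → track u ≡ track v → col u ≡ col v
    same-col {u} {v} e = FinP.combine-injectiveˡ (col u) (Fin.funToFin (shift u)) (col v) (Fin.funToFin (shift v)) e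

    same-shift : ∀ {u v} → track u ≡ track v → ∀ j → shift u j ≡ shift v j
    same-shift {u} {v} e j = trans (sym (FinP.finToFun-funToFin (shift u) j)) (trans
      (cong (λ x → Fin.finToFun x j) (FinP.combine-injectiveʳ (col u) (Fin.funToFin (shift u)) (col v) (Fin.funToFin (shift v)) e))
      (FinP.finToFun-funToFin (shift v) j))

    code-≡ : ∀ {v w x y} → track v ≡ track w → track x ≡ track y → (toℕ (shift v (col y)) + toℕ (shift y (col v))) % m
      ≡ (toℕ (shift w (col x)) + toℕ (shift x (col w))) % m
    code-≡ {v} {w} {x} {y} vw xy = cong₂ (λ a b → (toℕ a + toℕ b) % m)
      (trans (same-shift vw (col y)) (cong (shift w) (sym (same-col xy))))
      (trans (sym (same-shift xy (col v))) (cong (shift x) (same-col vw)))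

    downwards-≡ : ∀ {v y w x} → col v ≡ col w → col y ≡ col x → downwards v y ≡ downwards w x
    downwards-≡ cvw cyx = cong₂ (λ a b → if does (a FinP.<? b) then ℓ else 0) cvw cyx

    -- Between the same two colours, edges of opposite time direction have exactly one code raised
    -- by ℓ, while a label alone is below ℓ.
    code-opposite : ∀ {v y x w} → back v y ≡ true → back x w ≡ true → col v ≡ col w → col x ≡ col y → code v y ≢ code x w
    code-opposite {v} {y} {x} {w} vy xw cvw cxy e with FinP.<-cmp (col v) (col y)
    ... | tri≈ _ eq _ = col-back vy (sym eq)
    ... | tri< lt _ ¬gt = <⇒≱ (label< xw) (begin
      ℓ ≤⟨ m≤n+m ℓ (label v y) ⟩
      label v y + ℓ ≡⟨ cong (label v y +_) (cong (λ b → if b then ℓ else 0) (dec-true (col v FinP.<? col y) lt)) ⟨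
      code v y ≡⟨ e ⟩
      code x w ≡⟨ cong (label x w +_) (trans (downwards-≡ cxy (sym cvw)) (cong (λ b → if b then ℓ else 0) (dec-false (col y FinP.<? col v) ¬gt))) ⟩
      label x w + 0 ≡⟨ +-identityʳ _ ⟩
      label x w ∎)
      where open ≤-Reasoning
    ... | tri> ¬lt _ gt = <⇒≱ (label< vy) (begin
      ℓ ≤⟨ m≤n+m ℓ (label x w) ⟩
      label x w + ℓ ≡⟨ cong (label x w +_) (trans (downwards-≡ cxy (sym cvw)) (cong (λ b → if b then ℓ else 0) (dec-true (col y FinP.<? col v) gt))) ⟨
      code x w ≡⟨ e ⟨
      code v y ≡⟨ cong (label v y +_) (cong (λ b → if b then ℓ else 0) (dec-false (col v FinP.<? col y) ¬lt)) ⟩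
      label v y + 0 ≡⟨ +-identityʳ _ ⟩
      label v y ∎)
      where open ≤-Reasoning

    orient : ∀ {u v} → Edge G u v → back u v ≡ true ⊎ back v u ≡ true
    orient {u} {v} e = Splitting.Edge⇒Adj E e

  tracks : TrackLayout G (suc k * m ^ suc k)
  tracks = record
    { col = toℕ ∘ track ; ord = ord ; col< = FinP.toℕ<n ∘ track ; ord-inj = λ _ → ord-inj
    ; proper = λ e c → let cc = same-col (FinP.toℕ-injective c) in [ (λ b → col-back b (sym cc)) , (λ b → col-back b cc) ]′ (orient e)
    ; no-X = λ cvw cxy v<w x<y vy wx → no-X' (FinP.toℕ-injective cvw) (FinP.toℕ-injective cxy) v<w x<y (orient vy) (orient wx)
    }
    where
    solved : ∀ {v u} → back v u ≡ true → (toℕ (shift v (col u)) + toℕ (shift u (col v))) % m ≡ code v u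
    solved {v} {u} b = proj₂ shifts v u b
    solved' : ∀ {v u} → back v u ≡ true → (toℕ (shift u (col v)) + toℕ (shift v (col u))) % m ≡ code v u
    solved' {v} {u} b = trans (cong (_% m) (+-comm (toℕ (shift u (col v))) _)) (solved b)
    no-X' : ∀ {v w x y} → track v ≡ track w → track x ≡ track y → ord v < ord w → ord x < ord y →
      back v y ≡ true ⊎ back y v ≡ true → back w x ≡ true ⊎ back x w ≡ true → ⊥
    no-X' {v} {w} {x} {y} vw xy v<w x<y (inj₁ vy) (inj₁ wx) = <⇒≱ x<y (mono vy wx (+-cancelʳ-≡ (downwards w x) _ _
      (trans (cong (label v y +_) (downwards-≡ (sym (same-col vw)) (same-col xy))) (trans (sym (solved vy)) (trans (code-≡ vw xy) (solved wx))))) (<⇒≤ v<w))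
    no-X' {v} {w} {x} {y} vw xy v<w x<y (inj₂ yv) (inj₂ xw) = <⇒≱ v<w (mono xw yv (+-cancelʳ-≡ (downwards y v) _ _
      (trans (cong (label x w +_) (downwards-≡ (sym (same-col xy)) (same-col vw))) (trans (sym (solved' xw)) (trans (sym (code-≡ vw xy)) (solved' yv))))) (<⇒≤ x<y))
    no-X' vw xy v<w x<y (inj₁ vy) (inj₂ xw) = code-opposite vy xw (same-col vw) (same-col xy)
      (trans (sym (solved vy)) (trans (code-≡ vw xy) (solved' xw)))
    no-X' vw xy v<w x<y (inj₂ yv) (inj₁ wx) = code-opposite wx yv (sym (same-col vw)) (sym (same-col xy))
      (trans (sym (solved wx)) (trans (sym (code-≡ vw xy)) (solved' yv)))

labelling⇒tracks : ∀ {n} {G : Graph n} {k ℓ} (E : Elimination G k) → Labelling E ℓ → TrackLayout G (suc k * suc (ℓ + ℓ) ^ suc k)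
labelling⇒tracks E L = LabelledTracks.tracks E L (proj₁ colouring) λ {v} {u} b → proj₂ colouring v u b (Elimination.back-< E b)
  where
  colouring = greedy (Elimination.time E) (Elimination.back E) (Elimination.back-count E)

-- Numerical bounds and the theorem

binary-bracket : ∀ n → 1 ≤ n → ∃[ a ] (2 ^ a ≤ n × n < 2 ^ suc a)
binary-bracket (suc zero) _ = 0 , ≤-refl , ≤-refl
binary-bracket (suc n@(suc _)) _ with binary-bracket n (s≤s z≤n)
... | a , le , lt with m≤n⇒m<n∨m≡n lt
...   | inj₁ lt' = a , m≤n⇒m≤1+n le , lt'
...   | inj₂ eq  = suc a , ≤-reflexive (sym eq) , subst (_< 2 ^ suc (suc a)) (sym eq) (^-monoʳ-< 2 (s≤s (s≤s z≤n)) (n<1+n (suc a)))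

-- A bag containing an edge has two vertices. Here the assumed edge allows `suc k` to be absorbed
-- into a multiple of k.
edge⇒width≥1 : ∀ {n m k} {G : Graph n} {T : Tree m} (D : TreeDecomposition G m T) → TDWidth≤ D k → HasEdge G → 1 ≤ k
edge⇒width≥1 {G = G} D width (u , v , e) with edge-in D u v e
... | x , xu , xv = ≤-pred (begin
  2 ≤⟨ s≤s (count-pos {p = inBag x ∖ v} (∖-true (inBag x) (∈⇒inBag xu) λ { refl → true≢false (trans (sym e) (adj-irr G u)) })) ⟩
  suc (count (inBag x ∖ v)) ≤⟨ count-∖< (inBag x) (∈⇒inBag xv) ⟩
  count (inBag x) ≡⟨ count-Subset (bag D x) ⟨
  Subset.∣ bag D x ∣ ≤⟨ width x ⟩
  _ ∎)
  where
  open ≤-Reasoning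
  open Tops D

-- The number (4^k - 1) / 3, given by a recursion free of truncated subtraction and division.
third : ℕ → ℕ
third zero    = 0
third (suc k) = 4 * third k + 1

-- The number (4^k - 3k - 1) / 9, the exponent of 6 in `Tbound`.
ninth : ℕ → ℕ
ninth zero    = 0
ninth (suc k) = ninth k + third k

4^k≡third : ∀ k → 4 ^ k ≡ 3 * third k + 1
4^k≡third zero    = refl
4^k≡third (suc k) = trans (cong (4 *_) (4^k≡third k)) (expand (third k))
  where
  expand : ∀ s → 4 * (3 * s + 1) ≡ 3 * (4 * s + 1) + 1
  expand = ℕR.solve-∀

third≡ninth : ∀ k → third k ≡ 3 * ninth k + k
third≡ninth zero    = refl
third≡ninth (suc k) = trans (cong (λ s → 4 * s + 1) (third≡ninth k))
  (trans (collect (ninth k) k) (cong (λ s → 3 * (ninth k + s) + suc k) (sym (third≡ninth k))))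
  where
  collect : ∀ e k → 4 * (3 * e + k) + 1 ≡ 3 * (e + (3 * e + k)) + (1 + k)
  collect = ℕR.solve-∀

Tbound≡ : ∀ k → Tbound k ≡ 3 ^ k * 6 ^ ninth k
Tbound≡ k = cong (λ e → 3 ^ k * 6 ^ e) (begin
  (4 ^ k ∸ 3 * k ∸ 1) / 9 ≡⟨ cong (λ x → (x ∸ 3 * k ∸ 1) / 9) (trans (4^k≡third k) (trans (cong (λ s → 3 * s + 1) (third≡ninth k)) (collect (ninth k) k))) ⟩
  (ninth k * 9 + 1 + 3 * k ∸ 3 * k ∸ 1) / 9 ≡⟨ cong (λ x → (x ∸ 1) / 9) (m+n∸n≡m (ninth k * 9 + 1) (3 * k)) ⟩
  (ninth k * 9 + 1 ∸ 1) / 9 ≡⟨ cong (_/ 9) (m+n∸n≡m (ninth k * 9) 1) ⟩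
  ninth k * 9 / 9 ≡⟨ m*n/n≡m (ninth k) 9 ⟩
  ninth k ∎)
  where
  open ≡-Reasoning
  collect : ∀ e k → 3 * (3 * e + k) + 1 ≡ e * 9 + 1 + 3 * k
  collect = ℕR.solve-∀

-- From k = 2 on, the increment 2k + 3 of the square is at most twice `third k`, the increment of
-- the right side. The constant 9 covers the start.
[1+k]²≤ : ∀ k → suc k * suc k ≤ 9 + 2 * ninth k
[1+k]²≤ 0 = s≤s z≤n
[1+k]²≤ 1 = toWitness {a? = 4 ≤? 9} tt
[1+k]²≤ (suc (suc k)) = proj₁ (go k)
  where
  grow : ∀ k s → k + 4 ≤ s → suc k + 4 ≤ 4 * s + 1
  grow k s le = linear (3 * s) le (slack k s)
    where
    slack : ∀ k s → 1 + k + 4 + s + 3 * s ≡ 4 * s + 1 + (k + 4)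
    slack = ℕR.solve-∀
  go : ∀ k → (3 + k) * (3 + k) ≤ 9 + 2 * ninth (2 + k) × k + 4 ≤ third (2 + k)
  go zero = toWitness {a? = 9 ≤? 11} tt , toWitness {a? = 4 ≤? 5} tt
  go (suc k) with go k
  ... | sq , le = linear 1 (+-mono-≤ sq (*-monoʳ-≤ 2 le)) (slack k (ninth (2 + k)) (third (2 + k))) , grow k (third (2 + k)) le
    where
    slack : ∀ k e s → (4 + k) * (4 + k) + (9 + 2 * e + 2 * s) + 1 ≡ 9 + 2 * (e + s) + ((3 + k) * (3 + k) + 2 * (k + 4))
    slack = ℕR.solve-∀

queues≡ : ∀ k → suc (queues k) ≡ 2 ^ k
queues≡ zero    = refl
queues≡ (suc k) = cong₂ _+_ (queues≡ k) (trans (queues≡ k) (sym (+-identityʳ (2 ^ k))))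

-- The modulus is 2^(k+1) - 1 and k + 1 <= 3^k, so the question is how 2^((k+1)^2) compares with T.
-- It is at most 2^9 times 4^e, where e is the exponent of 6 in T.
labelled-tracks≤ : ∀ k → suc k * suc (queues k + queues k) ^ suc k ≤ 2 ^ 9 * Tbound k
labelled-tracks≤ k = begin
  suc k * suc (queues k + queues k) ^ suc k ≤⟨ *-mono-≤ (n<p^n (s≤s (s≤s z≤n)) k) (^-monoˡ-≤ (suc k) m≤) ⟩
  3 ^ k * (2 ^ suc k) ^ suc k ≡⟨ cong (3 ^ k *_) (^-*-assoc 2 (suc k) (suc k)) ⟩
  3 ^ k * 2 ^ (suc k * suc k) ≤⟨ *-monoʳ-≤ (3 ^ k) (^-monoʳ-≤ 2 ([1+k]²≤ k)) ⟩
  3 ^ k * 2 ^ (9 + 2 * ninth k) ≡⟨ cong (3 ^ k *_) (^-distribˡ-+-* 2 9 (2 * ninth k)) ⟩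
  3 ^ k * (2 ^ 9 * 2 ^ (2 * ninth k)) ≡⟨ shuffle (3 ^ k) (2 ^ 9) (2 ^ (2 * ninth k)) ⟩
  2 ^ 9 * (3 ^ k * 2 ^ (2 * ninth k)) ≡⟨ cong (λ x → 2 ^ 9 * (3 ^ k * x)) (^-*-assoc 2 2 (ninth k)) ⟨
  2 ^ 9 * (3 ^ k * 4 ^ ninth k) ≤⟨ *-monoʳ-≤ (2 ^ 9) (*-monoʳ-≤ (3 ^ k) (^-monoˡ-≤ (ninth k) (m≤m+n 4 2))) ⟩
  2 ^ 9 * (3 ^ k * 6 ^ ninth k) ≡⟨ cong (2 ^ 9 *_) (Tbound≡ k) ⟨
  2 ^ 9 * Tbound k ∎
  where
  open ≤-Reasoning
  shuffle : ∀ a b c → a * (b * c) ≡ b * (a * c)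
  shuffle = ℕR.solve-∀
  m≤ : suc (queues k + queues k) ≤ 2 ^ suc k
  m≤ = ≤-trans (n≤1+n _) (≤-reflexive (trans (cong suc (sym (+-suc (queues k) (queues k)))) (queues≡ (suc k))))

-- `B` converts tracks into box sides and `K` counts tracks. The bound with the degree needs 144 = 3
-- * 2 * 12 * 2, the one with T needs 2^9; the other cases need only 2, 3 and 5.
module Assembly (B : ℕ)
  (draw : ∀ {n} {G : Graph n} {t} → 1 ≤ n → 1 ≤ t → TrackLayout G t → HasDrawing G (B * t) (B * t) (B * n))
  (K : ℕ) (2^9≤K : 2 ^ 9 ≤ K) (144≤K : 144 ≤ K) where

  c : ℕ
  c = B * K

  1≤K : 1 ≤ K
  1≤K = ≤-trans (m≤m+n 1 143) 144≤K

  module _ {n} (G : Graph n) (has-edge : HasEdge G) where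

    1≤n : 1 ≤ n
    1≤n = ≤-trans (s≤s z≤n) (FinP.toℕ<n (proj₁ has-edge))

    Cx≤cy : ∀ {x y} → x ≤ K * y → B * x ≤ c * y
    Cx≤cy {x} {y} le = ≤-trans (*-monoʳ-≤ B le) (≤-reflexive (sym (*-assoc B K y)))

    tracks⇒box : ∀ {t} x → 1 ≤ t → t ≤ K * x → TrackLayout G t → HasDrawing G (c * x) (c * x) (c * n)
    tracks⇒box {t} x 1≤t le L = HasDrawing-mono (Cx≤cy le) (Cx≤cy le) (Cx≤cy (m≤n*m n K {{>-nonZero 1≤K}})) (draw 1≤n 1≤t L)

    pathwidth-box : ∀ pw → HasPD G pw → HasDrawing G (c * pw) (c * pw) (c * n)
    pathwidth-box pw P@(_ , D , width) = tracks⇒box pw (s≤s z≤n)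
      (≤-trans (+-monoˡ-≤ pw (edge⇒width≥1 D width has-edge)) (≤-trans (≤-reflexive (cong (pw +_) (sym (+-identityʳ pw)))) (*-monoˡ-≤ pw (≤-trans (m≤m+n 2 142) 144≤K))))
      (separation⇒tracks (pathwidth⇒separation P))

    treewidth≥1 : ∀ {tw} → HasTD G tw → 1 ≤ tw
    treewidth≥1 (_ , _ , D , width) = edge⇒width≥1 D width has-edge

    -- The condition 2^X <= n^(c tw) says X <= c tw log n without real logarithms. With a the
    -- integer part of log n, the track count 1 + (1 + a) (1 + tw) is at most 5 a tw, as n >= 2
    -- gives a >= 1.
    log-box : ∀ tw → HasTD G tw → 2 ≤ n →
      ∃[ X ] ∃[ Y ] (2 ^ X ≤ n ^ (c * tw) × 2 ^ Y ≤ n ^ (c * tw) × HasDrawing G X Y (c * n))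
    log-box tw T 2≤n = box (binary-bracket n 1≤n)
      where
      open ≤-Reasoning
      box : ∃[ a ] (2 ^ a ≤ n × n < 2 ^ suc a) → _
      box (a , lo , hi) = B * t , B * t , small , small ,
        HasDrawing-mono ≤-refl ≤-refl (Cx≤cy (m≤n*m n K {{>-nonZero 1≤K}}))
          (draw 1≤n (s≤s z≤n) (separation⇒tracks (treewidth⇒separation (elimination T) (suc a) hi)))
        where
        t = suc (suc a * suc tw)
        1≤a : 1 ≤ a
        1≤a = n≢0⇒n>0 λ { refl → <⇒≱ hi 2≤n }
        t≤ : t ≤ 5 * (a * tw)
        t≤ = begin
          1 + (1 + a) * (1 + tw) ≤⟨ +-mono-≤ (*-mono-≤ 1≤a 1≤tw) (*-mono-≤ (+-monoˡ-≤ a 1≤a) (+-monoˡ-≤ tw 1≤tw)) ⟩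
          a * tw + (a + a) * (tw + tw) ≡⟨ collect a tw ⟩
          5 * (a * tw) ∎
          where
          1≤tw = treewidth≥1 T
          collect : ∀ a t → a * t + (a + a) * (t + t) ≡ 5 * (a * t)
          collect = ℕR.solve-∀
        small : 2 ^ (B * t) ≤ n ^ (c * tw)
        small = begin
          2 ^ (B * t) ≤⟨ ^-monoʳ-≤ 2 (*-monoʳ-≤ B (≤-trans t≤ (*-monoˡ-≤ (a * tw) (≤-trans (m≤m+n 5 139) 144≤K)))) ⟩
          2 ^ (B * (K * (a * tw))) ≡⟨ cong (2 ^_) (shuffle B K a tw) ⟩
          2 ^ (a * (c * tw)) ≡⟨ ^-*-assoc 2 a (c * tw) ⟨
          (2 ^ a) ^ (c * tw) ≤⟨ ^-monoˡ-≤ (c * tw) lo ⟩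
          n ^ (c * tw) ∎
          where
          shuffle : ∀ B K a t → B * (K * (a * t)) ≡ a * (B * K * t)
          shuffle = ℕR.solve-∀

    partition-box : ∀ tpw → HasTP G tpw → HasDrawing G (c * tpw) (c * tpw) (c * n)
    partition-box tpw P = tracks⇒box tpw (≤-trans 1≤tpw (m≤n*m tpw 3)) (*-monoˡ-≤ tpw (≤-trans (m≤m+n 3 141) 144≤K)) (addresses⇒tracks A)
      where
      A = tree-partition⇒addresses P
      open AddressPartition A
      u = proj₁ has-edge
      1≤tpw : 1 ≤ tpw
      1≤tpw = ≤-trans (count-pos {p = λ v → does (addr v ≟ᴸ addr u)} {u} (dec-true (addr u ≟ᴸ addr u) refl)) (size (addr u))

    degree-box : ∀ tw → HasTD G tw → HasDrawing G (c * (maxDeg G * tw)) (c * (maxDeg G * tw)) (c * n)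
    degree-box tw T = tracks⇒box (maxDeg G * tw) 1≤t bound (addresses⇒tracks (bounded-degree-partition (elimination T) 1≤Δ))
      where
      open ≤-Reasoning
      Δ = maxDeg G
      1≤Δ : 1 ≤ Δ
      1≤Δ = ≤-trans (count-pos {p = adj G (proj₁ has-edge)} (proj₂ (proj₂ has-edge))) (degree≤ G (proj₁ has-edge))
      1≤t : 1 ≤ 3 * (2 * (Δ * (12 * suc tw)))
      1≤t = *-mono-≤ {1} {3} (s≤s z≤n) (*-mono-≤ {1} {2} (s≤s z≤n) (*-mono-≤ 1≤Δ (s≤s z≤n)))
      collect : ∀ Δ t → 3 * (2 * (Δ * (12 * (t + t)))) ≡ 144 * (Δ * t)
      collect = ℕR.solve-∀
      bound : 3 * (2 * (Δ * (12 * suc tw))) ≤ K * (Δ * tw)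
      bound = begin
        3 * (2 * (Δ * (12 * suc tw))) ≤⟨ *-monoʳ-≤ 3 (*-monoʳ-≤ 2 (*-monoʳ-≤ Δ (*-monoʳ-≤ 12 (+-monoˡ-≤ tw (treewidth≥1 T))))) ⟩
        3 * (2 * (Δ * (12 * (tw + tw)))) ≡⟨ collect Δ tw ⟩
        144 * (Δ * tw) ≤⟨ *-monoˡ-≤ (Δ * tw) 144≤K ⟩
        K * (Δ * tw) ∎

    Tbound-box : ∀ tw → HasTD G tw → HasDrawing G (c * Tbound tw) (c * Tbound tw) (c * n)
    Tbound-box tw T = tracks⇒box (Tbound tw) (*-mono-≤ {1} {suc tw} (s≤s z≤n) (m^n>0 (suc (queues tw + queues tw)) (suc tw)))
      (≤-trans (labelled-tracks≤ tw) (*-monoˡ-≤ (Tbound tw) 2^9≤K))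
      (labelling⇒tracks E (labelling tw E))
      where E = elimination T

theorem2p11 : ∃[ c ] (∀ (n : ℕ) (G : Graph n) → HasEdge G →
    ∀ (pw tw tpw : ℕ) → IsPW G pw → IsTW G tw → IsTPW G tpw →
    (HasDrawing G (c * pw) (c * pw) (c * n)
    × (2 ≤ n → ∃[ X ] ∃[ Y ] (2 ^ X ≤ n ^ (c * tw) × 2 ^ Y ≤ n ^ (c * tw)
    × HasDrawing G X Y (c * n))))
    × (HasDrawing G (c * tpw) (c * tpw) (c * n)
    × HasDrawing G (c * (maxDeg G * tw)) (c * (maxDeg G * tw)) (c * n))
    × HasDrawing G (c * Tbound tw) (c * Tbound tw) (c * n))
theorem2p11 = A.c , λ n G e pw tw tpw (P , _) (T , _) (Q , _) →
  (A.pathwidth-box G e pw P , A.log-box G e tw T) , (A.partition-box G e tpw Q , A.degree-box G e tw T) , A.Tbound-box G e tw T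
  where module A = Assembly (proj₁ tracks⇒drawing) (proj₂ tracks⇒drawing) (2 ^ 9) ≤-refl (m≤m+n 144 368)
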